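{- Let $d \ge 2$ be an integer, let $G$ be a finite abelian group, and let $\varepsilon > 0$. Then there exists $C=C(d,G,\varepsilon)$ such that for every positive integer $n$, if $Z_0 \subset G$ is not contained in any strict coset in $G$ and $E_1,\dots,E_d$ are subsets of $G^n$ with $(E_1+\dots+E_d) \cap Z_0^n = \emptyset$, then there exist $I \subset [n]$ with $0<|I|<C$ and subsets $E_1',\dots,E_d'$ of $G^{I}$ satisfying \[ |E_j \setminus (E_j' \times G^{I^c})| \le \varepsilon |G^n| \text{ for all } j \in [d], \quad (E_1'+\dots+E_d') \cap Z_0^I = \emptyset. \]
   Context: A strict coset in $G$ is a set $H+\{x\}$ where $H$ is a subgroup of $G$ with $H\neq G$ and $x\in G$. $[n]=\{1,\dots,n\}$, $I^c=[n]\setminus I$. For $E'\subset G^I$, $E'\times G^{I^c}$ denotes the set of $x\in G^n$ with $(x_i)_{i\in I}\in E'$. $Z_0^I$ is the set of elements of $G^I$ with all coordinates in $Z_0$; sums of sets are Minkowski sums. -}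

module Defs where

open import Data.Nat using (ℕ; zero; suc; _+_; _*_; _^_; _≤_; _<_)
open import Data.Fin using (Fin)
import Data.Fin as F
open import Data.Fin.Subset using (Subset; _∈_; _∉_)
open import Data.Vec using (Vec; []; _∷_; lookup; tabulate)
open import Data.List using (List; []; _∷_; [_]; map; concatMap; allFin)
open import Data.Bool using (Bool; true; false; if_then_else_)
open import Data.Product using (Σ; ∃; _×_; _,_)
open import Relation.Binary.PropositionalEquality using (_≡_)
open import Relation.Nullary using (¬_)
open import Algebra.Structures using (IsAbelianGroup)
open import Level using (0ℓ)

-- A finite abelian group, presented with carrier Fin order
-- (every finite abelian group is isomorphic to one of these).
record FiniteAbelianGroup : Set where
  field
    order : ℕ
    _⊕_   : Fin order → Fin order → Fin order
    𝟘     : Fin order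
    ⊖_    : Fin order → Fin order
    isAbelianGroup : IsAbelianGroup _≡_ _⊕_ 𝟘 ⊖_

module _ (G : FiniteAbelianGroup) where
  open FiniteAbelianGroup G

  Elt : ℕ → Set
  Elt n = Vec (Fin order) n

  SubsetG^ : ℕ → Set
  SubsetG^ n = Elt n → Bool

  IsSubgroup : Subset order → Set
  IsSubgroup H = (𝟘 ∈ H)
               × (∀ a b → a ∈ H → b ∈ H → (a ⊕ b) ∈ H)
               × (∀ a → a ∈ H → (⊖ a) ∈ H)

  ⊆Coset : Subset order → Subset order → Fin order → Set
  ⊆Coset Z H x = ∀ z → z ∈ Z → ∃ λ h → h ∈ H × z ≡ h ⊕ x

  InStrictCoset : Subset order → Set
  InStrictCoset Z = Σ (Subset order) λ H → Σ (Fin order) λ x →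
    IsSubgroup H × (∃ λ g → g ∉ H) × ⊆Coset Z H x

  sumG : (d : ℕ) → (Fin d → Fin order) → Fin order
  sumG zero    f = 𝟘
  sumG (suc d) f = f F.zero ⊕ sumG d (λ j → f (F.suc j))

  SumsetAvoids : (d n : ℕ) → (Fin d → SubsetG^ n) → Subset order → Set
  SumsetAvoids d n E Z =
    ¬ (Σ (Fin d → Elt n) λ e →
         (∀ j → E j (e j) ≡ true)
       × (∀ i → sumG d (λ j → lookup (e j) i) ∈ Z))

  allElts : (n : ℕ) → List (Elt n)
  allElts zero    = [ [] ]
  allElts (suc n) = concatMap (λ a → map (a ∷_) (allElts n)) (allFin order)

  countB : ∀ {A : Set} → (A → Bool) → List A → ℕ
  countB P []       = 0
  countB P (x ∷ xs) = (if P x then 1 else 0) + countB P xs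

  card : (n : ℕ) → SubsetG^ n → ℕ
  card n P = countB P (allElts n)

  -- restriction of x ∈ G^n to the coordinates I = image of ι : Fin k → Fin n
  restrict : {n k : ℕ} → (Fin k → Fin n) → Elt n → Elt k
  restrict ι x = tabulate (λ i → lookup x (ι i))

  diffCyl : {n k : ℕ} → (Fin k → Fin n) → SubsetG^ n → SubsetG^ k → SubsetG^ n
  diffCyl ι E E' x = if E x then (if E' (restrict ι x) then false else true) else false

-- Fibring over a bounded set J of coordinates, it suffices to show that two subsets A, B of G^m with A + B missing a
-- translate of Z₀^m cannot both be dense when A stays dense under every restriction of boundedly many coordinates; an
-- energy increment provides J such that most dense fibres of E₁ have this property, and the remaining fibres are discarded.
--
-- For the two-set statement let Ω consist of the singletons {g} and the sets Z₀ - y, choose ω ∈ Ω^m with independent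
-- coordinates, of the second kind with probability t, and let F(ω) = 1 if A meets ω₁ × ... × ω_m. By the mean value
-- theorem E F has a bounded derivative at some t ∈ [¼, ¾]. As Z₀ lies in no strict coset, the inclusion graph of Ω is
-- connected, so the total influence of F is bounded as well, and by Friedgut's theorem (hypercontractivity and
-- log-convexity of the noise semigroup) F is close to a junta. But F = 1 with probability bounded below under any
-- restriction of the junta coordinates, since A is hit so often, and F = 0 with probability at least the density of B,
-- as this holds at t = 1 and F is monotone.

module Submission where

-- They are replaced by one family of operators `T` with a rate for each coordinate, whose rates
-- multiply under composition. The obstacle is a mismatch of rates: the bound from L² to L⁴ is
-- available only at a small rate σ governed by the least atom of the measure, while bounded total
-- influence limits the energy loss only at a rate ρ close to 1. Log-convexity along the powers of ρ
-- links the two, at the price of a factor ½ per step. The least atom is also why t must stay away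
-- from 0 and 1.
--
-- Density of A passes to F because each set in Ω contains a selected point whose law is uniform for
-- every t.
--
-- For d > 2 only E₁ has to be made spread. E₂ serves as B, one point is chosen in a fibre of each
-- further set, and the sum of these points is the translation.
--
-- The error is budgeted as 4 α = 1/q: 2 α for sparse fibres of E₁ and 2 α for its dense fibres that
-- are not spread.

module Development where

  open import Defs
  open import Data.Rational hiding (∣_∣)
  open import Data.Rational.Properties
  open import Data.Rational.Solver
  open import Data.Bool using (Bool; true; false; if_then_else_; _∧_)
  import Data.Bool as Bool
  open import Data.Empty using (⊥-elim)
  import Data.Empty as Empty
  open import Data.Fin using (Fin; zero; suc)
  open import Data.Fin.Permutation using (permutation)
  import Data.Fin.Properties as Fin
  open import Data.Fin.Subset using (Subset; _∈_; _∩_; _∪_; ∣_∣; ⊥; ⁅_⁆)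
  open import Data.Fin.Subset.Properties using (_∈?_)
  import Data.Fin.Subset.Properties as Subset
  import Data.Integer as ℤ
  import Data.Integer.Properties as ℤ
  open import Data.List as List using (List; concatMap; _++_)
  open import Data.Nat as ℕ using (ℕ; zero; suc)
  import Data.Nat.Properties as ℕ
  open import Data.Product using (Σ; ∃; _×_; _,_; proj₁; proj₂)
  open import Data.Rational.Unnormalised as ℚᵘ using (mkℚᵘ; *≡*; *≤*)
  import Data.Rational.Unnormalised.Properties as ℚᵘ
  open import Data.Sum using (_⊎_; inj₁; inj₂)
  open import Data.Vec using (Vec; []; _∷_; lookup; map; replicate; tabulate; zipWith; _[_]≔_)
  import Data.Vec.Properties as Vec
  open import Data.Vec.Relation.Unary.All using (All; []; _∷_)
  open import Function using (_∘_; id)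
  open import Function.Definitions using (Injective)
  open import Relation.Binary.PropositionalEquality hiding (J; [_])
  open import Relation.Nullary using (Dec; yes; no; ¬_; does; ¬?; _×-dec_)
  import Relation.Nullary.Decidable as Dec
  open import Algebra.Bundles using (AbelianGroup; CommutativeRing)
  import Algebra.Properties.AbelianGroup
  import Algebra.Properties.Semiring.Sum

  open +-*-Solver using (solve; con; _:=_; _:+_; _:*_; _:-_; :-_)
  open ≤-Reasoning
  open Algebra.Properties.Semiring.Sum (CommutativeRing.semiring +-*-commutativeRing)
    using (sum; sum-cong-≗; ∑-distrib-+; ∑-comm; sum-permute; *-distribˡ-sum)

  -- Rational arithmetic, powers and finite sums

  sq : ℚ → ℚ
  sq x = x * x

  2ℚ : ℚ
  2ℚ = 1ℚ + 1ℚ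

  4ℚ : ℚ
  4ℚ = 2ℚ + 2ℚ

  0≤1 : 0ℚ ≤ 1ℚ
  0≤1 = nonNegative⁻¹ 1ℚ

  0≤2 : 0ℚ ≤ 2ℚ
  0≤2 = nonNegative⁻¹ 2ℚ

  0≤½ : 0ℚ ≤ ½
  0≤½ = nonNegative⁻¹ ½

  ½<1 : ½ < 1ℚ
  ½<1 = *<* (ℤ.+<+ (ℕ.s≤s (ℕ.s≤s ℕ.z≤n)))

  0≤+ : ∀ {a b} → 0ℚ ≤ a → 0ℚ ≤ b → 0ℚ ≤ a + b
  0≤+ {a} {b} p q = subst (_≤ a + b) (+-identityˡ 0ℚ) (+-mono-≤ p q)

  *-monoˡ : ∀ {a b c} → 0ℚ ≤ a → b ≤ c → a * b ≤ a * c
  *-monoˡ {a} 0≤a = *-monoˡ-≤-nonNeg a {{nonNegative 0≤a}}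

  *-monoʳ : ∀ {a b c} → 0ℚ ≤ a → b ≤ c → b * a ≤ c * a
  *-monoʳ {a} 0≤a = *-monoʳ-≤-nonNeg a {{nonNegative 0≤a}}

  0≤* : ∀ {a b} → 0ℚ ≤ a → 0ℚ ≤ b → 0ℚ ≤ a * b
  0≤* {a} {b} p q = subst (_≤ a * b) (*-zeroʳ a) (*-monoˡ p q)

  *-mono : ∀ {a b c d} → 0ℚ ≤ a → 0ℚ ≤ d → a ≤ b → c ≤ d → a * c ≤ b * d
  *-mono 0≤a 0≤d a≤b c≤d = ≤-trans (*-monoˡ 0≤a c≤d) (*-monoʳ 0≤d a≤b)

  0<* : ∀ {a b} → 0ℚ < a → 0ℚ < b → 0ℚ < a * b
  0<* {a} {b} p q = subst (_< a * b) (*-zeroʳ a) (*-monoʳ-<-pos a {{positive p}} q)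

  *-cancelˡ : ∀ {a b c} → 0ℚ < a → a * b ≤ a * c → b ≤ c
  *-cancelˡ {a} 0<a = *-cancelˡ-≤-pos a {{positive 0<a}}

  0≤sq : ∀ x → 0ℚ ≤ sq x
  0≤sq x with ≤-total 0ℚ x
  ... | inj₁ p = 0≤* p p
  ... | inj₂ p = subst (0ℚ ≤_) (solve 1 (λ x → (:- x) :* (:- x) := x :* x) refl x)
                   (0≤* (neg-antimono-≤ p) (neg-antimono-≤ p))

  sq-cancel-≤ : ∀ {a b} → 0ℚ ≤ b → sq a ≤ sq b → a ≤ b
  sq-cancel-≤ {a} {b} 0≤b p with a ≤? b
  ... | yes q = q
  ... | no q = ⊥-elim (<⇒≱ (≤-<-trans (*-monoˡ 0≤b (<⇒≤ b<a)) (*-monoˡ-<-pos a {{positive (≤-<-trans 0≤b b<a)}} b<a)) p)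
    where b<a = ≰⇒> q
          <⇒≱ : ∀ {x y} → x < y → ¬ (y ≤ x)
          <⇒≱ x<y y≤x = <-irrefl refl (<-≤-trans x<y y≤x)

  0≤-⇒≤ : ∀ {a b} → 0ℚ ≤ b - a → a ≤ b
  0≤-⇒≤ {a} {b} p = subst₂ _≤_ (+-identityˡ a) (solve 2 (λ a b → (b :- a) :+ a := b) refl a b) (+-monoˡ-≤ a p)

  ≤⇒0≤- : ∀ {a b} → a ≤ b → 0ℚ ≤ b - a
  ≤⇒0≤- {a} {b} p = subst (_≤ b - a) (+-inverseʳ a) (+-monoˡ-≤ (- a) p)

  ≤-by : ∀ {a b e} → 0ℚ ≤ e → b - a ≡ e → a ≤ b
  ≤-by p q = 0≤-⇒≤ (subst (0ℚ ≤_) (sym q) p)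

  ≤⇒¬< : ∀ {a b} → a ≤ b → ¬ (b < a)
  ≤⇒¬< a≤b b<a = <-irrefl refl (≤-<-trans a≤b b<a)

  -- Recursive, so that `ι (suc n)` unfolds to `1ℚ + ι n` and the ring solver can treat `ι n` as an
  -- atom.
  ι : ℕ → ℚ
  ι zero    = 0ℚ
  ι (suc n) = 1ℚ + ι n

  0≤ι : ∀ n → 0ℚ ≤ ι n
  0≤ι zero    = ≤-refl
  0≤ι (suc n) = 0≤+ 0≤1 (0≤ι n)

  0<ιsuc : ∀ n → 0ℚ < ι (suc n)
  0<ιsuc n = <-≤-trans (positive⁻¹ 1ℚ) (subst (_≤ 1ℚ + ι n) (+-identityʳ 1ℚ) (+-monoʳ-≤ 1ℚ (0≤ι n)))

  ι-+ : ∀ m n → ι (m ℕ.+ n) ≡ ι m + ι n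
  ι-+ zero n    = sym (+-identityˡ _)
  ι-+ (suc m) n = trans (cong (1ℚ +_) (ι-+ m n)) (sym (+-assoc 1ℚ (ι m) (ι n)))

  ι-* : ∀ m n → ι (m ℕ.* n) ≡ ι m * ι n
  ι-* zero n    = sym (*-zeroˡ (ι n))
  ι-* (suc m) n = trans (ι-+ n (m ℕ.* n)) (trans (cong (ι n +_) (ι-* m n))
    (solve 2 (λ m n → n :+ m :* n := (con 1ℚ :+ m) :* n) refl (ι m) (ι n)))

  ι-mono : ∀ {m n} → m ℕ.≤ n → ι m ≤ ι n
  ι-mono {n = n} ℕ.z≤n = 0≤ι n
  ι-mono (ℕ.s≤s p) = +-monoʳ-≤ 1ℚ (ι-mono p)

  ι-cancel-≤ : ∀ {m n} → ι m ≤ ι n → m ℕ.≤ n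
  ι-cancel-≤ {m} {n} p with m ℕ.≤? n
  ... | yes q = q
  ... | no q = ⊥-elim (≤⇒¬< p (<-≤-trans n<1+n (ι-mono (ℕ.≰⇒> q))))
    where n<1+n : ι n < ι (suc n)
          n<1+n = subst (_< ι (suc n)) (+-identityˡ (ι n)) (+-monoˡ-< (ι n) (positive⁻¹ 1ℚ))

  ι≡/1 : ∀ n → ι n ≡ ℤ.+ n / 1
  ι≡/1 zero = refl
  ι≡/1 (suc n) = trans (cong (1ℚ +_) (ι≡/1 n)) (toℚᵘ-injective (begin-≃ n))
    where
    begin-≃ : ∀ n → toℚᵘ (1ℚ + ℤ.+ n / 1) ℚᵘ.≃ toℚᵘ (ℤ.+ suc n / 1)
    begin-≃ n = ℚᵘ.≃-trans (toℚᵘ-homo-+ 1ℚ (ℤ.+ n / 1))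
      (ℚᵘ.≃-trans (ℚᵘ.+-cong (ℚᵘ.≃-refl {toℚᵘ 1ℚ}) (toℚᵘ-fromℚᵘ (mkℚᵘ (ℤ.+ n) 0)))
      (ℚᵘ.≃-trans (*≡* (cong (λ i → (ℤ.1ℤ ℤ.+ i) ℤ.* ℤ.1ℤ) (ℤ.*-identityʳ (ℤ.+ n))))
        (ℚᵘ.≃-sym (toℚᵘ-fromℚᵘ (mkℚᵘ (ℤ.+ suc n) 0)))))

  archimedean : ∀ x → Σ ℕ λ n → x ≤ ι n
  archimedean x@record{} = ℤ.∣ ↥ x ∣ , subst (x ≤_) (sym (ι≡/1 ℤ.∣ ↥ x ∣)) (toℚᵘ-cancel-≤ lemma)
    where
    k = ℤ.∣ ↥ x ∣
    i≤∣i∣ : ∀ i → i ℤ.≤ ℤ.+ ℤ.∣ i ∣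
    i≤∣i∣ (ℤ.+ n) = ℤ.≤-refl
    i≤∣i∣ (ℤ.-[1+ n ]) = ℤ.-≤+
    step : ↥ x ℤ.* ℤ.+ 1 ℤ.≤ ℤ.+ k ℤ.* ↧ x
    step = ℤ.≤-trans (ℤ.≤-reflexive (ℤ.*-identityʳ (↥ x))) (ℤ.≤-trans (i≤∣i∣ (↥ x))
      (subst (ℤ.+ k ℤ.≤_) (ℤ.pos-* k (↧ₙ x)) (ℤ.+≤+ (ℕ.m≤m*n k (↧ₙ x)))))
    lemma : toℚᵘ x ℚᵘ.≤ toℚᵘ (ℤ.+ k / 1)
    lemma = ℚᵘ.≤-respʳ-≃ (ℚᵘ.≃-sym (toℚᵘ-fromℚᵘ (mkℚᵘ (ℤ.+ k) 0))) (*≤* step)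

  1/-pos : ∀ x → 0ℚ < x → Σ ℚ λ y → 0ℚ < y × x * y ≡ 1ℚ
  1/-pos x 0<x = _ , positive⁻¹ _ {{1/pos⇒pos x {{positive 0<x}}}} , *-inverseʳ x {{pos⇒nonZero x {{positive 0<x}}}}

  pow : ℚ → ℕ → ℚ
  pow x zero    = 1ℚ
  pow x (suc n) = x * pow x n

  0≤pow : ∀ {x} n → 0ℚ ≤ x → 0ℚ ≤ pow x n
  0≤pow zero    p = 0≤1
  0≤pow (suc n) p = 0≤* p (0≤pow n p)

  0<pow : ∀ {x} n → 0ℚ < x → 0ℚ < pow x n
  0<pow zero    p = positive⁻¹ 1ℚ
  0<pow (suc n) p = 0<* p (0<pow n p)

  pow≤1 : ∀ {x} n → 0ℚ ≤ x → x ≤ 1ℚ → pow x n ≤ 1ℚ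
  pow≤1 zero p q = ≤-refl
  pow≤1 {x} (suc n) p q = *-mono p 0≤1 q (pow≤1 n p q)

  pow-anti : ∀ {x m n} → 0ℚ ≤ x → x ≤ 1ℚ → m ℕ.≤ n → pow x n ≤ pow x m
  pow-anti p q (ℕ.z≤n {n}) = pow≤1 n p q
  pow-anti p q (ℕ.s≤s r) = *-monoˡ p (pow-anti p q r)

  ι-^ : ∀ m n → ι (m ℕ.^ n) ≡ pow (ι m) n
  ι-^ m zero = refl
  ι-^ m (suc n) = trans (ι-* m (m ℕ.^ n)) (cong (ι m *_) (ι-^ m n))

  -- Division-free form of x^m ≤ 1 / (1 + m (1 - x)): from m to m + 1 the left side drops by x^m (m
  -- + 1) (1 - x)².
  bernoulli : ∀ {x} m → 0ℚ ≤ x → x ≤ 1ℚ → pow x m * (1ℚ + ι m * (1ℚ - x)) ≤ 1ℚ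
  bernoulli {x} zero p q = ≤-reflexive (solve 1 (λ x → con 1ℚ :* (con 1ℚ :+ con 0ℚ :* (con 1ℚ :- x)) := con 1ℚ) refl x)
  bernoulli {x} (suc m) p q = ≤-trans
    (≤-by (0≤* (0≤* (0≤pow m p) (0≤+ 0≤1 (0≤ι m))) (0≤sq (1ℚ - x)))
      (solve 3 (λ x y m → y :* (con 1ℚ :+ m :* (con 1ℚ :- x)) :- x :* y :* (con 1ℚ :+ (con 1ℚ :+ m) :* (con 1ℚ :- x))
         := y :* (con 1ℚ :+ m) :* ((con 1ℚ :- x) :* (con 1ℚ :- x))) refl x (pow x m) (ι m)))
    (bernoulli m p q)

  pow-small : ∀ {x σ} → 0ℚ ≤ x → x < 1ℚ → 0ℚ < σ → Σ ℕ λ m → pow x m ≤ σ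
  pow-small {x} {σ} 0≤x x<1 0<σ with 1/-pos (σ * (1ℚ - x)) (0<* 0<σ (subst (_< 1ℚ - x) (+-inverseʳ x) (+-monoˡ-< (- x) x<1)))
  ... | y , 0<y , e with archimedean y
  ... | m , y≤m = m , *-cancelˡ (0<* 0<y 0<1-x) (begin
    y * (1ℚ - x) * pow x m            ≤⟨ *-monoʳ (0≤pow m 0≤x) (*-monoʳ (<⇒≤ 0<1-x) y≤m) ⟩
    ι m * (1ℚ - x) * pow x m          ≤⟨ ≤-by (0≤pow m 0≤x) (solve 3 (λ x y m → y :* (con 1ℚ :+ m :* (con 1ℚ :- x)) :- m :* (con 1ℚ :- x) :* y := y) refl x (pow x m) (ι m)) ⟩
    pow x m * (1ℚ + ι m * (1ℚ - x))   ≤⟨ bernoulli m 0≤x (<⇒≤ x<1) ⟩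
    1ℚ                                ≡⟨ e ⟨
    σ * (1ℚ - x) * y                  ≡⟨ solve 3 (λ s d y → s :* d :* y := y :* d :* s) refl σ (1ℚ - x) y ⟩
    y * (1ℚ - x) * σ                  ∎)
    where
    open ≤-Reasoning
    0<1-x : 0ℚ < 1ℚ - x
    0<1-x = subst (_< 1ℚ - x) (+-inverseʳ x) (+-monoˡ-< (- x) x<1)

  sum-nonneg : ∀ {n} {f : Fin n → ℚ} → (∀ i → 0ℚ ≤ f i) → 0ℚ ≤ sum f
  sum-nonneg {zero}  p = ≤-refl
  sum-nonneg {suc n} p = 0≤+ (p zero) (sum-nonneg (λ i → p (suc i)))

  sum-mono : ∀ {n} {f g : Fin n → ℚ} → (∀ i → f i ≤ g i) → sum f ≤ sum g
  sum-mono {zero}  p = ≤-refl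
  sum-mono {suc n} p = +-mono-≤ (p zero) (sum-mono (λ i → p (suc i)))

  term≤sum : ∀ {n} {f : Fin n → ℚ} → (∀ i → 0ℚ ≤ f i) → ∀ i → f i ≤ sum f
  term≤sum {suc n} {f} p zero    = subst (_≤ sum f) (+-identityʳ (f zero)) (+-monoʳ-≤ (f zero) (sum-nonneg (λ i → p (suc i))))
  term≤sum {suc n} {f} p (suc i) = subst (_≤ sum f) (+-identityˡ (f (suc i))) (+-mono-≤ (p zero) (term≤sum (λ i → p (suc i)) i))

  sum-const : ∀ n x → sum {n} (λ _ → x) ≡ ι n * x
  sum-const zero x    = sym (*-zeroˡ x)
  sum-const (suc n) x = trans (cong (x +_) (sum-const n x)) (solve 2 (λ n x → x :+ n :* x := (con 1ℚ :+ n) :* x) refl (ι n) x)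

  -- Expectations as positive normalised linear functionals

  record Expectation (Ω : Set) : Set where
    field
      𝔼        : (Ω → ℚ) → ℚ
      𝔼-cong   : ∀ {f g} → (∀ a → f a ≡ g a) → 𝔼 f ≡ 𝔼 g
      𝔼-+      : ∀ f g → 𝔼 (λ a → f a + g a) ≡ 𝔼 f + 𝔼 g
      𝔼-*      : ∀ c f → 𝔼 (λ a → c * f a) ≡ c * 𝔼 f
      𝔼-1      : 𝔼 (λ _ → 1ℚ) ≡ 1ℚ
      𝔼-nonneg : ∀ {f} → (∀ a → 0ℚ ≤ f a) → 0ℚ ≤ 𝔼 f

    𝔼-const : ∀ c → 𝔼 (λ _ → c) ≡ c
    𝔼-const c = trans (𝔼-cong (λ _ → sym (*-identityʳ c))) (trans (𝔼-* c _) (trans (cong (c *_) 𝔼-1) (*-identityʳ c)))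

    𝔼-*ʳ : ∀ f c → 𝔼 (λ a → f a * c) ≡ 𝔼 f * c
    𝔼-*ʳ f c = trans (𝔼-cong (λ a → *-comm (f a) c)) (trans (𝔼-* c f) (*-comm c _))

    𝔼-neg : ∀ f → 𝔼 (λ a → - f a) ≡ - 𝔼 f
    𝔼-neg f = trans (𝔼-cong (λ a → solve 1 (λ x → :- x := con (- 1ℚ) :* x) refl (f a))) (trans (𝔼-* (- 1ℚ) f)
      (solve 1 (λ x → con (- 1ℚ) :* x := :- x) refl (𝔼 f)))

    𝔼-sub : ∀ f g → 𝔼 (λ a → f a - g a) ≡ 𝔼 f - 𝔼 g
    𝔼-sub f g = trans (𝔼-+ f (λ a → - g a)) (cong (𝔼 f +_) (𝔼-neg g))

    𝔼-lin : ∀ c f d g → 𝔼 (λ a → c * f a + d * g a) ≡ c * 𝔼 f + d * 𝔼 g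
    𝔼-lin c f d g = trans (𝔼-+ (λ a → c * f a) (λ a → d * g a)) (cong₂ _+_ (𝔼-* c f) (𝔼-* d g))

    𝔼-lin₃ : ∀ c f d g e h → 𝔼 (λ a → c * f a + d * g a + e * h a) ≡ c * 𝔼 f + d * 𝔼 g + e * 𝔼 h
    𝔼-lin₃ c f d g e h = trans (𝔼-+ (λ a → c * f a + d * g a) (λ a → e * h a)) (cong₂ _+_ (𝔼-lin c f d g) (𝔼-* e h))

    𝔼-affine : ∀ p c f d g e h →
               𝔼 (λ a → p a + c * f a + d * g a + e * h a) ≡ 𝔼 p + c * 𝔼 f + d * 𝔼 g + e * 𝔼 h
    𝔼-affine p c f d g e h = trans (𝔼-+ (λ a → p a + c * f a + d * g a) (λ a → e * h a)) (cong₂ _+_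
      (trans (𝔼-+ (λ a → p a + c * f a) (λ a → d * g a)) (cong₂ _+_ (trans (𝔼-+ p (λ a → c * f a)) (cong (𝔼 p +_) (𝔼-* c f))) (𝔼-* d g)))
      (𝔼-* e h))

    𝔼-mono : ∀ {f g} → (∀ a → f a ≤ g a) → 𝔼 f ≤ 𝔼 g
    𝔼-mono {f} {g} p = 0≤-⇒≤ (subst (0ℚ ≤_) (𝔼-sub g f) (𝔼-nonneg (λ a → ≤⇒0≤- (p a))))

    𝔼-sum : ∀ {n} (f : Fin n → Ω → ℚ) → 𝔼 (λ a → sum (λ i → f i a)) ≡ sum (λ i → 𝔼 (f i))
    𝔼-sum {zero}  f = 𝔼-const 0ℚ
    𝔼-sum {suc n} f = trans (𝔼-+ (f zero) _) (cong (𝔼 (f zero) +_) (𝔼-sum (λ i → f (suc i))))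

    -- Lagrange's identity: the two sides differ by half the double expectation of (f x g y - f y g
    -- x)². This avoids dividing by a norm that might vanish.
    cauchy-schwarz : ∀ f g → sq (𝔼 (λ a → f a * g a)) ≤ 𝔼 (λ a → sq (f a)) * 𝔼 (λ a → sq (g a))
    cauchy-schwarz f g = ≤-by (0≤* 0≤½ (𝔼-nonneg (λ x → 𝔼-nonneg (λ y → 0≤sq (f x * g y - f y * g x)))))
      (trans (solve 3 (λ A B C → A :* C :- B :* B := con ½ :* (C :* A :+ (con (- 2ℚ) :* B) :* B :+ A :* C)) refl A B C)
      (cong (½ *_) (sym outer)))
      where
      A = 𝔼 (λ a → sq (f a))
      B = 𝔼 (λ a → f a * g a)
      C = 𝔼 (λ a → sq (g a))
      inner : ∀ x → 𝔼 (λ y → sq (f x * g y - f y * g x)) ≡ C * sq (f x) + (- 2ℚ * B) * (f x * g x) + A * sq (g x)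
      inner x = trans (𝔼-cong (λ y → solve 4 (λ a b c d → (a :* b :- c :* d) :* (a :* b :- c :* d)
           := (a :* a) :* (b :* b) :+ (con (- 2ℚ) :* (a :* d)) :* (c :* b) :+ (d :* d) :* (c :* c)) refl (f x) (g y) (f y) (g x)))
        (trans (𝔼-lin₃ (sq (f x)) (λ y → sq (g y)) (- 2ℚ * (f x * g x)) (λ y → f y * g y) (sq (g x)) (λ y → sq (f y)))
        (solve 5 (λ A B C a d → (a :* a) :* C :+ (con (- 2ℚ) :* (a :* d)) :* B :+ (d :* d) :* A
           := C :* (a :* a) :+ (con (- 2ℚ) :* B) :* (a :* d) :+ A :* (d :* d)) refl A B C (f x) (g x)))
      outer : 𝔼 (λ x → 𝔼 (λ y → sq (f x * g y - f y * g x))) ≡ C * A + (- 2ℚ * B) * B + A * C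
      outer = trans (𝔼-cong inner) (𝔼-lin₃ C (λ x → sq (f x)) (- 2ℚ * B) (λ x → f x * g x) A (λ x → sq (g x)))

    jensen : ∀ f → sq (𝔼 f) ≤ 𝔼 (λ a → sq (f a))
    jensen f = subst₂ _≤_ (cong sq (𝔼-cong (λ a → *-identityʳ (f a))))
      (trans (cong (𝔼 (λ a → sq (f a)) *_) (𝔼-const (sq 1ℚ))) (*-identityʳ _)) (cauchy-schwarz f (λ _ → 1ℚ))

  open Expectation

  product : ∀ {Ω} → Expectation Ω → ∀ n → Expectation (Vec Ω n)
  product μ zero = record
    { 𝔼 = λ f → f [] ; 𝔼-cong = λ p → p [] ; 𝔼-+ = λ _ _ → refl ; 𝔼-* = λ _ _ → refl ; 𝔼-1 = refl ; 𝔼-nonneg = λ p → p [] }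
  product μ (suc n) = record
    { 𝔼 = λ f → 𝔼 μ (λ a → 𝔼 ν (λ x → f (a ∷ x)))
    ; 𝔼-cong = λ p → 𝔼-cong μ (λ a → 𝔼-cong ν (λ x → p (a ∷ x)))
    ; 𝔼-+ = λ f g → trans (𝔼-cong μ (λ a → 𝔼-+ ν (λ x → f (a ∷ x)) (λ x → g (a ∷ x)))) (𝔼-+ μ _ _)
    ; 𝔼-* = λ c f → trans (𝔼-cong μ (λ a → 𝔼-* ν c (λ x → f (a ∷ x)))) (𝔼-* μ c _)
    ; 𝔼-1 = trans (𝔼-cong μ (λ a → 𝔼-1 ν)) (𝔼-1 μ)
    ; 𝔼-nonneg = λ p → 𝔼-nonneg μ (λ a → 𝔼-nonneg ν (λ x → p (a ∷ x)))
    }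
    where ν = product μ n

  -- Fubini's theorem, kept as a property of a pair because `Expectation` fixes no summation formula
  -- from which to derive it.
  Commute : ∀ {Ω Ω′} → Expectation Ω → Expectation Ω′ → Set
  Commute {Ω} {Ω′} μ ν = ∀ (f : Ω → Ω′ → ℚ) → 𝔼 μ (λ a → 𝔼 ν (λ b → f a b)) ≡ 𝔼 ν (λ b → 𝔼 μ (λ a → f a b))

  product-commute : ∀ {Ω Ω′} (μ : Expectation Ω) (ν : Expectation Ω′) → Commute μ ν → ∀ n → Commute (product μ n) ν
  product-commute μ ν c zero    f = refl
  product-commute μ ν c (suc n) f = trans (𝔼-cong μ (λ a → product-commute μ ν c n (λ x → f (a ∷ x)))) (c _)

  -- Rates in [0, 1] and the parameters of the junta theorem

  Unit : ℚ → Set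
  Unit r = 0ℚ ≤ r × r ≤ 1ℚ

  χ : Bool → ℚ
  χ b = if b then 1ℚ else 0ℚ

  χ-unit : ∀ b → Unit (χ b)
  χ-unit true  = 0≤1 , ≤-refl
  χ-unit false = ≤-refl , 0≤1

  -- Rates for `T` that average out coordinate i and keep all others.
  allBut : ∀ {n} → Fin n → Vec ℚ n
  allBut {suc n} zero    = 0ℚ ∷ replicate n 1ℚ
  allBut         (suc i) = 1ℚ ∷ allBut i

  χ-∩ : ∀ {n} (J K : Subset n) → zipWith _*_ (map χ J) (map χ K) ≡ map χ (J ∩ K)
  χ-∩ []      []      = refl
  χ-∩ (a ∷ J) (b ∷ K) = cong₂ _∷_ (lem a b) (χ-∩ J K)
    where
    lem : ∀ a b → χ a * χ b ≡ χ (a ∧ b)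
    lem true  b = *-identityˡ (χ b)
    lem false b = *-zeroˡ (χ b)

  χ-units : ∀ {n} (J : Subset n) → All Unit (map χ J)
  χ-units []      = []
  χ-units (b ∷ J) = χ-unit b ∷ χ-units J

  replicate-units : ∀ n {r} → Unit r → All Unit (replicate n r)
  replicate-units zero    u = []
  replicate-units (suc n) u = u ∷ replicate-units n u

  -- δ = b / (a + b) meets both upper bounds at once, without a case a = 0.
  small : ∀ {a b} → 0ℚ ≤ a → 0ℚ < b → Σ ℚ λ δ → 0ℚ < δ × δ ≤ 1ℚ × δ * a ≤ b
  small {a} {b} 0≤a 0<b with 1/-pos (a + b) (subst (_< a + b) (+-identityˡ 0ℚ) (+-mono-≤-< 0≤a 0<b))
  ... | y , 0<y , e = b * y , 0<* 0<b 0<y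
    , subst (b * y ≤_) e (≤-by (0≤* 0≤a (<⇒≤ 0<y)) (solve 3 (λ a b y → (a :+ b) :* y :- b :* y := a :* y) refl a b y))
    , (begin
      b * y * a          ≤⟨ ≤-by (0≤* (0≤* (<⇒≤ 0<b) (<⇒≤ 0<b)) (<⇒≤ 0<y)) (solve 3 (λ a b y → b :* ((a :+ b) :* y) :- b :* y :* a := b :* b :* y) refl a b y) ⟩
      b * ((a + b) * y)  ≡⟨ cong (b *_) e ⟩
      b * 1ℚ             ≡⟨ *-identityʳ b ⟩
      b ∎)

  markov : ∀ {n} {I : Fin n → ℚ} τ → 0ℚ ≤ τ → (∀ i → 0ℚ ≤ I i) →
          Σ (Subset n) λ J → (∀ i → lookup J i ≡ false → I i ≤ τ) × ι ∣ J ∣ * τ ≤ sum I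
  markov {zero} τ 0≤τ 0≤I = [] , (λ ()) , ≤-reflexive (*-zeroˡ τ)
  markov {suc n} {I} τ 0≤τ 0≤I with markov {n} τ 0≤τ (λ i → 0≤I (suc i)) | I zero ≤? τ
  ... | J , small-off , bound | yes I₀≤τ = false ∷ J , (λ { zero _ → I₀≤τ ; (suc i) → small-off i })
        , ≤-trans bound (≤-by (0≤I zero) (solve 2 (λ a b → a :+ b :- b := a) refl (I zero) (sum (λ i → I (suc i)))))
  ... | J , small-off , bound | no I₀≰τ = true ∷ J , (λ { zero () ; (suc i) → small-off i })
        , ≤-trans (≤-reflexive (solve 2 (λ c t → (con 1ℚ :+ c) :* t := t :+ c :* t) refl (ι ∣ J ∣) τ)) (+-mono-≤ (<⇒≤ (≰⇒> I₀≰τ)) bound)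

  -- Here w bounds the atoms from below, K the total influence from above, and θ is the squared
  -- distance to a junta. The choices are made in this order: δ makes one noise step cost at most θ
  -- / 2; m steps reach a rate at which hypercontractivity holds; κ makes the light coordinates
  -- contribute less than what survives m steps; s counts the heavy coordinates. The dimension never
  -- enters.
  record Constants (w K θ : ℚ) : Set where
    field
      0<w   : 0ℚ < w
      w≤1   : w ≤ 1ℚ
      0<θ   : 0ℚ < θ
      δ κ   : ℚ
      m s   : ℕ
      0<δ   : 0ℚ < δ
      δ≤1   : δ ≤ 1ℚ
      4δK≤θ : 4ℚ * (δ * K) ≤ θ
      σ≤w/2 : pow (1ℚ - δ) m ≤ ½ * w
      0<κ   : 0ℚ < κ
      κK≤   : κ * K ≤ ½ * (pow ½ m * θ)
      K≤sκ² : K ≤ ι s * sq κ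

  constants : ∀ {w K θ} → 0ℚ < w → w ≤ 1ℚ → 0ℚ ≤ K → 0ℚ < θ → Constants w K θ
  constants {w} {K} {θ} 0<w w≤1 0≤K 0<θ = choose-δ (small (0≤* (0≤+ 0≤2 0≤2) 0≤K) 0<θ)
    where
    choose-s : ∀ δ m κ → 0ℚ < δ → δ ≤ 1ℚ → 4ℚ * (δ * K) ≤ θ → pow (1ℚ - δ) m ≤ ½ * w →
               0ℚ < κ → κ * K ≤ ½ * (pow ½ m * θ) →
               (Σ ℚ λ y → 0ℚ < y × sq κ * y ≡ 1ℚ) → Constants w K θ
    choose-s δ m κ 0<δ δ≤1 4δK≤θ σ≤w/2 0<κ κK≤ (y , 0<y , e) = record
      { 0<w = 0<w ; w≤1 = w≤1 ; 0<θ = 0<θ ; δ = δ ; κ = κ ; m = m ; s = proj₁ (archimedean (K * y))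
      ; 0<δ = 0<δ ; δ≤1 = δ≤1 ; 4δK≤θ = 4δK≤θ ; σ≤w/2 = σ≤w/2 ; 0<κ = 0<κ ; κK≤ = κK≤
      ; K≤sκ² = ≤-trans (≤-reflexive (trans (sym (*-identityʳ K)) (trans (cong (K *_) (sym e))
          (solve 3 (λ k c y → k :* (c :* y) := k :* y :* c) refl K (sq κ) y)))) (*-monoʳ (0≤sq κ) (proj₂ (archimedean (K * y)))) }
    choose-κ : ∀ δ → 0ℚ < δ → δ ≤ 1ℚ → 4ℚ * (δ * K) ≤ θ → (Σ ℕ λ m → pow (1ℚ - δ) m ≤ ½ * w) → Constants w K θ
    choose-κ δ 0<δ δ≤1 4δK≤θ (m , σ≤w/2) = choose (small 0≤K (0<* (positive⁻¹ ½) (0<* (0<pow m (positive⁻¹ ½)) 0<θ)))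
      where
      choose : (Σ ℚ λ κ → 0ℚ < κ × κ ≤ 1ℚ × κ * K ≤ ½ * (pow ½ m * θ)) → Constants w K θ
      choose (κ , 0<κ , _ , κK≤) = choose-s δ m κ 0<δ δ≤1 4δK≤θ σ≤w/2 0<κ κK≤ (1/-pos (sq κ) (0<* 0<κ 0<κ))
    choose-δ : (Σ ℚ λ δ → 0ℚ < δ × δ ≤ 1ℚ × δ * (4ℚ * K) ≤ θ) → Constants w K θ
    choose-δ (δ , 0<δ , δ≤1 , δ4K≤θ) = choose-κ δ 0<δ δ≤1
      (subst (_≤ θ) (trans (sym (*-assoc δ 4ℚ K)) (trans (cong (_* K) (*-comm δ 4ℚ)) (*-assoc 4ℚ δ K))) δ4K≤θ)
      (pow-small (≤⇒0≤- δ≤1) (subst (1ℚ - δ <_) (+-identityʳ 1ℚ) (+-monoʳ-< 1ℚ (neg-antimono-< 0<δ))) (0<* (positive⁻¹ ½) 0<w))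

  -- Noise operators and Friedgut's junta theorem

  module Operators (Ω : Set) (μ : Expectation Ω) (swap : Commute μ μ) where

    E : ∀ n → Expectation (Vec Ω n)
    E = product μ

    ⟪_⟫ : ∀ {n} → (Vec Ω n → ℚ) → ℚ
    ⟪_⟫ {n} f = 𝔼 (E n) f

    ‖_‖² : ∀ {n} → (Vec Ω n → ℚ) → ℚ
    ‖ f ‖² = ⟪ (λ x → sq (f x)) ⟫

    -- A coordinate of rate r is kept with probability r and resampled from μ otherwise. Constant
    -- rates give noise, rates `map χ J` the conditional expectation on J, and `allBut i` the
    -- average over coordinate i; a single family gives all their commutation rules through `T-T`.
    T : ∀ {n} → Vec ℚ n → (Vec Ω n → ℚ) → Vec Ω n → ℚ
    T []       f x       = f x
    T (r ∷ rs) f (a ∷ x) = r * T rs (λ y → f (a ∷ y)) x + (1ℚ - r) * 𝔼 μ (λ b → T rs (λ y → f (b ∷ y)) x)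

    E-swap : ∀ n → Commute (E n) μ
    E-swap = product-commute μ μ swap

    T-cong : ∀ {n} (r : Vec ℚ n) {f g} → (∀ x → f x ≡ g x) → ∀ x → T r f x ≡ T r g x
    T-cong []       p x       = p x
    T-cong (r ∷ rs) p (a ∷ x) = cong₂ (λ u v → r * u + (1ℚ - r) * v) (T-cong rs (λ y → p (a ∷ y)) x)
                                  (𝔼-cong μ (λ b → T-cong rs (λ y → p (b ∷ y)) x))

    T-lin : ∀ {n} (r : Vec ℚ n) c f d g x → T r (λ y → c * f y + d * g y) x ≡ c * T r f x + d * T r g x
    T-lin []       c f d g x       = refl
    T-lin (r ∷ rs) c f d g (a ∷ x) = trans
      (cong₂ (λ u v → r * u + (1ℚ - r) * v) (T-lin rs c (λ y → f (a ∷ y)) d (λ y → g (a ∷ y)) x)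
        (trans (𝔼-cong μ (λ b → T-lin rs c (λ y → f (b ∷ y)) d (λ y → g (b ∷ y)) x)) (𝔼-lin μ c _ d _)))
      (solve 7 (λ r c d u v u′ v′ → r :* (c :* u :+ d :* v) :+ (con 1ℚ :- r) :* (c :* u′ :+ d :* v′)
        := c :* (r :* u :+ (con 1ℚ :- r) :* u′) :+ d :* (r :* v :+ (con 1ℚ :- r) :* v′)) refl r c d _ _ _ _)

    T-const : ∀ {n} (r : Vec ℚ n) c x → T r (λ _ → c) x ≡ c
    T-const []       c x       = refl
    T-const (r ∷ rs) c (a ∷ x) = trans
      (cong₂ (λ u v → r * u + (1ℚ - r) * v) (T-const rs c x) (trans (𝔼-cong μ (λ b → T-const rs c x)) (𝔼-const μ c)))
      (solve 2 (λ r c → r :* c :+ (con 1ℚ :- r) :* c := c) refl r c)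

    T-sub : ∀ {n} (r : Vec ℚ n) f g x → T r (λ y → f y - g y) x ≡ T r f x - T r g x
    T-sub r f g x = trans (T-cong r (λ y → lem (f y) (g y)) x) (trans (T-lin r 1ℚ f (- 1ℚ) g x) (sym (lem (T r f x) (T r g x))))
      where lem : ∀ a b → a - b ≡ 1ℚ * a + - 1ℚ * b
            lem = solve 2 (λ a b → a :- b := con 1ℚ :* a :+ con (- 1ℚ) :* b) refl

    T-𝔼 : ∀ {n} (r : Vec ℚ n) (f : Ω → Vec Ω n → ℚ) x → T r (λ y → 𝔼 μ (λ b → f b y)) x ≡ 𝔼 μ (λ b → T r (f b) x)
    T-𝔼 []       f x       = refl
    T-𝔼 (r ∷ rs) f (a ∷ x) = trans
      (cong₂ (λ u v → r * u + (1ℚ - r) * v) (T-𝔼 rs (λ b y → f b (a ∷ y)) x)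
        (trans (𝔼-cong μ (λ c → T-𝔼 rs (λ b y → f b (c ∷ y)) x)) (swap _)))
      (sym (𝔼-lin μ r _ (1ℚ - r) _))

    T-T : ∀ {n} (r s : Vec ℚ n) f x → T r (T s f) x ≡ T (zipWith _*_ r s) f x
    T-T []       []       f x       = refl
    T-T (r ∷ rs) (s ∷ ss) f (a ∷ x) = trans
      (cong₂ (λ u v → r * u + (1ℚ - r) * v) (inner a)
        (trans (𝔼-cong μ inner) (trans (𝔼-lin μ s u (1ℚ - s) (λ _ → 𝔼 μ u)) (cong (λ v → s * 𝔼 μ u + (1ℚ - s) * v) (𝔼-const μ (𝔼 μ u))))))
      (solve 4 (λ r s u m → r :* (s :* u :+ (con 1ℚ :- s) :* m) :+ (con 1ℚ :- r) :* (s :* m :+ (con 1ℚ :- s) :* m)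
        := r :* s :* u :+ (con 1ℚ :- r :* s) :* m) refl r s (u a) (𝔼 μ u))
      where
      u : Ω → ℚ
      u b = T (zipWith _*_ rs ss) (λ y → f (b ∷ y)) x
      inner : ∀ b → T rs (λ y → T (s ∷ ss) f (b ∷ y)) x ≡ s * u b + (1ℚ - s) * 𝔼 μ u
      inner b = trans (T-lin rs s _ (1ℚ - s) _ x) (cong₂ (λ v w → s * v + (1ℚ - s) * w) (T-T rs ss _ x)
        (trans (T-𝔼 rs _ x) (𝔼-cong μ (λ c → T-T rs ss _ x))))

    T-comm : ∀ {n} (r s : Vec ℚ n) f x → T r (T s f) x ≡ T s (T r f) x
    T-comm r s f x = trans (T-T r s f x) (trans (cong (λ v → T v f x) (Vec.zipWith-comm *-comm r s)) (sym (T-T s r f x)))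

    -- A point and its noisy copy are exchangeable; `swap` provides this for a resampled coordinate.
    T-adj : ∀ {n} (r : Vec ℚ n) f g → ⟪ (λ x → T r f x * g x) ⟫ ≡ ⟪ (λ x → f x * T r g x) ⟫
    T-adj []       f g = refl
    T-adj {suc n} (r ∷ rs) f g = trans (𝔼-cong μ left) (trans (𝔼-lin μ r _ (1ℚ - r) _)
      (trans (cong₂ (λ u v → r * u + (1ℚ - r) * v) (𝔼-cong μ (λ a → T-adj rs (f′ a) (g′ a)))
        (trans (𝔼-cong μ (λ a → 𝔼-cong μ (λ b → T-adj rs (f′ b) (g′ a)))) (swap _)))
      (trans (sym (𝔼-lin μ r _ (1ℚ - r) _)) (sym (𝔼-cong μ right)))))
      where
      f′ g′ : Ω → Vec Ω n → ℚ
      f′ a y = f (a ∷ y)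
      g′ a y = g (a ∷ y)
      left : ∀ a → ⟪ (λ x → T (r ∷ rs) f (a ∷ x) * g′ a x) ⟫
               ≡ r * ⟪ (λ x → T rs (f′ a) x * g′ a x) ⟫ + (1ℚ - r) * 𝔼 μ (λ b → ⟪ (λ x → T rs (f′ b) x * g′ a x) ⟫)
      left a = trans (𝔼-cong (E n) (λ x → trans
          (solve 4 (λ r u m v → (r :* u :+ (con 1ℚ :- r) :* m) :* v := r :* (u :* v) :+ (con 1ℚ :- r) :* (m :* v)) refl
            r (T rs (f′ a) x) (𝔼 μ (λ b → T rs (f′ b) x)) (g′ a x))
          (cong (λ z → r * (T rs (f′ a) x * g′ a x) + (1ℚ - r) * z) (sym (𝔼-*ʳ μ (λ b → T rs (f′ b) x) (g′ a x))))))
        (trans (𝔼-lin (E n) r _ (1ℚ - r) _) (cong (λ z → r * ⟪ (λ x → T rs (f′ a) x * g′ a x) ⟫ + (1ℚ - r) * z) (E-swap n _)))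
      right : ∀ a → ⟪ (λ x → f′ a x * T (r ∷ rs) g (a ∷ x)) ⟫
               ≡ r * ⟪ (λ x → f′ a x * T rs (g′ a) x) ⟫ + (1ℚ - r) * 𝔼 μ (λ b → ⟪ (λ x → f′ a x * T rs (g′ b) x) ⟫)
      right a = trans (𝔼-cong (E n) (λ x → trans
          (solve 4 (λ r u m v → v :* (r :* u :+ (con 1ℚ :- r) :* m) := r :* (v :* u) :+ (con 1ℚ :- r) :* (v :* m)) refl
            r (T rs (g′ a) x) (𝔼 μ (λ b → T rs (g′ b) x)) (f′ a x))
          (cong (λ z → r * (f′ a x * T rs (g′ a) x) + (1ℚ - r) * z) (sym (𝔼-* μ (f′ a x) (λ b → T rs (g′ b) x))))))
        (trans (𝔼-lin (E n) r _ (1ℚ - r) _) (cong (λ z → r * ⟪ (λ x → f′ a x * T rs (g′ a) x) ⟫ + (1ℚ - r) * z) (E-swap n _)))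

    T-mean : ∀ {n} (r : Vec ℚ n) f → ⟪ T r f ⟫ ≡ ⟪ f ⟫
    T-mean {n} r f = trans (𝔼-cong (E n) (λ x → sym (*-identityʳ (T r f x)))) (trans (T-adj r f (λ _ → 1ℚ))
      (𝔼-cong (E n) (λ x → trans (cong (f x *_) (T-const r 1ℚ x)) (*-identityʳ (f x)))))

    T-nonneg : ∀ {n} {r : Vec ℚ n} → All Unit r → ∀ {f} → (∀ x → 0ℚ ≤ f x) → ∀ x → 0ℚ ≤ T r f x
    T-nonneg []              p x       = p x
    T-nonneg ((u , v) ∷ rs) p (a ∷ x) = 0≤+ (0≤* u (T-nonneg rs (λ y → p (a ∷ y)) x))
      (0≤* (≤⇒0≤- v) (𝔼-nonneg μ (λ b → T-nonneg rs (λ y → p (b ∷ y)) x)))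

    -- The law of the noisy copy of x. Viewing it as an `Expectation` yields monotonicity and
    -- Jensen's inequality for `T` at once.
    kernel : ∀ {n} {r : Vec ℚ n} → All Unit r → Vec Ω n → Expectation (Vec Ω n)
    kernel {r = r} u x = record
      { 𝔼 = λ f → T r f x
      ; 𝔼-cong = λ p → T-cong r p x
      ; 𝔼-+ = λ f g → trans (T-cong r (λ y → sym (one (f y) (g y))) x) (trans (T-lin r 1ℚ f 1ℚ g x) (one (T r f x) (T r g x)))
      ; 𝔼-* = λ c f → trans (T-cong r (λ y → sym (zer c (f y))) x) (trans (T-lin r c f 0ℚ f x) (zer c (T r f x)))
      ; 𝔼-1 = T-const r 1ℚ x
      ; 𝔼-nonneg = λ p → T-nonneg u p x
      }
      where
      one : ∀ a b → 1ℚ * a + 1ℚ * b ≡ a + b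
      one = solve 2 (λ a b → con 1ℚ :* a :+ con 1ℚ :* b := a :+ b) refl
      zer : ∀ c a → c * a + 0ℚ * a ≡ c * a
      zer = solve 2 (λ c a → c :* a :+ con 0ℚ :* a := c :* a) refl

    T-mono : ∀ {n} {r : Vec ℚ n} → All Unit r → ∀ {f g} → (∀ x → f x ≤ g x) → ∀ x → T r f x ≤ T r g x
    T-mono u p x = 𝔼-mono (kernel u x) p

    T-jensen : ∀ {n} {r : Vec ℚ n} → All Unit r → ∀ f x → sq (T r f x) ≤ T r (λ y → sq (f y)) x
    T-jensen u f x = jensen (kernel u x) f

    T-contract : ∀ {n} {r : Vec ℚ n} → All Unit r → ∀ f → ‖ T r f ‖² ≤ ‖ f ‖²
    T-contract {n} {r} u f = ≤-trans (𝔼-mono (E n) (T-jensen u f)) (≤-reflexive (T-mean r _))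

    T-ones : ∀ n f x → T (replicate n 1ℚ) f x ≡ f x
    T-ones zero    f x       = refl
    T-ones (suc n) f (a ∷ x) = trans (cong (λ u → 1ℚ * u + _) (T-ones n (λ y → f (a ∷ y)) x))
      (solve 2 (λ u v → con 1ℚ :* u :+ (con 1ℚ :- con 1ℚ) :* v := u) refl (f (a ∷ x)) (𝔼 μ (λ b → T (replicate n 1ℚ) (λ y → f (b ∷ y)) x)))

    T-allBut : ∀ {n} (i : Fin n) f x → T (allBut i) f x ≡ 𝔼 μ (λ b → f (x [ i ]≔ b))
    T-allBut {suc n} zero f (a ∷ x) = trans
      (solve 2 (λ u v → con 0ℚ :* u :+ (con 1ℚ :- con 0ℚ) :* v := v) refl
        (T (replicate n 1ℚ) (λ y → f (a ∷ y)) x) (𝔼 μ (λ b → T (replicate n 1ℚ) (λ y → f (b ∷ y)) x)))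
      (𝔼-cong μ (λ b → T-ones n (λ y → f (b ∷ y)) x))
    T-allBut (suc i) f (a ∷ x) = trans
      (solve 2 (λ u v → con 1ℚ :* u :+ (con 1ℚ :- con 1ℚ) :* v := u) refl
        (T (allBut i) (λ y → f (a ∷ y)) x) (𝔼 μ (λ b → T (allBut i) (λ y → f (b ∷ y)) x))) (T-allBut i (λ y → f (a ∷ y)) x)

    -- Blending φ with its mean keeps the mean and multiplies the variance by r², so the second
    -- moment drops by 1 - r² times the variance.
    mix : ∀ r (φ : Ω → ℚ) → 𝔼 μ (λ a → sq (φ a)) - 𝔼 μ (λ a → sq (r * φ a + (1ℚ - r) * 𝔼 μ φ))
          ≡ (1ℚ - sq r) * 𝔼 μ (λ a → sq (φ a - 𝔼 μ φ))
    mix r φ = trans (cong (λ z → S - z) (trans (𝔼-cong μ (λ a → solve 3 (λ r p m → (r :* p :+ (con 1ℚ :- r) :* m) :* (r :* p :+ (con 1ℚ :- r) :* m)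
          := (r :* r) :* (p :* p) :+ (con 2ℚ :* r :* (con 1ℚ :- r) :* m) :* p :+ ((con 1ℚ :- r) :* (con 1ℚ :- r) :* m :* m) :* con 1ℚ) refl r (φ a) m))
        (𝔼-lin₃ μ (sq r) (λ a → sq (φ a)) (2ℚ * r * (1ℚ - r) * m) φ ((1ℚ - r) * (1ℚ - r) * m * m) (λ _ → 1ℚ))))
      (trans (cong (λ e → S - (sq r * S + 2ℚ * r * (1ℚ - r) * m * m + (1ℚ - r) * (1ℚ - r) * m * m * e)) (𝔼-1 μ))
      (trans (solve 3 (λ r S m → S :- ((r :* r) :* S :+ con 2ℚ :* r :* (con 1ℚ :- r) :* m :* m :+ (con 1ℚ :- r) :* (con 1ℚ :- r) :* m :* m :* con 1ℚ)
          := (con 1ℚ :- r :* r) :* (con 1ℚ :* S :+ (con (- 2ℚ) :* m) :* m :+ m :* m :* con 1ℚ)) refl r S m)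
      (sym (cong ((1ℚ - sq r) *_) (trans (𝔼-cong μ (λ a → solve 2 (λ p m → (p :- m) :* (p :- m)
          := con 1ℚ :* (p :* p) :+ (con (- 2ℚ) :* m) :* p :+ m :* m :* con 1ℚ) refl (φ a) m))
        (trans (𝔼-lin₃ μ 1ℚ (λ a → sq (φ a)) (- 2ℚ * m) φ (m * m) (λ _ → 1ℚ)) (cong (λ e → 1ℚ * S + (- 2ℚ * m) * m + m * m * e) (𝔼-1 μ))))))))
      where
      m = 𝔼 μ φ
      S = 𝔼 μ (λ a → sq (φ a))

    1-sq≥0 : ∀ {r} → Unit r → 0ℚ ≤ 1ℚ - sq r
    1-sq≥0 (p , q) = ≤⇒0≤- (*-mono p 0≤1 q q)

    -- Applies the noise of the first coordinate before that of the others, the order in which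
    -- `energy-loss` telescopes.
    T-cons : ∀ {n} r (rs : Vec ℚ n) f a x →
             T (r ∷ rs) f (a ∷ x) ≡ T rs (λ y → r * f (a ∷ y) + (1ℚ - r) * 𝔼 μ (λ b → f (b ∷ y))) x
    T-cons r rs f a x = sym (trans (T-lin rs r _ (1ℚ - r) _ x)
      (cong (λ z → r * T rs (λ y → f (a ∷ y)) x + (1ℚ - r) * z) (T-𝔼 rs (λ b y → f (b ∷ y)) x)))

    T-allBut-suc : ∀ {n} (i : Fin n) f a x → T (allBut (suc i)) f (a ∷ x) ≡ T (allBut i) (λ y → f (a ∷ y)) x
    T-allBut-suc i f a x = solve 2 (λ u v → con 1ℚ :* u :+ (con 1ℚ :- con 1ℚ) :* v := u) refl
      (T (allBut i) (λ y → f (a ∷ y)) x) (𝔼 μ (λ b → T (allBut i) (λ y → f (b ∷ y)) x))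

    mix-contract : ∀ {r} → Unit r → (φ : Ω → ℚ) → 𝔼 μ (λ a → sq (r * φ a + (1ℚ - r) * 𝔼 μ φ)) ≤ 𝔼 μ (λ a → sq (φ a))
    mix-contract {r} u φ = ≤-by (0≤* (1-sq≥0 u) (𝔼-nonneg μ (λ a → 0≤sq (φ a - 𝔼 μ φ)))) (mix r φ)

    -- The Efron-Stein difference, the part of h with mean zero in coordinate i; its squared norm is
    -- the L² influence of i.
    D : ∀ {n} → Fin n → (Vec Ω n → ℚ) → Vec Ω n → ℚ
    D i h x = h x - T (allBut i) h x

    -- With r = χ J this is the Efron–Stein inequality, with constant r the energy lost under noise.
    energy-loss : ∀ {n} {r : Vec ℚ n} → All Unit r → ∀ h →
                  ‖ h ‖² - ‖ T r h ‖² ≤ sum (λ i → (1ℚ - sq (lookup r i)) * ‖ D i h ‖²)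
    energy-loss [] h = ≤-reflexive (+-inverseʳ (sq (h [])))
    energy-loss {suc n} {r ∷ rs} (u ∷ us) h = begin
      ‖ h ‖² - ‖ T (r ∷ rs) h ‖²
        ≡⟨ cong (λ z → ‖ h ‖² - z) (𝔼-cong μ (λ a → 𝔼-cong (E n) (λ x → cong sq (T-cons r rs h a x)))) ⟩
      ‖ h ‖² - L
        ≡⟨ solve 3 (λ H K L → H :- L := (H :- K) :+ (K :- L)) refl ‖ h ‖² K L ⟩
      (‖ h ‖² - K) + (K - L)
        ≤⟨ +-mono-≤ (≤-reflexive first) second ⟩
      sum (λ i → (1ℚ - sq (lookup (r ∷ rs) i)) * ‖ D i h ‖²)
        ∎
      where
      -- h with noise on the first coordinate only. `mix` gives the loss of that step exactly; the
      -- rest is the induction hypothesis on fibres, where by `D-contract` the first step has not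
      -- increased the other differences.
      k : Ω → Vec Ω n → ℚ
      k a y = r * h (a ∷ y) + (1ℚ - r) * 𝔼 μ (λ b → h (b ∷ y))
      K = 𝔼 μ (λ a → ‖ k a ‖²)
      L = 𝔼 μ (λ a → ‖ T rs (k a) ‖²)
      d : Fin n → Ω → Vec Ω n → ℚ
      d i a = D i (λ y → h (a ∷ y))
      first : ‖ h ‖² - K ≡ (1ℚ - sq r) * ‖ D zero h ‖²
      first = trans (cong₂ _-_ (sym (E-swap n (λ x a → sq (h (a ∷ x))))) (sym (E-swap n (λ x a → sq (k a x)))))
        (trans (sym (𝔼-sub (E n) _ _))
        (trans (𝔼-cong (E n) (λ x → mix r (λ a → h (a ∷ x))))
        (trans (𝔼-* (E n) (1ℚ - sq r) _) (cong ((1ℚ - sq r) *_)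
        (trans (E-swap n (λ x a → sq (h (a ∷ x) - 𝔼 μ (λ b → h (b ∷ x)))))
        (𝔼-cong μ (λ a → 𝔼-cong (E n) (λ x → cong (λ z → sq (h (a ∷ x) - z)) (sym (T-allBut zero h (a ∷ x)))))))))))
      D-k : ∀ i a x → D i (k a) x ≡ r * d i a x + (1ℚ - r) * 𝔼 μ (λ b → d i b x)
      D-k i a x = trans
        (cong (λ z → k a x - z) (trans (T-lin (allBut i) r _ (1ℚ - r) _ x)
          (cong (λ z → r * T (allBut i) (λ y → h (a ∷ y)) x + (1ℚ - r) * z) (T-𝔼 (allBut i) (λ b y → h (b ∷ y)) x))))
        (trans (solve 5 (λ r f m q e → r :* f :+ (con 1ℚ :- r) :* m :- (r :* q :+ (con 1ℚ :- r) :* e)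
            := r :* (f :- q) :+ (con 1ℚ :- r) :* (m :- e)) refl r (h (a ∷ x)) _ _ _)
          (cong (λ z → r * d i a x + (1ℚ - r) * z) (sym (𝔼-sub μ _ _))))
      D-contract : ∀ i → 𝔼 μ (λ a → ‖ D i (k a) ‖²) ≤ ‖ D (suc i) h ‖²
      D-contract i = begin
        𝔼 μ (λ a → ‖ D i (k a) ‖²)
          ≡⟨ 𝔼-cong μ (λ a → 𝔼-cong (E n) (λ x → cong sq (D-k i a x))) ⟩
        𝔼 μ (λ a → ⟪ (λ x → sq (r * d i a x + (1ℚ - r) * 𝔼 μ (λ b → d i b x))) ⟫)
          ≡⟨ E-swap n (λ x a → sq (r * d i a x + (1ℚ - r) * 𝔼 μ (λ b → d i b x))) ⟨
        ⟪ (λ x → 𝔼 μ (λ a → sq (r * d i a x + (1ℚ - r) * 𝔼 μ (λ b → d i b x)))) ⟫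
          ≤⟨ 𝔼-mono (E n) (λ x → mix-contract u (λ a → d i a x)) ⟩
        ⟪ (λ x → 𝔼 μ (λ a → sq (d i a x))) ⟫
          ≡⟨ E-swap n (λ x a → sq (d i a x)) ⟩
        𝔼 μ (λ a → ‖ d i a ‖²)
          ≡⟨ 𝔼-cong μ (λ a → 𝔼-cong (E n) (λ x → cong (λ z → sq (h (a ∷ x) - z)) (T-allBut-suc i h a x))) ⟨
        ‖ D (suc i) h ‖² ∎
      second : K - L ≤ sum (λ i → (1ℚ - sq (lookup rs i)) * ‖ D (suc i) h ‖²)
      second = begin
        K - L
          ≡⟨ 𝔼-sub μ _ _ ⟨
        𝔼 μ (λ a → ‖ k a ‖² - ‖ T rs (k a) ‖²)
          ≤⟨ 𝔼-mono μ (λ a → energy-loss us (k a)) ⟩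
        𝔼 μ (λ a → sum (λ i → (1ℚ - sq (lookup rs i)) * ‖ D i (k a) ‖²))
          ≡⟨ 𝔼-sum μ (λ i a → (1ℚ - sq (lookup rs i)) * ‖ D i (k a) ‖²) ⟩
        sum (λ i → 𝔼 μ (λ a → (1ℚ - sq (lookup rs i)) * ‖ D i (k a) ‖²))
          ≡⟨ sum-cong-≗ (λ i → 𝔼-* μ (1ℚ - sq (lookup rs i)) (λ a → ‖ D i (k a) ‖²)) ⟩
        sum (λ i → (1ℚ - sq (lookup rs i)) * 𝔼 μ (λ a → ‖ D i (k a) ‖²))
          ≤⟨ sum-mono (λ i → *-monoˡ (1-sq≥0 (lookupAll us i)) (D-contract i)) ⟩
        sum (λ i → (1ℚ - sq (lookup rs i)) * ‖ D (suc i) h ‖²) ∎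
        where
        lookupAll : ∀ {m} {v : Vec ℚ m} → All Unit v → ∀ i → Unit (lookup v i)
        lookupAll (p ∷ ps) zero    = p
        lookupAll (p ∷ ps) (suc i) = lookupAll ps i

    -- Tensorisation: split off the first coordinate as T u = A + σ B with B of mean zero; the terms of odd degree
    -- in B vanish or are absorbed by 2 σ² B² (A - σ B)² ≥ 0.
    hypercontractivity : ∀ {w σ} → (∀ f → (∀ a → 0ℚ ≤ f a) → ∀ a → w * f a ≤ 𝔼 μ f) →
      0ℚ ≤ w → 0ℚ ≤ σ → 4ℚ * sq σ ≤ 1ℚ → (1ℚ + 2ℚ) * sq (sq σ) ≤ w →
      ∀ n (u : Vec Ω n → ℚ) → ⟪ (λ x → sq (sq (T (replicate n σ) u x))) ⟫ ≤ sq ‖ u ‖²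
    hypercontractivity weight 0≤w 0≤σ 4σ²≤1 3σ⁴≤w zero u = ≤-refl
    hypercontractivity {w} {σ} weight 0≤w 0≤σ 4σ²≤1 3σ⁴≤w (suc n) u = begin
      𝔼 μ (λ a → ⟪ (λ x → sq (sq (T (σ ∷ σs) u (a ∷ x)))) ⟫)
        ≤⟨ 𝔼-mono μ (λ a → 𝔼-mono (E n) (λ x → pointwise a x)) ⟩
      𝔼 μ (λ a → ⟪ (λ x → bound a x) ⟫)
        ≡⟨ expand ⟩
      ⟪ (λ x → sq (sq (A x))) ⟫ + 8σ² * 𝔼 μ (λ a → ⟪ (λ x → sq (A x) * sq (B a x)) ⟫) + 3σ⁴ * 𝔼 μ (λ a → ⟪ (λ x → sq (sq (B a x))) ⟫)
        ≤⟨ +-mono-≤ (+-mono-≤ ih-A (*-monoˡ 0≤8σ² (𝔼-mono μ cross))) (*-monoˡ 0≤3σ⁴ (𝔼-mono μ ih-B)) ⟩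
      sq α + 8σ² * 𝔼 μ (λ a → α * β a) + 3σ⁴ * 𝔼 μ (λ a → sq (β a))
        ≤⟨ +-mono-≤ (+-monoʳ-≤ (sq α) (≤-trans (≤-reflexive (cong (8σ² *_) (𝔼-* μ α β))) (*-monoʳ (0≤* 0≤α 0≤𝔼β) 8σ²≤2)))
             (≤-trans (*-monoʳ (𝔼-nonneg μ (λ a → 0≤sq (β a))) 3σ⁴≤w) w𝔼β²) ⟩
      sq α + 2ℚ * (α * 𝔼 μ β) + sq (𝔼 μ β)
        ≡⟨ solve 2 (λ a b → a :* a :+ con 2ℚ :* (a :* b) :+ b :* b := (a :+ b) :* (a :+ b)) refl α (𝔼 μ β) ⟩
      sq (α + 𝔼 μ β)
        ≡⟨ cong sq variance ⟨
      sq ‖ u ‖² ∎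
      where
      σs = replicate n σ
      -- In (A + σ B)⁴ the terms σ² A² B² and σ⁴ B⁴ have coefficients 6 and 1; adding 2 σ² B² (A - σ
      -- B)² cancels 4 σ³ A B³ and turns these into 8 and 3.
      8σ² = 2ℚ * (4ℚ * sq σ)
      3σ⁴ = (1ℚ + 2ℚ) * sq (sq σ)
      m : Vec Ω n → ℚ
      m y = 𝔼 μ (λ a → u (a ∷ y))
      v : Ω → Vec Ω n → ℚ
      v a y = u (a ∷ y) - m y
      A : Vec Ω n → ℚ
      A = T σs m
      B : Ω → Vec Ω n → ℚ
      B a = T σs (v a)
      α = ‖ m ‖²
      β : Ω → ℚ
      β a = ‖ v a ‖²
      0≤α : 0ℚ ≤ α
      0≤α = 𝔼-nonneg (E n) (λ x → 0≤sq (m x))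
      0≤β : ∀ a → 0ℚ ≤ β a
      0≤β a = 𝔼-nonneg (E n) (λ x → 0≤sq (v a x))
      0≤𝔼β : 0ℚ ≤ 𝔼 μ β
      0≤𝔼β = 𝔼-nonneg μ 0≤β
      0≤8σ² : 0ℚ ≤ 8σ²
      0≤8σ² = 0≤* 0≤2 (0≤* (0≤+ 0≤2 0≤2) (0≤sq σ))
      0≤3σ⁴ : 0ℚ ≤ 3σ⁴
      0≤3σ⁴ = 0≤* (0≤+ 0≤1 0≤2) (0≤sq (sq σ))
      8σ²≤2 : 8σ² ≤ 2ℚ
      8σ²≤2 = subst (8σ² ≤_) (*-identityʳ 2ℚ) (*-monoˡ 0≤2 4σ²≤1)
      bound : Ω → Vec Ω n → ℚ
      bound a x = sq (sq (A x)) + 4ℚ * σ * (sq (A x) * A x * B a x) + 8σ² * (sq (A x) * sq (B a x)) + 3σ⁴ * sq (sq (B a x))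
      T-split : ∀ a x → T (σ ∷ σs) u (a ∷ x) ≡ A x + σ * B a x
      T-split a x = trans (cong (λ z → σ * T σs (λ y → u (a ∷ y)) x + (1ℚ - σ) * z) (sym (T-𝔼 σs (λ b y → u (b ∷ y)) x)))
        (trans (solve 3 (λ s p q → s :* p :+ (con 1ℚ :- s) :* q := q :+ s :* (p :- q)) refl σ (T σs (λ y → u (a ∷ y)) x) (A x))
          (cong (λ z → A x + σ * z) (sym (T-sub σs (λ y → u (a ∷ y)) m x))))
      pointwise : ∀ a x → sq (sq (T (σ ∷ σs) u (a ∷ x))) ≤ bound a x
      pointwise a x = subst (λ z → sq (sq z) ≤ bound a x) (sym (T-split a x))
        (≤-by (0≤* 0≤2 (0≤sq (σ * B a x * (A x - σ * B a x))))
          (solve 3 (λ a b s → a :* a :* (a :* a) :+ con 4ℚ :* s :* (a :* a :* a :* b) :+ con 2ℚ :* (con 4ℚ :* (s :* s)) :* (a :* a :* (b :* b))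
               :+ con (1ℚ + 2ℚ) :* (s :* s :* (s :* s)) :* (b :* b :* (b :* b))
               :- (a :+ s :* b) :* (a :+ s :* b) :* ((a :+ s :* b) :* (a :+ s :* b))
            := con 2ℚ :* (s :* b :* (a :- s :* b) :* (s :* b :* (a :- s :* b)))) refl (A x) (B a x) σ))
      𝔼B : ∀ x → 𝔼 μ (λ a → B a x) ≡ 0ℚ
      𝔼B x = trans (sym (T-𝔼 σs v x)) (trans (T-cong σs (λ y → trans (𝔼-sub μ _ _) (trans (cong (λ z → m y - z) (𝔼-const μ (m y))) (+-inverseʳ (m y)))) x) (T-const σs 0ℚ x))
      odd : 𝔼 μ (λ a → ⟪ (λ x → sq (A x) * A x * B a x) ⟫) ≡ 0ℚ
      odd = trans (sym (E-swap n (λ x a → sq (A x) * A x * B a x)))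
        (trans (𝔼-cong (E n) (λ x → trans (𝔼-* μ (sq (A x) * A x) (λ a → B a x)) (trans (cong (sq (A x) * A x *_) (𝔼B x)) (*-zeroʳ (sq (A x) * A x)))))
        (𝔼-const (E n) 0ℚ))
      expand : 𝔼 μ (λ a → ⟪ (λ x → bound a x) ⟫)
        ≡ ⟪ (λ x → sq (sq (A x))) ⟫ + 8σ² * 𝔼 μ (λ a → ⟪ (λ x → sq (A x) * sq (B a x)) ⟫) + 3σ⁴ * 𝔼 μ (λ a → ⟪ (λ x → sq (sq (B a x))) ⟫)
      expand = trans (𝔼-cong μ (λ a → 𝔼-affine (E n) (λ x → sq (sq (A x))) (4ℚ * σ) (λ x → sq (A x) * A x * B a x)
          8σ² (λ x → sq (A x) * sq (B a x)) 3σ⁴ (λ x → sq (sq (B a x)))))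
        (trans (𝔼-affine μ (λ _ → ⟪ (λ x → sq (sq (A x))) ⟫) (4ℚ * σ) _ 8σ² _ 3σ⁴ _)
        (cong (λ z → z + 8σ² * 𝔼 μ (λ a → ⟪ (λ x → sq (A x) * sq (B a x)) ⟫) + 3σ⁴ * 𝔼 μ (λ a → ⟪ (λ x → sq (sq (B a x))) ⟫))
          (trans (cong₂ (λ p q → p + 4ℚ * σ * q) (𝔼-const μ ⟪ (λ x → sq (sq (A x))) ⟫) odd)
            (solve 2 (λ p s → p :+ con 4ℚ :* s :* con 0ℚ := p) refl ⟪ (λ x → sq (sq (A x))) ⟫ σ))))
      hyp = hypercontractivity weight 0≤w 0≤σ 4σ²≤1 3σ⁴≤w n
      ih-A : ⟪ (λ x → sq (sq (A x))) ⟫ ≤ sq α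
      ih-A = hyp m
      ih-B : ∀ a → ⟪ (λ x → sq (sq (B a x))) ⟫ ≤ sq (β a)
      ih-B a = hyp (v a)
      cross : ∀ a → ⟪ (λ x → sq (A x) * sq (B a x)) ⟫ ≤ α * β a
      cross a = sq-cancel-≤ (0≤* 0≤α (0≤β a)) (begin
        sq ⟪ (λ x → sq (A x) * sq (B a x)) ⟫                          ≤⟨ cauchy-schwarz (E n) (λ x → sq (A x)) (λ x → sq (B a x)) ⟩
        ⟪ (λ x → sq (sq (A x))) ⟫ * ⟪ (λ x → sq (sq (B a x))) ⟫       ≤⟨ *-mono (𝔼-nonneg (E n) (λ x → 0≤sq (sq (A x)))) (0≤sq (β a)) ih-A (ih-B a) ⟩
        sq α * sq (β a)                                               ≡⟨ solve 2 (λ a b → a :* a :* (b :* b) := a :* b :* (a :* b)) refl α (β a) ⟩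
        sq (α * β a) ∎)
      -- The lower bound on atoms enters here: `weight` gives w β ≤ 𝔼 β pointwise, which bounds the
      -- second moment of β by its squared mean.
      w𝔼β² : w * 𝔼 μ (λ a → sq (β a)) ≤ sq (𝔼 μ β)
      w𝔼β² = begin
        w * 𝔼 μ (λ a → sq (β a))    ≡⟨ 𝔼-* μ w _ ⟨
        𝔼 μ (λ a → w * sq (β a))    ≤⟨ 𝔼-mono μ (λ a → ≤-trans (≤-reflexive (sym (*-assoc w (β a) (β a)))) (*-monoʳ (0≤β a) (weight β 0≤β a))) ⟩
        𝔼 μ (λ a → 𝔼 μ β * β a)     ≡⟨ 𝔼-* μ (𝔼 μ β) β ⟩
        sq (𝔼 μ β) ∎
      variance : ‖ u ‖² ≡ α + 𝔼 μ β
      variance = trans (sym (E-swap n (λ x a → sq (u (a ∷ x))))) (trans (𝔼-cong (E n) (λ x → pt x))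
        (trans (𝔼-+ (E n) (λ x → sq (m x)) (λ x → 𝔼 μ (λ a → sq (v a x)))) (cong (α +_) (E-swap n (λ x a → sq (v a x))))))
        where
        pt : ∀ x → 𝔼 μ (λ a → sq (u (a ∷ x))) ≡ sq (m x) + 𝔼 μ (λ a → sq (v a x))
        pt x = trans (solve 2 (λ S M → S := M :+ (S :- M)) refl S (sq (m x))) (cong (sq (m x) +_)
          (trans (cong (λ z → S - z) (sym (trans (𝔼-cong μ (λ a → solve 2 (λ p m → (con 0ℚ :* p :+ (con 1ℚ :- con 0ℚ) :* m) :* (con 0ℚ :* p :+ (con 1ℚ :- con 0ℚ) :* m) := m :* m) refl (u (a ∷ x)) (m x))) (𝔼-const μ (sq (m x))))))
          (trans (mix 0ℚ (λ a → u (a ∷ x))) (solve 1 (λ z → (con 1ℚ :- con 0ℚ :* con 0ℚ) :* z := z) refl (𝔼 μ (λ a → sq (v a x)))))))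
          where S = 𝔼 μ (λ a → sq (u (a ∷ x)))

    noise : ∀ {n} → ℚ → (Vec Ω n → ℚ) → Vec Ω n → ℚ
    noise {n} ρ = T (replicate n ρ)

    P : ∀ {n} → Subset n → (Vec Ω n → ℚ) → Vec Ω n → ℚ
    P J = T (map χ J)

    P-P : ∀ {n} (J K : Subset n) f x → P J (P K f) x ≡ P (J ∩ K) f x
    P-P J K f x = trans (T-T (map χ J) (map χ K) f x) (cong (λ v → T v f x) (χ-∩ J K))

    -- `P J` is self-adjoint and idempotent, so the cross term ⟪ f · P J f ⟫ equals ‖ P J f ‖².
    pythagoras : ∀ {n} (J : Subset n) f → ‖ (λ x → f x - P J f x) ‖² ≡ ‖ f ‖² - ‖ P J f ‖²
    pythagoras {n} J f = trans (𝔼-cong (E n) (λ x → solve 2 (λ a b → (a :- b) :* (a :- b)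
        := con 1ℚ :* (a :* a) :+ con (- 2ℚ) :* (a :* b) :+ con 1ℚ :* (b :* b)) refl (f x) (P J f x)))
      (trans (𝔼-lin₃ (E n) 1ℚ _ (- 2ℚ) _ 1ℚ _)
      (trans (cong (λ z → 1ℚ * ‖ f ‖² + - 2ℚ * z + 1ℚ * ‖ P J f ‖²) fPf)
      (solve 2 (λ a b → con 1ℚ :* a :+ con (- 2ℚ) :* b :+ con 1ℚ :* b := a :- b) refl ‖ f ‖² ‖ P J f ‖²)))
      where
      fPf : ⟪ (λ x → f x * P J f x) ⟫ ≡ ‖ P J f ‖²
      fPf = trans (𝔼-cong (E n) (λ x → cong (f x *_) (sym (trans (P-P J J f x) (cong (λ S → P S f x) (Subset.∩-idem J))))))
        (sym (T-adj (map χ J) f (P J f)))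

    -- Hölder's inequality for g = g p, as two applications of Cauchy–Schwarz; p is the indicator of a set carrying g.
    influence-bound : ∀ {n} (r : Vec ℚ n) → (∀ u → ⟪ (λ x → sq (sq (T r u x))) ⟫ ≤ sq ‖ u ‖²) →
      ∀ g p → (∀ x → g x * p x ≡ g x) → (∀ x → p x * p x ≡ p x) → (∀ x → sq (g x) ≤ p x) →
      sq ‖ T r g ‖² ≤ ⟪ p ⟫ * ⟪ p ⟫ * ⟪ p ⟫
    influence-bound {n} r hyper g p gp pp g²≤p = finish (0ℚ <? X)
      where
      X I Y : ℚ
      X = ‖ T r g ‖²
      I = ⟪ p ⟫
      u : Vec Ω n → ℚ
      u = T r (T r g)
      Y = ⟪ (λ x → p x * sq (u x)) ⟫
      0≤p : ∀ x → 0ℚ ≤ p x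
      0≤p x = ≤-trans (0≤sq (g x)) (g²≤p x)
      0≤I : 0ℚ ≤ I
      0≤I = 𝔼-nonneg (E n) 0≤p
      0≤X : 0ℚ ≤ X
      0≤X = 𝔼-nonneg (E n) (λ x → 0≤sq (T r g x))
      0≤Y : 0ℚ ≤ Y
      0≤Y = 𝔼-nonneg (E n) (λ x → 0≤* (0≤p x) (0≤sq (u x)))
      X≡ : X ≡ ⟪ (λ x → g x * (p x * u x)) ⟫
      X≡ = trans (T-adj r g (T r g)) (𝔼-cong (E n) (λ x → trans (cong (_* u x) (sym (gp x))) (*-assoc (g x) (p x) (u x))))
      X²≤ : sq X ≤ I * Y
      X²≤ = begin
        sq X                                                       ≡⟨ cong sq X≡ ⟩
        sq ⟪ (λ x → g x * (p x * u x)) ⟫                           ≤⟨ cauchy-schwarz (E n) g (λ x → p x * u x) ⟩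
        ⟪ (λ x → sq (g x)) ⟫ * ⟪ (λ x → sq (p x * u x)) ⟫          ≡⟨ cong (‖ g ‖² *_) (𝔼-cong (E n) (λ x → trans
            (solve 2 (λ p u → p :* u :* (p :* u) := p :* p :* (u :* u)) refl (p x) (u x)) (cong (_* sq (u x)) (pp x)))) ⟩
        ‖ g ‖² * Y                                                 ≤⟨ *-monoʳ 0≤Y (𝔼-mono (E n) g²≤p) ⟩
        I * Y ∎
      Y²≤ : sq Y ≤ I * sq X
      Y²≤ = begin
        sq Y                                                       ≤⟨ cauchy-schwarz (E n) p (λ x → sq (u x)) ⟩
        ⟪ (λ x → sq (p x)) ⟫ * ⟪ (λ x → sq (sq (u x))) ⟫           ≡⟨ cong (_* ⟪ (λ x → sq (sq (u x))) ⟫) (𝔼-cong (E n) pp) ⟩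
        I * ⟪ (λ x → sq (sq (u x))) ⟫                              ≤⟨ *-monoˡ 0≤I (hyper (T r g)) ⟩
        I * sq X ∎
      finish : _ → sq X ≤ I * I * I
      -- X⁴ ≤ I² Y² ≤ I³ X², and cancelling X² requires X > 0.
      finish (yes 0<X) = *-cancelˡ (0<* 0<X 0<X) (begin
        sq X * sq X           ≤⟨ *-mono (0≤sq X) (0≤* 0≤I 0≤Y) X²≤ X²≤ ⟩
        I * Y * (I * Y)       ≡⟨ solve 2 (λ i y → i :* y :* (i :* y) := i :* i :* (y :* y)) refl I Y ⟩
        I * I * sq Y          ≤⟨ *-monoˡ (0≤sq I) Y²≤ ⟩
        I * I * (I * sq X)    ≡⟨ solve 2 (λ i x → i :* i :* (i :* x) := x :* (i :* i :* i)) refl I (sq X) ⟩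
        sq X * (I * I * I)    ∎)
      finish (no X≯0) = ≤-trans (≤-reflexive (cong sq (≤-antisym (≮⇒≥ X≯0) 0≤X))) (0≤* (0≤sq I) 0≤I)

    noise-∘ : ∀ {n} ρ k f (x : Vec Ω n) → noise ρ (noise (pow ρ k) f) x ≡ noise (pow ρ (suc k)) f x
    noise-∘ {n} ρ k f x = trans (T-T (replicate n ρ) (replicate n (pow ρ k)) f x)
      (cong (λ v → T v f x) (Vec.zipWith-replicate {n = n} _*_ ρ (pow ρ k)))

    -- Self-adjointness moves one noise step across the inner product of steps k and k + 2, making
    -- it the squared norm of step k + 1; then Cauchy-Schwarz applies.
    log-convex : ∀ {n} ρ k (f : Vec Ω n → ℚ) →
      sq ‖ noise (pow ρ (suc k)) f ‖² ≤ ‖ noise (pow ρ k) f ‖² * ‖ noise (pow ρ (suc (suc k))) f ‖²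
    log-convex {n} ρ k f = subst (λ z → sq z ≤ ‖ noise (pow ρ k) f ‖² * ‖ noise (pow ρ (suc (suc k))) f ‖²) eq
      (cauchy-schwarz (E n) (noise (pow ρ k) f) (noise (pow ρ (suc (suc k))) f))
      where
      eq : ⟪ (λ x → noise (pow ρ k) f x * noise (pow ρ (suc (suc k))) f x) ⟫ ≡ ‖ noise (pow ρ (suc k)) f ‖²
      eq = trans (𝔼-cong (E n) (λ x → cong (noise (pow ρ k) f x *_) (sym (noise-∘ ρ (suc k) f x))))
        (trans (sym (T-adj (replicate n ρ) (noise (pow ρ k) f) (noise (pow ρ (suc k)) f)))
        (𝔼-cong (E n) (λ x → cong (_* noise (pow ρ (suc k)) f x) (noise-∘ ρ k f x))))

    -- By log-convexity the ratios of consecutive energies do not decrease, so a first ratio of at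
    -- least ½ persists.
    slow-decay : ∀ {n} ρ (f : Vec Ω n → ℚ) → ½ * ‖ noise (pow ρ 0) f ‖² ≤ ‖ noise (pow ρ 1) f ‖² →
      ∀ k → ½ * ‖ noise (pow ρ k) f ‖² ≤ ‖ noise (pow ρ (suc k)) f ‖²
    slow-decay ρ f base zero    = base
    slow-decay {n} ρ f base (suc k) with 0ℚ <? ‖ noise (pow ρ (suc k)) f ‖²
    ... | yes 0<b = *-cancelˡ 0<b (begin
        b * (½ * b)      ≡⟨ solve 1 (λ b → b :* (con ½ :* b) := con ½ :* (b :* b)) refl b ⟩
        ½ * sq b         ≤⟨ *-monoˡ 0≤½ (log-convex ρ k f) ⟩
        ½ * (a * c)      ≡⟨ *-assoc ½ a c ⟨
        ½ * a * c        ≤⟨ *-monoʳ (𝔼-nonneg (E n) (λ x → 0≤sq (noise (pow ρ (suc (suc k))) f x))) (slow-decay ρ f base k) ⟩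
        b * c            ∎)
      where
      a b c : ℚ
      a = ‖ noise (pow ρ k) f ‖²
      b = ‖ noise (pow ρ (suc k)) f ‖²
      c = ‖ noise (pow ρ (suc (suc k))) f ‖²
    ... | no b≯0 = ≤-trans (*-monoˡ 0≤½ (≮⇒≥ b≯0)) (≤-trans (≤-reflexive (*-zeroʳ ½)) (𝔼-nonneg (E n) (λ x → 0≤sq (noise (pow ρ (suc (suc k))) f x))))

    slow-decay-pow : ∀ {n} ρ (f : Vec Ω n → ℚ) → ½ * ‖ noise (pow ρ 0) f ‖² ≤ ‖ noise (pow ρ 1) f ‖² →
      ∀ k → pow ½ k * ‖ noise (pow ρ 0) f ‖² ≤ ‖ noise (pow ρ k) f ‖²
    slow-decay-pow ρ f base zero    = ≤-reflexive (*-identityˡ _)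
    slow-decay-pow ρ f base (suc k) = ≤-trans (≤-reflexive (*-assoc ½ (pow ½ k) _))
      (≤-trans (*-monoˡ 0≤½ (slow-decay-pow ρ f base k)) (slow-decay ρ f base k))

    -- If ‖ f ‖² ≥ θ for f = F - P J F, small total influence makes the energy of f drop by at most half per noise step, so
    -- by log-convexity ‖ noise σ f ‖² ≥ pow ½ m * θ; but the coordinates outside J contribute at most κ I i each.
    friedgut : ∀ {w K θ} (C : Constants w K θ) → (∀ f → (∀ a → 0ℚ ≤ f a) → ∀ a → w * f a ≤ 𝔼 μ f) →
      ∀ {n} (F : Vec Ω n → ℚ) (p : Fin n → Vec Ω n → ℚ) →
      (∀ i x → D i F x * p i x ≡ D i F x) → (∀ i x → p i x * p i x ≡ p i x) → (∀ i x → sq (D i F x) ≤ p i x) →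
      sum (λ i → ⟪ p i ⟫) ≤ K →
      Σ (Subset n) λ J → ∣ J ∣ ℕ.≤ Constants.s C × ‖ (λ x → F x - P J F x) ‖² < θ
    friedgut {w} {K} {θ} C weight {n} F p gp pp g²≤p ΣI≤K = J , |J|≤s , ≰⇒> (λ θ≤ → contra θ≤)
      where
      open Constants C
      ρ σ : ℚ
      ρ = 1ℚ - δ
      σ = pow ρ m
      I : Fin n → ℚ
      I i = ⟪ p i ⟫
      0≤I : ∀ i → 0ℚ ≤ I i
      0≤I i = 𝔼-nonneg (E n) (λ x → ≤-trans (0≤sq (D i F x)) (g²≤p i x))
      -- With threshold κ², the bound X² ≤ I³ of `influence-bound` becomes X ≤ κ I for light
      -- coordinates, which is linear in I and can be summed.
      chosen = markov (sq κ) (0≤sq κ) 0≤I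
      J : Subset n
      J = proj₁ chosen
      |J|≤s : ∣ J ∣ ℕ.≤ s
      |J|≤s = ι-cancel-≤ (*-cancelˡ (0<* 0<κ 0<κ) (subst₂ _≤_ (*-comm (ι ∣ J ∣) (sq κ)) (*-comm (ι s) (sq κ))
        (≤-trans (proj₂ (proj₂ chosen)) (≤-trans ΣI≤K K≤sκ²))))
      0≤ρ : 0ℚ ≤ ρ
      0≤ρ = ≤⇒0≤- δ≤1
      ρ-unit : Unit ρ
      ρ-unit = 0≤ρ , ≤-by (<⇒≤ 0<δ) (solve 1 (λ d → con 1ℚ :- (con 1ℚ :- d) := d) refl δ)
      0≤σ : 0ℚ ≤ σ
      0≤σ = 0≤pow m 0≤ρ
      0≤w = <⇒≤ 0<w
      4σ²≤w : 4ℚ * sq σ ≤ w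
      4σ²≤w = begin
        4ℚ * sq σ                      ≤⟨ *-monoˡ (0≤+ 0≤2 0≤2) (*-mono 0≤σ (0≤* 0≤½ 0≤w) σ≤w/2 σ≤w/2) ⟩
        4ℚ * (½ * w * (½ * w))         ≡⟨ solve 1 (λ w → con 4ℚ :* (con ½ :* w :* (con ½ :* w)) := w :* w) refl w ⟩
        w * w                          ≤⟨ *-monoˡ 0≤w w≤1 ⟩
        w * 1ℚ                         ≡⟨ *-identityʳ w ⟩
        w ∎
      3σ⁴≤w : (1ℚ + 2ℚ) * sq (sq σ) ≤ w
      3σ⁴≤w = begin
        (1ℚ + 2ℚ) * sq (sq σ)          ≤⟨ *-monoʳ (0≤sq (sq σ)) (≤ᵇ⇒≤ {1ℚ + 2ℚ} {4ℚ} _) ⟩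
        4ℚ * (sq σ * sq σ)             ≡⟨ *-assoc 4ℚ (sq σ) (sq σ) ⟨
        4ℚ * sq σ * sq σ               ≤⟨ *-mono (0≤* (0≤+ 0≤2 0≤2) (0≤sq σ)) 0≤1 4σ²≤w (*-mono 0≤σ 0≤1 (pow≤1 m 0≤ρ (proj₂ ρ-unit)) (pow≤1 m 0≤ρ (proj₂ ρ-unit))) ⟩
        w * 1ℚ                         ≡⟨ *-identityʳ w ⟩
        w ∎
      hyper : ∀ u → ⟪ (λ x → sq (sq (noise σ u x))) ⟫ ≤ sq ‖ u ‖²
      hyper = hypercontractivity weight 0≤w 0≤σ (≤-trans 4σ²≤w w≤1) 3σ⁴≤w n
      X : Fin n → ℚ
      X i = ‖ noise σ (D i F) ‖²
      f : Vec Ω n → ℚ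
      f x = F x - P J F x
      a₀≡ : ‖ noise (pow ρ 0) f ‖² ≡ ‖ f ‖²
      a₀≡ = 𝔼-cong (E n) (λ x → cong sq (T-ones n f x))
      noise-split : ∀ τ x → noise τ f x ≡ noise τ F x - P J (noise τ F) x
      noise-split τ x = trans (T-sub (replicate n τ) F (P J F) x) (cong (λ z → noise τ F x - z) (T-comm (replicate n τ) (map χ J) F x))
      noise-norm : ∀ τ → ‖ noise τ f ‖² ≡ ‖ noise τ F ‖² - ‖ P J (noise τ F) ‖²
      noise-norm τ = trans (𝔼-cong (E n) (λ x → cong sq (noise-split τ x))) (pythagoras J (noise τ F))
      loss : ‖ F ‖² - ‖ noise ρ F ‖² ≤ 2ℚ * (δ * K)
      loss = begin
        ‖ F ‖² - ‖ noise ρ F ‖²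
          ≤⟨ energy-loss (replicate-units n ρ-unit) F ⟩
        sum (λ i → (1ℚ - sq (lookup (replicate n ρ) i)) * ‖ D i F ‖²)
          ≡⟨ sum-cong-≗ (λ i → cong (λ z → (1ℚ - sq z) * ‖ D i F ‖²) (Vec.lookup-replicate i ρ)) ⟩
        sum (λ i → (1ℚ - sq ρ) * ‖ D i F ‖²)
          ≤⟨ sum-mono (λ i → *-mono (1-sq≥0 ρ-unit) (0≤I i) 1-ρ²≤2δ (𝔼-mono (E n) (g²≤p i))) ⟩
        sum (λ i → 2ℚ * δ * I i)
          ≡⟨ *-distribˡ-sum (2ℚ * δ) I ⟨
        2ℚ * δ * sum I
          ≤⟨ *-monoˡ (0≤* 0≤2 (<⇒≤ 0<δ)) ΣI≤K ⟩
        2ℚ * δ * K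
          ≡⟨ *-assoc 2ℚ δ K ⟩
        2ℚ * (δ * K) ∎
        where
        1-ρ²≤2δ : 1ℚ - sq ρ ≤ 2ℚ * δ
        1-ρ²≤2δ = ≤-by (0≤sq δ) (solve 1 (λ d → con 2ℚ :* d :- (con 1ℚ :- (con 1ℚ :- d) :* (con 1ℚ :- d)) := d :* d) refl δ)
      -- f loses no more energy than F: by orthogonality the losses of f and of `P J F` add up to
      -- that of F, and the latter is nonnegative.
      a₁≥ : ‖ f ‖² - 2ℚ * (δ * K) ≤ ‖ noise (pow ρ 1) f ‖²
      a₁≥ = begin
        ‖ f ‖² - 2ℚ * (δ * K)
          ≤⟨ +-monoʳ-≤ ‖ f ‖² (neg-antimono-≤ loss) ⟩
        ‖ f ‖² - (‖ F ‖² - ‖ noise ρ F ‖²)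
          ≡⟨ cong (λ z → z - (‖ F ‖² - ‖ noise ρ F ‖²)) (pythagoras J F) ⟩
        (‖ F ‖² - ‖ P J F ‖²) - (‖ F ‖² - ‖ noise ρ F ‖²)
          ≡⟨ solve 3 (λ a b c → (a :- b) :- (a :- c) := c :- b) refl ‖ F ‖² ‖ P J F ‖² ‖ noise ρ F ‖² ⟩
        ‖ noise ρ F ‖² - ‖ P J F ‖²
          ≤⟨ +-monoʳ-≤ ‖ noise ρ F ‖² (neg-antimono-≤ contract) ⟩
        ‖ noise ρ F ‖² - ‖ P J (noise ρ F) ‖²
          ≡⟨ noise-norm ρ ⟨
        ‖ noise ρ f ‖²
          ≡⟨ cong (λ τ → ‖ noise τ f ‖²) (*-identityʳ ρ) ⟨
        ‖ noise (pow ρ 1) f ‖² ∎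
        where
        contract : ‖ P J (noise ρ F) ‖² ≤ ‖ P J F ‖²
        contract = ≤-trans (≤-reflexive (𝔼-cong (E n) (λ x → cong sq (T-comm (map χ J) (replicate n ρ) F x))))
          (T-contract (replicate-units n ρ-unit) (P J F))
      X-bound : ∀ i → (1ℚ - sq (lookup (map χ J) i)) * ‖ D i (noise σ F) ‖² ≤ κ * I i
      X-bound i = subst₂ (λ c y → (1ℚ - sq c) * y ≤ κ * I i) (sym (Vec.lookup-map i χ J)) (sym D-noise) (bit (lookup J i) refl)
        where
        D-noise : ‖ D i (noise σ F) ‖² ≡ X i
        D-noise = 𝔼-cong (E n) (λ x → cong sq (trans (cong (λ z → noise σ F x - z) (T-comm (allBut i) (replicate n σ) F x))
          (sym (T-sub (replicate n σ) F (T (allBut i) F) x))))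
        0≤κI = 0≤* (<⇒≤ 0<κ) (0≤I i)
        bit : ∀ b → lookup J i ≡ b → (1ℚ - sq (χ b)) * X i ≤ κ * I i
        bit true  e = ≤-trans (≤-reflexive (solve 1 (λ x → (con 1ℚ :- con 1ℚ :* con 1ℚ) :* x := con 0ℚ) refl (X i))) 0≤κI
        bit false e = ≤-trans (≤-reflexive (solve 1 (λ x → (con 1ℚ :- con 0ℚ :* con 0ℚ) :* x := x) refl (X i)))
          (sq-cancel-≤ 0≤κI (begin
            sq (X i)                 ≤⟨ influence-bound (replicate n σ) hyper (D i F) (p i) (gp i) (pp i) (g²≤p i) ⟩
            I i * I i * I i          ≤⟨ *-monoˡ (0≤sq (I i)) (proj₁ (proj₂ chosen) i e) ⟩
            I i * I i * sq κ         ≡⟨ solve 2 (λ a k → a :* a :* (k :* k) := k :* a :* (k :* a)) refl (I i) κ ⟩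
            sq (κ * I i) ∎))
      aₘ≤ : ‖ noise σ f ‖² ≤ ½ * (pow ½ m * θ)
      aₘ≤ = begin
        ‖ noise σ f ‖²                                                               ≡⟨ noise-norm σ ⟩
        ‖ noise σ F ‖² - ‖ P J (noise σ F) ‖²                                            ≤⟨ energy-loss (χ-units J) (noise σ F) ⟩
        sum (λ i → (1ℚ - sq (lookup (map χ J) i)) * ‖ D i (noise σ F) ‖²)            ≤⟨ sum-mono X-bound ⟩
        sum (λ i → κ * I i)                                                      ≡⟨ *-distribˡ-sum κ I ⟨
        κ * sum I                                                                ≤⟨ *-monoˡ (<⇒≤ 0<κ) ΣI≤K ⟩
        κ * K                                                                    ≤⟨ κK≤ ⟩
        ½ * (pow ½ m * θ) ∎
      contra : ¬ (θ ≤ ‖ f ‖²)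
      contra θ≤ = ≤⇒¬< too-big half<
        where
        -- The loss 2 δ K is at most θ / 2, hence at most half of ‖ f ‖².
        base : ½ * ‖ noise (pow ρ 0) f ‖² ≤ ‖ noise (pow ρ 1) f ‖²
        base = ≤-trans (≤-trans (≤-reflexive (cong (½ *_) a₀≡)) (≤-by
            (0≤* 0≤½ (0≤+ (≤⇒0≤- θ≤) (≤⇒0≤- 4δK≤θ)))
            (solve 3 (λ f d t → f :- con 2ℚ :* d :- con ½ :* f := con ½ :* ((f :- t) :+ (t :- con 4ℚ :* d))) refl ‖ f ‖² (δ * K) θ))) a₁≥
        c>0 : 0ℚ < pow ½ m * θ
        c>0 = 0<* (0<pow m (positive⁻¹ ½)) 0<θ
        half< : ½ * (pow ½ m * θ) < pow ½ m * θ
        half< = subst (½ * (pow ½ m * θ) <_) (*-identityˡ (pow ½ m * θ)) (*-monoˡ-<-pos (pow ½ m * θ) {{positive c>0}} ½<1)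
        too-big : pow ½ m * θ ≤ ½ * (pow ½ m * θ)
        too-big = ≤-trans (*-monoˡ (0≤pow m 0≤½) (subst (θ ≤_) (sym a₀≡) θ≤)) (≤-trans (slow-decay-pow ρ f base m) aₘ≤)

  ¼ : ℚ
  ¼ = ½ * ½

  ¾ : ℚ
  ¾ = ¼ + ½

  -- Biased measures on singletons and translates

  module Uniform (N : ℕ) (ν : ℚ) (0<ν : 0ℚ < ν) (Nν≡1 : ι N * ν ≡ 1ℚ) where

    uniform : Expectation (Fin N)
    uniform = record
      { 𝔼 = λ f → ν * sum f
      ; 𝔼-cong = λ p → cong (ν *_) (sum-cong-≗ p)
      ; 𝔼-+ = λ f g → trans (cong (ν *_) (∑-distrib-+ f g)) (*-distribˡ-+ ν (sum f) (sum g))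
      ; 𝔼-* = λ c f → trans (cong (ν *_) (sym (*-distribˡ-sum c f)))
          (solve 3 (λ v c s → v :* (c :* s) := c :* (v :* s)) refl ν c (sum f))
      ; 𝔼-1 = trans (cong (ν *_) (trans (sum-const N 1ℚ) (*-identityʳ (ι N)))) (trans (*-comm ν (ι N)) Nν≡1)
      ; 𝔼-nonneg = λ p → 0≤* (<⇒≤ 0<ν) (sum-nonneg p)
      }

    U : (Fin N → ℚ) → ℚ
    U = 𝔼 uniform

    uniform-commute : Commute uniform uniform
    uniform-commute f = cong (ν *_) (trans (sym (*-distribˡ-sum ν (λ a → sum (f a))))
      (trans (cong (ν *_) (∑-comm f)) (*-distribˡ-sum ν (λ b → sum (λ a → f a b)))))

    U-weight : ∀ f → (∀ a → 0ℚ ≤ f a) → ∀ a → ν * f a ≤ U f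
    U-weight f p a = *-monoˡ (<⇒≤ 0<ν) (term≤sum p a)

    ν≤1 : Fin N → ν ≤ 1ℚ
    ν≤1 a = ≤-trans (≤-reflexive (sym (*-identityʳ ν))) (≤-trans (U-weight (λ _ → 1ℚ) (λ _ → 0≤1) a) (≤-reflexive (𝔼-1 uniform)))

    U-permute : ∀ (π π⁻¹ : Fin N → Fin N) → (∀ a → π (π⁻¹ a) ≡ a) → (∀ a → π⁻¹ (π a) ≡ a) → ∀ f → U (λ a → f (π a)) ≡ U f
    U-permute π π⁻¹ p q f = cong (ν *_) (sym (sum-permute f (permutation π π⁻¹ p q)))

    Ω : Set
    Ω = Fin N ⊎ Fin N

    -- The derivative in t of `𝔼 (biased t u) φ`, which is affine in t.
    Δ : (Ω → ℚ) → ℚ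
    Δ φ = U (λ y → φ (inj₂ y)) - U (λ g → φ (inj₁ g))

    biased : ∀ t → Unit t → Expectation Ω
    biased t (0≤t , t≤1) = record
      { 𝔼 = λ f → (1ℚ - t) * U (λ g → f (inj₁ g)) + t * U (λ y → f (inj₂ y))
      ; 𝔼-cong = λ p → cong₂ (λ u v → (1ℚ - t) * u + t * v) (𝔼-cong uniform (λ g → p (inj₁ g))) (𝔼-cong uniform (λ y → p (inj₂ y)))
      ; 𝔼-+ = λ f g → trans (cong₂ (λ u v → (1ℚ - t) * u + t * v) (𝔼-+ uniform _ _) (𝔼-+ uniform _ _))
          (solve 5 (λ t a b c d → (con 1ℚ :- t) :* (a :+ b) :+ t :* (c :+ d) := ((con 1ℚ :- t) :* a :+ t :* c) :+ ((con 1ℚ :- t) :* b :+ t :* d)) refl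
            t (U (λ x → f (inj₁ x))) (U (λ x → g (inj₁ x))) (U (λ x → f (inj₂ x))) (U (λ x → g (inj₂ x))))
      ; 𝔼-* = λ c f → trans (cong₂ (λ u v → (1ℚ - t) * u + t * v) (𝔼-* uniform c _) (𝔼-* uniform c _))
          (solve 4 (λ t c a b → (con 1ℚ :- t) :* (c :* a) :+ t :* (c :* b) := c :* ((con 1ℚ :- t) :* a :+ t :* b)) refl
            t c (U (λ x → f (inj₁ x))) (U (λ x → f (inj₂ x))))
      ; 𝔼-1 = trans (cong₂ (λ u v → (1ℚ - t) * u + t * v) (𝔼-1 uniform) (𝔼-1 uniform))
          (solve 1 (λ t → (con 1ℚ :- t) :* con 1ℚ :+ t :* con 1ℚ := con 1ℚ) refl t)
      ; 𝔼-nonneg = λ p → 0≤+ (0≤* (≤⇒0≤- t≤1) (𝔼-nonneg uniform (λ g → p (inj₁ g)))) (0≤* 0≤t (𝔼-nonneg uniform (λ y → p (inj₂ y))))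
      }

    biased-uniform : ∀ t u → Commute (biased t u) uniform
    biased-uniform t u f = trans
      (cong₂ (λ v w → (1ℚ - t) * v + t * w) (uniform-commute (λ a b → f (inj₁ a) b)) (uniform-commute (λ a b → f (inj₂ a) b)))
      (sym (𝔼-lin uniform (1ℚ - t) _ t _))

    biased-commute : ∀ t u → Commute (biased t u) (biased t u)
    biased-commute t u f = sym (trans
      (cong₂ (λ v w → (1ℚ - t) * v + t * w) (sym (biased-uniform t u (λ b a → f b (inj₁ a)))) (sym (biased-uniform t u (λ b a → f b (inj₂ a)))))
      (sym (𝔼-lin (biased t u) (1ℚ - t) (λ b → U (λ a → f b (inj₁ a))) t (λ b → U (λ a → f b (inj₂ a))))))

    -- On [¼, ¾] both kinds of set keep weight at least ¼, so the atom bound depends on neither t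
    -- nor n.
    biased-weight : ∀ t u → ¼ ≤ t → t ≤ ¾ → ∀ f → (∀ a → 0ℚ ≤ f a) → ∀ a → ¼ * ν * f a ≤ 𝔼 (biased t u) f
    biased-weight t u ¼≤t t≤¾ f p a = ≤-trans (≤-reflexive (*-assoc ¼ ν (f a))) (side a)
      where
      0≤L = 𝔼-nonneg uniform (λ g → p (inj₁ g))
      0≤R = 𝔼-nonneg uniform (λ y → p (inj₂ y))
      ¼≤1-t : ¼ ≤ 1ℚ - t
      ¼≤1-t = ≤-trans (≤ᵇ⇒≤ {¼} {1ℚ - ¾} _) (+-monoʳ-≤ 1ℚ (neg-antimono-≤ t≤¾))
      side : ∀ a → ¼ * (ν * f a) ≤ 𝔼 (biased t u) f
      side (inj₁ g) = subst (_≤ 𝔼 (biased t u) f) (+-identityʳ _) (+-mono-≤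
        (*-mono 0≤¼ 0≤L ¼≤1-t (U-weight (λ g → f (inj₁ g)) (λ g → p (inj₁ g)) g)) (0≤* (proj₁ u) 0≤R))
        where 0≤¼ = 0≤* 0≤½ 0≤½
      side (inj₂ y) = subst (_≤ 𝔼 (biased t u) f) (+-identityˡ _) (+-mono-≤
        (0≤* (≤⇒0≤- (proj₂ u)) 0≤L) (*-mono 0≤¼ 0≤R ¼≤t (U-weight (λ g → f (inj₂ g)) (λ g → p (inj₂ g)) y)))
        where 0≤¼ = 0≤* 0≤½ 0≤½

    mean : ∀ t → Unit t → ∀ {n} → (Vec Ω n → ℚ) → ℚ
    mean t u {n} = 𝔼 (product (biased t u) n)

    ∂ : ∀ {n} → Fin n → (Vec Ω n → ℚ) → Vec Ω n → ℚ
    ∂ i F x = Δ (λ b → F (x [ i ]≔ b))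

    -- By the Margulis-Russo formula this is the derivative of `mean t u F` in t; it is used only
    -- through the finite differences of `taylor`.
    gradient : ∀ t → Unit t → ∀ {n} → (Vec Ω n → ℚ) → ℚ
    gradient t u F = sum (λ i → mean t u (∂ i F))

    gradient-suc : ∀ t u {n} (F : Vec Ω (suc n) → ℚ) → gradient t u F
      ≡ Δ (λ b → mean t u (λ x → F (b ∷ x))) + 𝔼 (biased t u) (λ a → gradient t u (λ x → F (a ∷ x)))
    gradient-suc t u {n} F = cong₂ _+_
      (trans (𝔼-const (biased t u) _) (trans (𝔼-sub (product (biased t u) n) _ _)
        (cong₂ _-_ (product-commute (biased t u) uniform (biased-uniform t u) n (λ x y → F (inj₂ y ∷ x)))
                   (product-commute (biased t u) uniform (biased-uniform t u) n (λ x g → F (inj₁ g ∷ x))))))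
      (sym (𝔼-sum (biased t u) (λ i a → mean t u (∂ i (λ x → F (a ∷ x))))))

    biased-shift : ∀ t u δ u′ φ → 𝔼 (biased (t + δ) u′) φ ≡ 𝔼 (biased t u) φ + δ * Δ φ
    biased-shift t u δ u′ φ = solve 4 (λ t d a b → (con 1ℚ :- (t :+ d)) :* a :+ (t :+ d) :* b
      := ((con 1ℚ :- t) :* a :+ t :* b) :+ d :* (b :- a)) refl t δ (U (λ g → φ (inj₁ g))) (U (λ y → φ (inj₂ y)))

    module _ (t : ℚ) (u : Unit t) (δ : ℚ) (0≤δ : 0ℚ ≤ δ) (u′ : Unit (t + δ)) where

      lipschitz : ∀ {n} (F : Vec Ω n → ℚ) → (∀ x → 0ℚ ≤ F x) → (∀ x → F x ≤ 1ℚ) →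
                  mean (t + δ) u′ F ≤ mean t u F + ι n * δ
      lipschitz {zero} F 0≤F F≤1 = ≤-by ≤-refl (solve 2 (λ f d → f :+ con 0ℚ :* d :- f := con 0ℚ) refl (F []) δ)
      lipschitz {suc n} F 0≤F F≤1 = begin
        𝔼 (biased (t + δ) u′) h′
          ≡⟨ biased-shift t u δ u′ h′ ⟩
        𝔼 μ h′ + δ * Δ h′
          ≤⟨ +-mono-≤ (𝔼-mono μ (λ a → lipschitz (λ x → F (a ∷ x)) (λ x → 0≤F (a ∷ x)) (λ x → F≤1 (a ∷ x)))) (*-monoˡ 0≤δ Δ≤1) ⟩
        𝔼 μ (λ a → h a + ι n * δ) + δ * 1ℚ
          ≡⟨ cong (_+ δ * 1ℚ) (trans (𝔼-+ μ h (λ _ → ι n * δ)) (cong (𝔼 μ h +_) (𝔼-const μ (ι n * δ)))) ⟩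
        𝔼 μ h + ι n * δ + δ * 1ℚ
          ≡⟨ solve 3 (λ h n d → h :+ n :* d :+ d :* con 1ℚ := h :+ (con 1ℚ :+ n) :* d) refl (𝔼 μ h) (ι n) δ ⟩
        𝔼 μ h + ι (suc n) * δ ∎
        where
        μ = biased t u
        h h′ : Ω → ℚ
        h a = mean t u (λ x → F (a ∷ x))
        h′ a = mean (t + δ) u′ (λ x → F (a ∷ x))
        Δ≤1 : Δ h′ ≤ 1ℚ
        Δ≤1 = subst (Δ h′ ≤_) (+-identityʳ 1ℚ) (+-mono-≤
          (≤-trans (𝔼-mono uniform (λ y → ≤-trans (𝔼-mono (product (biased (t + δ) u′) n) (λ x → F≤1 (inj₂ y ∷ x)))
            (≤-reflexive (𝔼-1 (product (biased (t + δ) u′) n))))) (≤-reflexive (𝔼-1 uniform)))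
          (neg-antimono-≤ (𝔼-nonneg uniform (λ g → 𝔼-nonneg (product (biased (t + δ) u′) n) (λ x → 0≤F (inj₁ g ∷ x))))))

      lipschitz′ : ∀ {n} (F : Vec Ω n → ℚ) → (∀ x → 0ℚ ≤ F x) → (∀ x → F x ≤ 1ℚ) →
                   mean t u F ≤ mean (t + δ) u′ F + ι n * δ
      lipschitz′ {n} F 0≤F F≤1 = 0≤-⇒≤ (subst (0ℚ ≤_) eq (≤⇒0≤- (lipschitz (λ x → 1ℚ - F x) (λ x → ≤⇒0≤- (F≤1 x))
          (λ x → ≤-by (0≤F x) (solve 1 (λ f → con 1ℚ :- (con 1ℚ :- f) := f) refl (F x))))))
        where
        flip : ∀ s v → mean s v (λ x → 1ℚ - F x) ≡ 1ℚ - mean s v F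
        flip s v = trans (𝔼-sub (product (biased s v) n) (λ _ → 1ℚ) F) (cong (_- mean s v F) (𝔼-1 (product (biased s v) n)))
        eq : mean t u (λ x → 1ℚ - F x) + ι n * δ - mean (t + δ) u′ (λ x → 1ℚ - F x) ≡ mean (t + δ) u′ F + ι n * δ - mean t u F
        eq = trans (cong₂ (λ a b → a + ι n * δ - b) (flip t u) (flip (t + δ) u′))
          (solve 3 (λ a b c → con 1ℚ :- a :+ c :- (con 1ℚ :- b) := b :+ c :- a) refl (mean t u F) (mean (t + δ) u′ F) (ι n * δ))

      -- Replaces a bound on the second derivative. Adding a coordinate, the two Lipschitz bounds
      -- move Δ from bias t to t + δ at a cost of 2 n δ, and 2 (n + 1)² - 2 n² leaves room for the
      -- resulting 2 n δ².
      taylor : ∀ {n} (F : Vec Ω n → ℚ) → (∀ x → 0ℚ ≤ F x) → (∀ x → F x ≤ 1ℚ) →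
               mean t u F + δ * gradient t u F ≤ mean (t + δ) u′ F + 2ℚ * sq (ι n * δ)
      taylor {zero} F 0≤F F≤1 = ≤-by ≤-refl
        (solve 2 (λ f d → f :+ con 2ℚ :* (con 0ℚ :* d :* (con 0ℚ :* d)) :- (f :+ d :* con 0ℚ) := con 0ℚ) refl (F []) δ)
      taylor {suc n} F 0≤F F≤1 = begin
        𝔼 μ h + δ * gradient t u F
          ≡⟨ cong (λ z → 𝔼 μ h + δ * z) (gradient-suc t u F) ⟩
        𝔼 μ h + δ * (Δ h + 𝔼 μ g)
          ≡⟨ solve 4 (λ h d D g → h :+ d :* (D :+ g) := (h :+ d :* g) :+ d :* D) refl (𝔼 μ h) δ (Δ h) (𝔼 μ g) ⟩
        (𝔼 μ h + δ * 𝔼 μ g) + δ * Δ h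
          ≤⟨ +-mono-≤ rest (*-monoˡ 0≤δ Δ-close) ⟩
        (𝔼 μ h′ + 2ℚ * sq (ι n * δ)) + δ * (Δ h′ + 2ℚ * (ι n * δ))
          ≤⟨ ≤-by (0≤* 0≤2 (0≤* (0≤sq δ) (0≤+ (0≤ι n) 0≤1)))
               (solve 4 (λ h D n d → (h :+ d :* D) :+ con 2ℚ :* ((con 1ℚ :+ n) :* d :* ((con 1ℚ :+ n) :* d))
                  :- ((h :+ con 2ℚ :* (n :* d :* (n :* d))) :+ d :* (D :+ con 2ℚ :* (n :* d)))
                  := con 2ℚ :* (d :* d :* (n :+ con 1ℚ))) refl (𝔼 μ h′) (Δ h′) (ι n) δ) ⟩
        (𝔼 μ h′ + δ * Δ h′) + 2ℚ * sq (ι (suc n) * δ)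
          ≡⟨ cong (_+ 2ℚ * sq (ι (suc n) * δ)) (biased-shift t u δ u′ h′) ⟨
        mean (t + δ) u′ F + 2ℚ * sq (ι (suc n) * δ) ∎
        where
        μ = biased t u
        h h′ g : Ω → ℚ
        h a = mean t u (λ x → F (a ∷ x))
        h′ a = mean (t + δ) u′ (λ x → F (a ∷ x))
        g a = gradient t u (λ x → F (a ∷ x))
        rest : 𝔼 μ h + δ * 𝔼 μ g ≤ 𝔼 μ h′ + 2ℚ * sq (ι n * δ)
        rest = begin
          𝔼 μ h + δ * 𝔼 μ g                      ≡⟨ trans (𝔼-+ μ h (λ a → δ * g a)) (cong (𝔼 μ h +_) (𝔼-* μ δ g)) ⟨
          𝔼 μ (λ a → h a + δ * g a)              ≤⟨ 𝔼-mono μ (λ a → taylor (λ x → F (a ∷ x)) (λ x → 0≤F (a ∷ x)) (λ x → F≤1 (a ∷ x))) ⟩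
          𝔼 μ (λ a → h′ a + 2ℚ * sq (ι n * δ))   ≡⟨ trans (𝔼-+ μ h′ (λ _ → 2ℚ * sq (ι n * δ))) (cong (𝔼 μ h′ +_) (𝔼-const μ (2ℚ * sq (ι n * δ)))) ⟩
          𝔼 μ h′ + 2ℚ * sq (ι n * δ) ∎
        shift : ∀ (k : Fin N → ℚ) → U (λ y → k y + ι n * δ) ≡ U k + ι n * δ
        shift k = trans (𝔼-+ uniform k (λ _ → ι n * δ)) (cong (U k +_) (𝔼-const uniform (ι n * δ)))
        Δ-close : Δ h ≤ Δ h′ + 2ℚ * (ι n * δ)
        Δ-close = ≤-trans (+-mono-≤
            (≤-trans (𝔼-mono uniform (λ y → lipschitz′ (λ x → F (inj₂ y ∷ x)) (λ x → 0≤F (inj₂ y ∷ x)) (λ x → F≤1 (inj₂ y ∷ x))))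
              (≤-reflexive (shift (λ y → h′ (inj₂ y)))))
            (neg-antimono-≤ {U (λ g → h′ (inj₁ g)) - ι n * δ} lower))
          (≤-reflexive (solve 3 (λ a b c → a :+ c :- (b :- c) := a :- b :+ con 2ℚ :* c) refl (U (λ y → h′ (inj₂ y))) (U (λ g → h′ (inj₁ g))) (ι n * δ)))
          where
          lower : U (λ g → h′ (inj₁ g)) - ι n * δ ≤ U (λ g → h (inj₁ g))
          lower = ≤-trans (+-monoˡ-≤ (- (ι n * δ)) (≤-trans (𝔼-mono uniform (λ g → lipschitz (λ x → F (inj₁ g ∷ x)) (λ x → 0≤F (inj₁ g ∷ x)) (λ x → F≤1 (inj₁ g ∷ x))))
              (≤-reflexive (shift (λ g → h (inj₁ g))))))
            (≤-reflexive (solve 2 (λ a c → a :+ c :- c := a) refl (U (λ g → h (inj₁ g))) (ι n * δ)))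

    -- The grid is so fine (M > n²) that the quadratic Taylor error is below the step δ, so gradients above 4 all along
    -- [¼, ¾] would raise the mean by more than 1.
    mean-value : ∀ {n} (F : Vec Ω n → ℚ) → (∀ x → 0ℚ ≤ F x) → (∀ x → F x ≤ 1ℚ) →
      Σ ℚ λ t → Σ (Unit t) λ u → ¼ ≤ t × t ≤ ¾ × gradient t u F ≤ 4ℚ
    mean-value {n} F 0≤F F≤1 = go (1/-pos (ι M) (0<ιsuc (n ℕ.* n)))
      where
      M = suc (n ℕ.* n)
      Goal = Σ ℚ λ t → Σ (Unit t) λ u → ¼ ≤ t × t ≤ ¾ × gradient t u F ≤ 4ℚ
      go : (Σ ℚ λ y → 0ℚ < y × ι M * y ≡ 1ℚ) → Goal
      go (y , 0<y , My≡1) = conclude (march M ℕ.≤-refl)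
        where
        -- As y = 1 / M, exactly M steps of length δ lead from ¼ to ¾.
        δ : ℚ
        δ = ½ * y
        0<δ : 0ℚ < δ
        0<δ = 0<* (positive⁻¹ ½) 0<y
        0≤δ = <⇒≤ 0<δ
        Mδ≡½ : ι M * δ ≡ ½
        Mδ≡½ = trans (solve 2 (λ m y → m :* (con ½ :* y) := con ½ :* (m :* y)) refl (ι M) y) (trans (cong (½ *_) My≡1) (*-identityʳ ½))
        error≤δ : 2ℚ * sq (ι n * δ) ≤ δ
        error≤δ = begin
          2ℚ * sq (ι n * δ)               ≡⟨ solve 2 (λ n d → con 2ℚ :* (n :* d :* (n :* d)) := con 2ℚ :* d :* (n :* n :* d)) refl (ι n) δ ⟩
          2ℚ * δ * (ι n * ι n * δ)        ≡⟨ cong (λ z → 2ℚ * δ * (z * δ)) (ι-* n n) ⟨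
          2ℚ * δ * (ι (n ℕ.* n) * δ)      ≤⟨ *-monoˡ (0≤* 0≤2 0≤δ) (*-monoʳ 0≤δ (ι-mono (ℕ.n≤1+n (n ℕ.* n)))) ⟩
          2ℚ * δ * (ι M * δ)              ≡⟨ cong (2ℚ * δ *_) Mδ≡½ ⟩
          2ℚ * δ * ½                      ≡⟨ solve 1 (λ d → con 2ℚ :* d :* con ½ := d) refl δ ⟩
          δ ∎
        time : ℕ → ℚ
        time zero    = ¼
        time (suc r) = time r + δ
        time≡ : ∀ r → time r ≡ ¼ + ι r * δ
        time≡ zero = solve 1 (λ d → con ¼ := con ¼ :+ con 0ℚ :* d) refl δ
        time≡ (suc r) = trans (cong (_+ δ) (time≡ r)) (solve 2 (λ r d → con ¼ :+ r :* d :+ d := con ¼ :+ (con 1ℚ :+ r) :* d) refl (ι r) δ)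
        ¼≤time : ∀ r → ¼ ≤ time r
        ¼≤time r = subst (¼ ≤_) (sym (time≡ r)) (≤-by (0≤* (0≤ι r) 0≤δ) (solve 1 (λ z → con ¼ :+ z :- con ¼ := z) refl (ι r * δ)))
        time≤¾ : ∀ {r} → r ℕ.≤ M → time r ≤ ¾
        time≤¾ {r} r≤M = subst (_≤ ¾) (sym (time≡ r)) (+-monoʳ-≤ ¼ (subst (ι r * δ ≤_) Mδ≡½ (*-monoʳ 0≤δ (ι-mono r≤M))))
        unit : ∀ {r} → r ℕ.≤ M → Unit (time r)
        unit {r} r≤M = ≤-trans (0≤* 0≤½ 0≤½) (¼≤time r) , ≤-trans (time≤¾ r≤M) (≤ᵇ⇒≤ {¾} {1ℚ} _)
        -- A step with gradient above 4 gains at least 4 δ minus the error δ, whence the invariant 3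
        -- r δ; at r = M it is 3/2.
        march : ∀ r (r≤M : r ℕ.≤ M) → Goal ⊎ (ι r * δ * (1ℚ + 2ℚ) ≤ mean (time r) (unit r≤M) F)
        march zero r≤M = inj₂ (≤-trans (≤-reflexive (solve 1 (λ d → con 0ℚ :* d :* (con 1ℚ :+ con 2ℚ) := con 0ℚ) refl δ)) (𝔼-nonneg (product (biased (time zero) (unit r≤M)) n) 0≤F))
        march (suc r) r<M = advance (march r r≤M) (gradient (time r) v F ≤? 4ℚ)
          where
          r≤M = ℕ.<⇒≤ r<M
          v = unit r≤M
          h h′ G : ℚ
          h = mean (time r) v F
          h′ = mean (time r + δ) (unit r<M) F
          G = gradient (time r) v F
          gain : ι r * δ * (1ℚ + 2ℚ) ≤ h → h + δ * G ≤ h′ + 2ℚ * sq (ι n * δ) → ¬ (G ≤ 4ℚ) → ι (suc r) * δ * (1ℚ + 2ℚ) ≤ h′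
          gain ih step p = 0≤-⇒≤ (≤-trans (0≤+ (0≤+ (≤⇒0≤- step) (≤⇒0≤- ih)) (0≤+ (≤⇒0≤- error≤δ) (0≤* 0≤δ (≤⇒0≤- (<⇒≤ (≰⇒> p))))))
            (≤-reflexive (identity h h′ (2ℚ * sq (ι n * δ)) δ G (ι r))))
            where
            identity : ∀ h h′ e d G r → ((h′ + e - (h + d * G)) + (h - r * d * (1ℚ + 2ℚ))) + ((d - e) + d * (G - 4ℚ)) ≡ h′ - (1ℚ + r) * d * (1ℚ + 2ℚ)
            identity = solve 6 (λ h h′ e d G r → ((h′ :+ e :- (h :+ d :* G)) :+ (h :- r :* d :* (con 1ℚ :+ con 2ℚ))) :+ ((d :- e) :+ d :* (G :- con 4ℚ))
              := h′ :- (con 1ℚ :+ r) :* d :* (con 1ℚ :+ con 2ℚ)) refl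
          advance : Goal ⊎ (ι r * δ * (1ℚ + 2ℚ) ≤ h) → Dec (G ≤ 4ℚ) → Goal ⊎ (ι (suc r) * δ * (1ℚ + 2ℚ) ≤ h′)
          advance (inj₁ found) _ = inj₁ found
          advance (inj₂ _) (yes p) = inj₁ (time r , v , ¼≤time r , time≤¾ r≤M , p)
          advance (inj₂ ih) (no p) = inj₂ (gain ih (taylor (time r) v δ 0≤δ (unit r<M) F 0≤F F≤1) p)
        conclude : Goal ⊎ (ι M * δ * (1ℚ + 2ℚ) ≤ mean (time M) (unit ℕ.≤-refl) F) → Goal
        conclude (inj₁ found) = found
        conclude (inj₂ p) = ⊥-elim (≤⇒¬< (≤-trans (≤-reflexive (cong (_* (1ℚ + 2ℚ)) (sym Mδ≡½))) (≤-trans p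
          (≤-trans (𝔼-mono (product (biased (time M) (unit ℕ.≤-refl)) n) F≤1) (≤-reflexive (𝔼-1 (product (biased (time M) (unit ℕ.≤-refl)) n)))))) (1<3/2))
          where
          1<3/2 : 1ℚ < ½ * (1ℚ + 2ℚ)
          1<3/2 = *<* (ℤ.+<+ (ℕ.s≤s (ℕ.s≤s (ℕ.s≤s ℕ.z≤n))))

  -- Sets hit by random boxes

  anyVec? : ∀ {A : Set} → (∀ {P : A → Set} → (∀ a → Dec (P a)) → Dec (∃ P)) →
            ∀ {n} {P : Vec A n → Set} → (∀ x → Dec (P x)) → Dec (∃ P)
  anyVec? any? {zero}  P? = Dec.map′ (λ p → [] , p) (λ { ([] , p) → p }) (P? [])
  anyVec? any? {suc n} P? = Dec.map′ (λ { (a , x , p) → a ∷ x , p }) (λ { (a ∷ x , p) → a , x , p })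
    (any? (λ a → anyVec? any? (λ x → P? (a ∷ x))))

  χ-mono : ∀ {P Q : Set} (p? : Dec P) (q? : Dec Q) → (P → Q) → χ (does p?) ≤ χ (does q?)
  χ-mono (yes p) (yes q) f = ≤-refl
  χ-mono (yes p) (no ¬q) f = ⊥-elim (¬q (f p))
  χ-mono (no ¬p) (yes q) f = 0≤1
  χ-mono (no ¬p) (no ¬q) f = ≤-refl

  sq≤1 : ∀ {d} → - 1ℚ ≤ d → d ≤ 1ℚ → sq d ≤ 1ℚ
  sq≤1 {d} p q = ≤-by (0≤* (≤⇒0≤- q) (≤⇒0≤- p)) (solve 1 (λ d → con 1ℚ :- d :* d := (con 1ℚ :- d) :* (d :- con (- 1ℚ))) refl d)

  module Group (G : FiniteAbelianGroup) where

    open FiniteAbelianGroup G public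

    abelianGroup : AbelianGroup _ _
    abelianGroup = record { isAbelianGroup = isAbelianGroup }

    open AbelianGroup abelianGroup public using (assoc; comm; identityˡ; identityʳ; inverseˡ; inverseʳ)

    infixl 6 _⊝_
    _⊝_ : Fin order → Fin order → Fin order
    a ⊝ b = a ⊕ (⊖ b)

    open Algebra.Properties.AbelianGroup abelianGroup using (⁻¹-∙-comm)

    ⊝-⊕ : ∀ a b → (a ⊝ b) ⊕ b ≡ a
    ⊝-⊕ a b = trans (assoc a (⊖ b) b) (trans (cong (a ⊕_) (inverseˡ b)) (identityʳ a))

    ⊕-⊝ : ∀ a b → (a ⊕ b) ⊝ b ≡ a
    ⊕-⊝ a b = trans (assoc a b (⊖ b)) (trans (cong (a ⊕_) (inverseʳ b)) (identityʳ a))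

    ⊕-⊝′ : ∀ g z → g ⊕ (z ⊝ g) ≡ z
    ⊕-⊝′ g z = trans (comm g (z ⊝ g)) (⊝-⊕ z g)

    ⊝-⊝ : ∀ z g → z ⊝ (z ⊝ g) ≡ g
    ⊝-⊝ z g = trans (cong (_⊝ (z ⊝ g)) (sym (⊕-⊝′ g z))) (⊕-⊝ g (z ⊝ g))

    ⊝-shift : ∀ z g z₀ → z ⊝ (g ⊕ (z ⊝ z₀)) ≡ z₀ ⊝ g
    ⊝-shift z g z₀ = trans (cong (z ⊕_) (sym (⁻¹-∙-comm g (z ⊝ z₀)))) (trans (cong (z ⊕_) (comm (⊖ g) (⊖ (z ⊝ z₀))))
      (trans (sym (assoc z (⊖ (z ⊝ z₀)) (⊖ g))) (cong (_⊕ (⊖ g)) (⊝-⊝ z z₀))))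

  ∈-tabulate⁺ : ∀ {n} {P : Fin n → Set} (P? : ∀ i → Dec (P i)) {i} → P i → i ∈ tabulate (does ∘ P?)
  ∈-tabulate⁺ P? {i} p = Vec.lookup⇒[]= i _ (trans (Vec.lookup∘tabulate (does ∘ P?) i) (Dec.dec-true (P? i) p))

  ∈-tabulate⁻ : ∀ {n} {P : Fin n → Set} (P? : ∀ i → Dec (P i)) {i} → i ∈ tabulate (does ∘ P?) → P i
  ∈-tabulate⁻ P? {i} i∈ = witness (P? i) (trans (sym (Vec.lookup∘tabulate (does ∘ P?) i)) (Vec.[]=⇒lookup i∈))
    where
    witness : ∀ {Q : Set} (q? : Dec Q) → does q? ≡ true → Q
    witness (yes q) _ = q

  module Stabiliser (G : FiniteAbelianGroup) where

    open Group G

    -- The stabiliser of φ under translations is a subgroup containing Z₀ - z₀, hence everything.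
    invariant⇒constant : ∀ {Z₀ z₀} → ¬ InStrictCoset G Z₀ → (φ : Fin order → ℚ) →
      (∀ z → z ∈ Z₀ → ∀ g → φ (g ⊕ (z ⊝ z₀)) ≡ φ g) → ∀ g → φ g ≡ φ 𝟘
    invariant⇒constant {Z₀} {z₀} ¬coset φ inv g = trans (cong φ (sym (identityˡ g))) (fixes g 𝟘)
      where
      Fixes : Fin order → Set
      Fixes h = ∀ g → φ (g ⊕ h) ≡ φ g
      fixes? : ∀ h → Dec (Fixes h)
      fixes? h = Fin.all? (λ g → φ (g ⊕ h) ≟ φ g)
      H = tabulate (does ∘ fixes?)
      subgroup : IsSubgroup G H
      subgroup = ∈-tabulate⁺ fixes? (λ g → cong φ (identityʳ g))
        , (λ a b a∈ b∈ → ∈-tabulate⁺ fixes? (λ g → trans (cong φ (sym (assoc g a b)))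
            (trans (∈-tabulate⁻ fixes? b∈ (g ⊕ a)) (∈-tabulate⁻ fixes? a∈ g))))
        , (λ a a∈ → ∈-tabulate⁺ fixes? (λ g → trans (sym (∈-tabulate⁻ fixes? a∈ (g ⊝ a))) (cong φ (⊝-⊕ g a))))
      fixes : ∀ h → Fixes h
      fixes h = decide (fixes? h)
        where
        decide : Dec (Fixes h) → Fixes h
        decide (yes p) = p
        decide (no ¬p) = ⊥-elim (¬coset (H , z₀ , subgroup , (h , λ h∈ → ¬p (∈-tabulate⁻ fixes? h∈)) ,
          (λ z z∈ → z ⊝ z₀ , ∈-tabulate⁺ fixes? (inv z z∈) , sym (⊝-⊕ z z₀))))

  module Hit (G : FiniteAbelianGroup) (ν : ℚ) (0<ν : 0ℚ < ν) (Nν≡1 : ι (FiniteAbelianGroup.order G) * ν ≡ 1ℚ)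
             (Z₀ : Subset (FiniteAbelianGroup.order G)) where

    open Group G
    open Stabiliser G
    open Uniform order ν 0<ν Nν≡1

    -- inj₁ g stands for the singleton {g} and inj₂ y for {a : a + y ∈ Z₀}.
    _∈Ω_ : Fin order → Ω → Set
    a ∈Ω inj₁ g = a ≡ g
    a ∈Ω inj₂ y = (a ⊕ y) ∈ Z₀

    _∈Ω?_ : ∀ a ω → Dec (a ∈Ω ω)
    a ∈Ω? inj₁ g = a Fin.≟ g
    a ∈Ω? inj₂ y = (a ⊕ y) ∈? Z₀

    Hits : ∀ {n} → (Vec (Fin order) n → Bool) → Vec Ω n → Set
    Hits A ω = ∃ λ a → A a ≡ true × (∀ i → lookup a i ∈Ω lookup ω i)

    hits? : ∀ {n} A (ω : Vec Ω n) → Dec (Hits A ω)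
    hits? A ω = anyVec? Fin.any? (λ a → (A a Bool.≟ true) ×-dec Fin.all? (λ i → lookup a i ∈Ω? lookup ω i))

    hit : ∀ {n} → (Vec (Fin order) n → Bool) → Vec Ω n → ℚ
    hit A ω = χ (does (hits? A ω))

    -- g ⊕ y ∈ Z₀ places the singleton {g} inside the set of `inj₂ y`, so the box only grows.
    Hits-mono : ∀ {n} A (ω : Vec Ω n) i g y → (g ⊕ y) ∈ Z₀ → Hits A (ω [ i ]≔ inj₁ g) → Hits A (ω [ i ]≔ inj₂ y)
    Hits-mono A ω i g y gy∈ (a , Aa , a∈) = a , Aa , λ j → at j (j Fin.≟ i)
      where
      at : ∀ j → Dec (j ≡ i) → lookup a j ∈Ω lookup (ω [ i ]≔ inj₂ y) j
      at j (yes refl) = subst (lookup a i ∈Ω_) (sym (Vec.lookup∘updateAt i ω)) (subst (λ b → (b ⊕ y) ∈ Z₀)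
        (sym (subst (lookup a i ∈Ω_) (Vec.lookup∘updateAt i ω) (a∈ i))) gy∈)
      at j (no j≢i) = subst (lookup a j ∈Ω_) (trans (Vec.lookup∘update′ j≢i ω (inj₁ g)) (sym (Vec.lookup∘update′ j≢i ω (inj₂ y)))) (a∈ j)

    hit-mono : ∀ {n} A (ω : Vec Ω n) i g y → (g ⊕ y) ∈ Z₀ → hit A (ω [ i ]≔ inj₁ g) ≤ hit A (ω [ i ]≔ inj₂ y)
    hit-mono A ω i g y gy∈ = χ-mono (hits? A (ω [ i ]≔ inj₁ g)) (hits? A (ω [ i ]≔ inj₂ y)) (Hits-mono A ω i g y gy∈)

    module _ (z₀ : Fin order) (z₀∈ : z₀ ∈ Z₀) where

      reflect-permute : ∀ z f → U (λ g → f (z ⊝ g)) ≡ U f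
      reflect-permute z = U-permute (z ⊝_) (z ⊝_) (⊝-⊝ z) (⊝-⊝ z)

      reflect∈ : ∀ {z} → z ∈ Z₀ → ∀ g → (g ⊕ (z ⊝ g)) ∈ Z₀
      reflect∈ z∈ g = subst (_∈ Z₀) (sym (⊕-⊝′ g _)) z∈

      -- Coupling: each singleton {g} is replaced by the set of z₀ ⊝ g, which contains it, and the
      -- reflection g ↦ z₀ ⊝ g preserves the uniform measure. The right side is the mean at t = 1.
      mean≤mean-right : ∀ t u {n} (F : Vec Ω n → ℚ) →
        (∀ ω i g y → (g ⊕ y) ∈ Z₀ → F (ω [ i ]≔ inj₁ g) ≤ F (ω [ i ]≔ inj₂ y)) →
        mean t u F ≤ 𝔼 (product uniform n) (λ y → F (map inj₂ y))
      mean≤mean-right t u {zero} F mono = ≤-refl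
      mean≤mean-right t u {suc n} F mono = ≤-trans
        (𝔼-mono (biased t u) (λ a → mean≤mean-right t u (λ x → F (a ∷ x)) (λ ω i → mono (a ∷ ω) (suc i))))
        (≤-trans (+-monoˡ-≤ (t * R) (*-monoˡ (≤⇒0≤- (proj₂ u)) L≤R))
          (≤-reflexive (solve 2 (λ t r → (con 1ℚ :- t) :* r :+ t :* r := r) refl t R)))
        where
        k : Ω → ℚ
        k a = 𝔼 (product uniform n) (λ y → F (a ∷ map inj₂ y))
        L = U (λ g → k (inj₁ g))
        R = U (λ y → k (inj₂ y))
        L≤R : L ≤ R
        L≤R = ≤-trans (𝔼-mono uniform (λ g → 𝔼-mono (product uniform n) (λ y → mono (inj₁ g ∷ map inj₂ y) zero g (z₀ ⊝ g) (reflect∈ z₀∈ g))))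
          (≤-reflexive (reflect-permute z₀ (λ y → k (inj₂ y))))

      -- A point of the set ω that is uniformly distributed whatever the bias, again by the
      -- reflection in z₀.
      select : Ω → Fin order
      select (inj₁ g) = g
      select (inj₂ y) = z₀ ⊝ y

      select∈ : ∀ ω → select ω ∈Ω ω
      select∈ (inj₁ g) = refl
      select∈ (inj₂ y) = subst (_∈ Z₀) (sym (⊝-⊕ z₀ y)) z₀∈

      select-measure : ∀ t u φ → 𝔼 (biased t u) (φ ∘ select) ≡ U φ
      select-measure t u φ = trans (cong (λ v → (1ℚ - t) * U φ + t * v) (reflect-permute z₀ φ))
        (solve 2 (λ t r → (con 1ℚ :- t) :* r :+ t :* r := r) refl t (U φ))

      -- `select` pushes the biased measure to the uniform one, so pulling back along it intertwines
      -- the two noise families. This carries lower bounds on restrictions of A over to Ω.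
      T-select : ∀ t u {n} (r : Vec ℚ n) f ω →
        Operators.T Ω (biased t u) (biased-commute t u) r (f ∘ map select) ω ≡ Operators.T (Fin order) uniform uniform-commute r f (map select ω)
      T-select t u []       f []      = refl
      T-select t u (r ∷ rs) f (a ∷ ω) = cong₂ (λ v w → r * v + (1ℚ - r) * w) (T-select t u rs (λ y → f (select a ∷ y)) ω)
        (trans (𝔼-cong (biased t u) (λ b → T-select t u rs (λ y → f (select b ∷ y)) ω))
          (select-measure t u (λ b → Operators.T (Fin order) uniform uniform-commute rs (λ y → f (b ∷ y)) (map select ω))))

      A≤hit : ∀ {n} A (ω : Vec Ω n) → χ (A (map select ω)) ≤ hit A ω
      A≤hit A ω = lem (A (map select ω)) refl (hits? A ω)
        where
        lem : ∀ b → A (map select ω) ≡ b → (h : Dec (Hits A ω)) → χ b ≤ χ (does h)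
        lem b e (yes p) = proj₂ (χ-unit b)
        lem true e (no ¬p) = ⊥-elim (¬p (map select ω , e , λ i → subst (_∈Ω lookup ω i) (sym (Vec.lookup-map i select ω)) (select∈ (lookup ω i))))
        lem false e (no ¬p) = ≤-refl

      -- Tests only those inclusions of {g} in the set of y for which g ⊕ y is the fixed z₀;
      -- `¬pivotal⇒constant` shows that they detect every dependence on coordinate i.
      Pivotal : ∀ {n} → (Vec (Fin order) n → Bool) → Fin n → Vec Ω n → Set
      Pivotal A i ω = ∃ λ g → ¬ (hit A (ω [ i ]≔ inj₂ (z₀ ⊝ g)) ≡ hit A (ω [ i ]≔ inj₁ g))

      pivotal? : ∀ {n} A i (ω : Vec Ω n) → Dec (Pivotal A i ω)
      pivotal? A i ω = Fin.any? (λ g → ¬? (hit A (ω [ i ]≔ inj₂ (z₀ ⊝ g)) ≟ hit A (ω [ i ]≔ inj₁ g)))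

      ∂-reflect : ∀ {n} (F : Vec Ω n → ℚ) i ω z → ∂ i F ω ≡ U (λ g → F (ω [ i ]≔ inj₂ (z ⊝ g)) - F (ω [ i ]≔ inj₁ g))
      ∂-reflect F i ω z = trans (cong (_- U (λ g → F (ω [ i ]≔ inj₁ g))) (sym (reflect-permute z (λ y → F (ω [ i ]≔ inj₂ y))))) (sym (𝔼-sub uniform _ _))

      hit-gap : ∀ {n} A (ω : Vec Ω n) i {z} → z ∈ Z₀ → ∀ g → 0ℚ ≤ hit A (ω [ i ]≔ inj₂ (z ⊝ g)) - hit A (ω [ i ]≔ inj₁ g)
      hit-gap A ω i z∈ g = ≤⇒0≤- (hit-mono A ω i g _ (reflect∈ z∈ g))

      -- A change of F on coordinate i shows up in the gradient because U (F ∘ inj₂) - U (F ∘ inj₁) is a multiple of ν.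
      pivotal≤∂ : ∀ {n} A i (ω : Vec Ω n) → χ (does (pivotal? A i ω)) ≤ ι order * ∂ i (hit A) ω
      pivotal≤∂ A i ω = cases (pivotal? A i ω)
        where
        gap : Fin order → ℚ
        gap g = hit A (ω [ i ]≔ inj₂ (z₀ ⊝ g)) - hit A (ω [ i ]≔ inj₁ g)
        jump : ∀ a b → χ a ≤ χ b → ¬ (χ b ≡ χ a) → 1ℚ ≤ χ b - χ a
        jump true  true  p q = ⊥-elim (q refl)
        jump true  false p q = ⊥-elim (≤⇒¬< p (positive⁻¹ 1ℚ))
        jump false true  p q = ≤-refl
        jump false false p q = ⊥-elim (q refl)
        cases : (d : Dec (Pivotal A i ω)) → χ (does d) ≤ ι order * ∂ i (hit A) ω
        cases (yes (g , ≢)) = begin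
          1ℚ                              ≡⟨ Nν≡1 ⟨
          ι order * ν                     ≡⟨ cong (ι order *_) (*-identityʳ ν) ⟨
          ι order * (ν * 1ℚ)              ≤⟨ *-monoˡ (0≤ι order) (*-monoˡ (<⇒≤ 0<ν) (jump _ _ (hit-mono A ω i g _ (reflect∈ z₀∈ g)) ≢)) ⟩
          ι order * (ν * gap g)           ≤⟨ *-monoˡ (0≤ι order) (U-weight gap (hit-gap A ω i z₀∈) g) ⟩
          ι order * U gap                 ≡⟨ cong (ι order *_) (∂-reflect (hit A) i ω z₀) ⟨
          ι order * ∂ i (hit A) ω ∎
        cases (no _) = 0≤* (0≤ι order) (subst (0ℚ ≤_) (sym (∂-reflect (hit A) i ω z₀)) (𝔼-nonneg uniform (hit-gap A ω i z₀∈)))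

      -- If all inclusions through z₀ are flat, then `∂ i` vanishes. For every z in Z₀ it is also
      -- the mean of the nonnegative gaps through z, so these vanish too. The singletons {g} and {g
      -- + z - z₀} both lie in the set of z₀ - g, hence the values on singletons are invariant under
      -- z - z₀.
      ¬pivotal⇒constant : ∀ {n} A i (ω : Vec Ω n) → ¬ InStrictCoset G Z₀ → ¬ Pivotal A i ω →
                          ∀ b → hit A (ω [ i ]≔ b) ≡ hit A (ω [ i ]≔ inj₁ 𝟘)
      ¬pivotal⇒constant A i ω ¬coset ¬piv = λ { (inj₁ g) → φ-const g ; (inj₂ y) → trans (right y) (φ-const (z₀ ⊝ y)) }
        where
        φ : Fin order → ℚ
        φ g = hit A (ω [ i ]≔ inj₁ g)
        ψ : Fin order → ℚ
        ψ y = hit A (ω [ i ]≔ inj₂ y)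
        equal : ∀ g → ψ (z₀ ⊝ g) ≡ φ g
        equal g = Dec.decidable-stable (ψ (z₀ ⊝ g) ≟ φ g) (λ ≢ → ¬piv (g , ≢))
        ∂≡0 : ∂ i (hit A) ω ≡ 0ℚ
        ∂≡0 = trans (∂-reflect (hit A) i ω z₀) (trans (𝔼-cong uniform (λ g → trans (cong (_- φ g) (equal g)) (+-inverseʳ (φ g)))) (𝔼-const uniform 0ℚ))
        equal′ : ∀ z → z ∈ Z₀ → ∀ g → ψ (z ⊝ g) ≡ φ g
        equal′ z z∈ g = ≤-antisym (0≤-⇒≤ (subst (0ℚ ≤_) (solve 2 (λ a b → con 0ℚ :- (a :- b) := b :- a) refl (ψ (z ⊝ g)) (φ g)) (≤⇒0≤- gap≤0)))
                                 (0≤-⇒≤ (hit-gap A ω i z∈ g))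
          where
          gap≤0 : ψ (z ⊝ g) - φ g ≤ 0ℚ
          gap≤0 = *-cancelˡ 0<ν (≤-trans (U-weight (λ g → ψ (z ⊝ g) - φ g) (hit-gap A ω i z∈) g)
            (≤-reflexive (trans (sym (∂-reflect (hit A) i ω z)) (trans ∂≡0 (sym (*-zeroʳ ν))))))
        φ-const : ∀ g → φ g ≡ φ 𝟘
        φ-const = invariant⇒constant ¬coset φ (λ z z∈ g → trans (sym (equal′ z z∈ (g ⊕ (z ⊝ z₀))))
          (trans (cong ψ (⊝-shift z g z₀)) (equal g)))
        right : ∀ y → ψ y ≡ φ (z₀ ⊝ y)
        right y = trans (cong ψ (sym (⊝-⊝ z₀ y))) (equal (z₀ ⊝ y))

  -- A spread set and a dense set cannot avoid a translate

  module SpreadSets (G : FiniteAbelianGroup) (ν : ℚ) (0<ν : 0ℚ < ν) (Nν≡1 : ι (FiniteAbelianGroup.order G) * ν ≡ 1ℚ) where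

    open Group G
    open Uniform order ν 0<ν Nν≡1
    open Operators (Fin order) uniform uniform-commute public using (E; ⟪_⟫; ‖_‖²; P)

    translate : ∀ {n} (c : Vec (Fin order) n) f → ⟪ (λ y → f (zipWith _⊝_ y c)) ⟫ ≡ ⟪ f ⟫
    translate []      f = refl
    translate (c ∷ cs) f = trans (𝔼-cong uniform (λ a → translate cs (λ y → f ((a ⊝ c) ∷ y))))
      (U-permute (_⊝ c) (_⊕ c) (λ a → ⊕-⊝ a c) (λ a → ⊝-⊕ a c) (λ a → ⟪ (λ y → f (a ∷ y)) ⟫))

    Spread : ℕ → ℚ → ∀ {n} → (Vec (Fin order) n → Bool) → Set
    Spread s α {n} A = ∀ (S : Subset n) → ∣ S ∣ ℕ.≤ s → ∀ y → α ≤ P S (λ x → χ (A x)) y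

    -- The total influence is at most the factor |G| of `pivotal≤∂` times the gradient bound 4. The
    -- distance is β α², since F vanishes on mass at least β and any candidate junta is at least α
    -- there.
    spreadness : ∀ {α β} → 0ℚ < α → 0ℚ < β → Constants (¼ * ν) (ι order * 4ℚ) (β * sq α)
    spreadness 0<α 0<β = constants (0<* (0<* (positive⁻¹ ½) (positive⁻¹ ½)) 0<ν) ¼ν≤1
      (0≤* (0≤ι order) (0≤+ 0≤2 0≤2)) (0<* 0<β (0<* 0<α 0<α))
      where
      ¼ν≤1 : ¼ * ν ≤ 1ℚ
      ¼ν≤1 = *-mono (0≤* 0≤½ 0≤½) 0≤1 (≤ᵇ⇒≤ {¼} {1ℚ} _) (ν≤1 𝟘)

    -- Let F be the indicator that A meets the product of the ω i. If A + B + c avoided Z₀, F would vanish with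
    -- probability at least β, although every P J F with ∣ J ∣ ≤ s is at least α everywhere, so F is far from a junta.
    spread-meets : ∀ {α β} (0<α : 0ℚ < α) (0<β : 0ℚ < β) {Z₀ z₀} → z₀ ∈ Z₀ → ¬ InStrictCoset G Z₀ →
      ∀ {n} (A B : Vec (Fin order) n → Bool) (c : Vec (Fin order) n) → Spread (Constants.s (spreadness 0<α 0<β)) α A → β ≤ ⟪ (λ x → χ (B x)) ⟫ →
      ¬ (∀ a b → A a ≡ true → B b ≡ true → ¬ (∀ i → (lookup a i ⊕ (lookup b i ⊕ lookup c i)) ∈ Z₀))
    spread-meets {α} {β} 0<α 0<β {Z₀} {z₀} z₀∈ ¬coset {n} A B c spread dense avoids =
      finish (mean-value F 0≤F F≤1)
      where
      open Hit G ν 0<ν Nν≡1 Z₀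
      F : Vec Ω n → ℚ
      F = hit A
      0≤F : ∀ ω → 0ℚ ≤ F ω
      0≤F ω = proj₁ (χ-unit (does (hits? A ω)))
      F≤1 : ∀ ω → F ω ≤ 1ℚ
      F≤1 ω = proj₂ (χ-unit (does (hits? A ω)))
      Finish = (Σ ℚ λ t → Σ (Unit t) λ u → ¼ ≤ t × t ≤ ¾ × gradient t u F ≤ 4ℚ)
      finish : Finish → Empty.⊥
      finish (t , u , ¼≤t , t≤¾ , gradient≤4) = ≤⇒¬< lower (proj₂ (proj₂ junta))
        where
        μ = biased t u
        module O = Operators Ω μ (biased-commute t u)
        p : Fin n → Vec Ω n → ℚ
        p i ω = χ (does (pivotal? z₀ z₀∈ A i ω))
        D≡ : ∀ i ω → O.D i F ω ≡ F ω - 𝔼 μ (λ b → F (ω [ i ]≔ b))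
        D≡ i ω = cong (λ z → F ω - z) (O.T-allBut i F ω)
        D-constant : ∀ i ω → ¬ Pivotal z₀ z₀∈ A i ω → O.D i F ω ≡ 0ℚ
        D-constant i ω ¬piv = trans (D≡ i ω) (trans (cong₂ _-_ (trans (cong F (sym (Vec.[]≔-lookup ω i))) (const (lookup ω i)))
            (trans (𝔼-cong μ const) (𝔼-const μ (F (ω [ i ]≔ inj₁ 𝟘))))) (+-inverseʳ (F (ω [ i ]≔ inj₁ 𝟘))))
          where const = ¬pivotal⇒constant z₀ z₀∈ A i ω ¬coset ¬piv
        gp : ∀ i ω → O.D i F ω * p i ω ≡ O.D i F ω
        gp i ω = cases (pivotal? z₀ z₀∈ A i ω)
          where
          cases : (d : Dec (Pivotal z₀ z₀∈ A i ω)) → O.D i F ω * χ (does d) ≡ O.D i F ω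
          cases (yes _)   = *-identityʳ (O.D i F ω)
          cases (no ¬piv) = trans (*-zeroʳ (O.D i F ω)) (sym (D-constant i ω ¬piv))
        pp : ∀ i ω → p i ω * p i ω ≡ p i ω
        pp i ω = idem (does (pivotal? z₀ z₀∈ A i ω))
          where
          idem : ∀ b → χ b * χ b ≡ χ b
          idem true  = refl
          idem false = refl
        g²≤p : ∀ i ω → sq (O.D i F ω) ≤ p i ω
        g²≤p i ω = cases (pivotal? z₀ z₀∈ A i ω)
          where
          m = 𝔼 μ (λ b → F (ω [ i ]≔ b))
          0≤m : 0ℚ ≤ m
          0≤m = 𝔼-nonneg μ (λ b → 0≤F (ω [ i ]≔ b))
          m≤1 : m ≤ 1ℚ
          m≤1 = ≤-trans (𝔼-mono μ (λ b → F≤1 (ω [ i ]≔ b))) (≤-reflexive (𝔼-1 μ))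
          cases : (d : Dec (Pivotal z₀ z₀∈ A i ω)) → sq (O.D i F ω) ≤ χ (does d)
          cases (no ¬piv) = ≤-reflexive (cong sq (D-constant i ω ¬piv))
          cases (yes _) = sq≤1
            (subst (- 1ℚ ≤_) (sym (D≡ i ω)) (subst (_≤ F ω - m) (+-identityˡ (- 1ℚ)) (+-mono-≤ (0≤F ω) (neg-antimono-≤ m≤1))))
            (subst (_≤ 1ℚ) (sym (D≡ i ω)) (subst (F ω - m ≤_) (+-identityʳ 1ℚ) (+-mono-≤ (F≤1 ω) (neg-antimono-≤ 0≤m))))
        total : sum (λ i → O.⟪ p i ⟫) ≤ ι order * 4ℚ
        total = begin
          sum (λ i → O.⟪ p i ⟫)                         ≤⟨ sum-mono (λ i → 𝔼-mono (O.E n) (pivotal≤∂ z₀ z₀∈ A i)) ⟩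
          sum (λ i → O.⟪ (λ ω → ι order * ∂ i F ω) ⟫)   ≡⟨ sum-cong-≗ (λ i → 𝔼-* (O.E n) (ι order) (∂ i F)) ⟩
          sum (λ i → ι order * O.⟪ ∂ i F ⟫)             ≡⟨ *-distribˡ-sum (ι order) (λ i → O.⟪ ∂ i F ⟫) ⟨
          ι order * gradient t u F                      ≤⟨ *-monoˡ (0≤ι order) gradient≤4 ⟩
          ι order * 4ℚ ∎
        junta = O.friedgut (spreadness 0<α 0<β) (biased-weight t u ¼≤t t≤¾) F p gp pp g²≤p total
        J : Subset n
        J = proj₁ junta
        α≤PF : ∀ ω → α ≤ O.P J F ω
        α≤PF ω = begin
          α                                                     ≤⟨ spread J (proj₁ (proj₂ junta)) (map (select z₀ z₀∈) ω) ⟩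
          P J (λ x → χ (A x)) (map (select z₀ z₀∈) ω)           ≡⟨ T-select z₀ z₀∈ t u (map χ J) (λ x → χ (A x)) ω ⟨
          O.P J (λ ω → χ (A (map (select z₀ z₀∈) ω))) ω        ≤⟨ O.T-mono (χ-units J) (A≤hit z₀ z₀∈ A) ω ⟩
          O.P J F ω ∎
        -- A hit at `map inj₂ y` is some a in A with a + y in Z₀ⁿ; if b = y - c lies in B, then a +
        -- b + c is a forbidden sum.
        miss : ∀ y → χ (B (zipWith _⊝_ y c)) ≤ 1ℚ - F (map inj₂ y)
        miss y = cases (B (zipWith _⊝_ y c)) refl (hits? A (map inj₂ y))
          where
          cases : ∀ b → B (zipWith _⊝_ y c) ≡ b → (h : Dec (Hits A (map inj₂ y))) → χ b ≤ 1ℚ - χ (does h)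
          cases true e (yes (a , Aa , a∈)) = ⊥-elim (avoids a (zipWith _⊝_ y c) Aa e (λ i →
            subst (_∈ Z₀) (cong (lookup a i ⊕_) (sym (trans (cong (_⊕ lookup c i) (Vec.lookup-zipWith _⊝_ i y c)) (⊝-⊕ (lookup y i) (lookup c i)))))
              (subst (lookup a i ∈Ω_) (Vec.lookup-map i inj₂ y) (a∈ i))))
          cases false e (yes _) = ≤-refl
          cases true  e (no _)  = ≤-refl
          cases false e (no _)  = 0≤1
        mass : β ≤ O.⟪ (λ ω → 1ℚ - F ω) ⟫
        mass = begin
          β                                              ≤⟨ dense ⟩
          ⟪ (λ x → χ (B x)) ⟫                            ≡⟨ translate c (λ x → χ (B x)) ⟨
          ⟪ (λ y → χ (B (zipWith _⊝_ y c))) ⟫            ≤⟨ 𝔼-mono (E n) miss ⟩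
          ⟪ (λ y → 1ℚ - F (map inj₂ y)) ⟫                ≡⟨ trans (𝔼-sub (E n) (λ _ → 1ℚ) (λ y → F (map inj₂ y))) (cong (_- ⟪ (λ y → F (map inj₂ y)) ⟫) (𝔼-1 (E n))) ⟩
          1ℚ - ⟪ (λ y → F (map inj₂ y)) ⟫                ≤⟨ +-monoʳ-≤ 1ℚ (neg-antimono-≤ (mean≤mean-right z₀ z₀∈ t u F (hit-mono A))) ⟩
          1ℚ - O.⟪ F ⟫                                   ≡⟨ trans (𝔼-sub (O.E n) (λ _ → 1ℚ) F) (cong (_- O.⟪ F ⟫) (𝔼-1 (O.E n))) ⟨
          O.⟪ (λ ω → 1ℚ - F ω) ⟫ ∎
        pointwise : ∀ ω → (1ℚ - F ω) * sq α ≤ sq (F ω - O.P J F ω)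
        pointwise ω = cases (does (hits? A ω)) (O.P J F ω) (α≤PF ω)
          where
          cases : ∀ b q → α ≤ q → (1ℚ - χ b) * sq α ≤ sq (χ b - q)
          cases true  q α≤q = ≤-trans (≤-reflexive (*-zeroˡ (sq α))) (0≤sq (1ℚ - q))
          cases false q α≤q = ≤-trans (≤-reflexive (*-identityˡ (sq α))) (≤-trans (*-mono (<⇒≤ 0<α) (≤-trans (<⇒≤ 0<α) α≤q) α≤q α≤q)
            (≤-reflexive (solve 1 (λ q → q :* q := (con 0ℚ :- q) :* (con 0ℚ :- q)) refl q)))
        lower : β * sq α ≤ O.‖ (λ ω → F ω - O.P J F ω) ‖²
        lower = begin
          β * sq α                                       ≤⟨ *-monoʳ (0≤sq α) mass ⟩
          O.⟪ (λ ω → 1ℚ - F ω) ⟫ * sq α                  ≡⟨ 𝔼-*ʳ (O.E n) (λ ω → 1ℚ - F ω) (sq α) ⟨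
          O.⟪ (λ ω → (1ℚ - F ω) * sq α) ⟫                ≤⟨ 𝔼-mono (O.E n) pointwise ⟩
          O.‖ (λ ω → F ω - O.P J F ω) ‖² ∎

  -- Energy increment

  anyBool? : ∀ {P : Bool → Set} → (∀ b → Dec (P b)) → Dec (∃ P)
  anyBool? {P} P? = decide (P? true) (P? false)
    where
    decide : Dec (P true) → Dec (P false) → Dec (∃ P)
    decide (yes p) _       = yes (true , p)
    decide (no _)  (yes q) = yes (false , q)
    decide (no ¬p) (no ¬q) = no λ { (true , p) → ¬p p ; (false , q) → ¬q q }

  ∣p∪q∣≤∣p∣+∣q∣ : ∀ {n} (p q : Subset n) → ∣ p ∪ q ∣ ℕ.≤ ∣ p ∣ ℕ.+ ∣ q ∣
  ∣p∪q∣≤∣p∣+∣q∣ []          []          = ℕ.z≤n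
  ∣p∪q∣≤∣p∣+∣q∣ (true ∷ p)  (true ∷ q)  = ℕ.s≤s (ℕ.≤-trans (∣p∪q∣≤∣p∣+∣q∣ p q) (ℕ.+-monoʳ-≤ ∣ p ∣ (ℕ.n≤1+n ∣ q ∣)))
  ∣p∪q∣≤∣p∣+∣q∣ (true ∷ p)  (false ∷ q) = ℕ.s≤s (∣p∪q∣≤∣p∣+∣q∣ p q)
  ∣p∪q∣≤∣p∣+∣q∣ (false ∷ p) (true ∷ q)  = ℕ.≤-trans (ℕ.s≤s (∣p∪q∣≤∣p∣+∣q∣ p q)) (ℕ.≤-reflexive (sym (ℕ.+-suc ∣ p ∣ ∣ q ∣)))
  ∣p∪q∣≤∣p∣+∣q∣ (false ∷ p) (false ∷ q) = ∣p∪q∣≤∣p∣+∣q∣ p q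

  infix 4 _≼_
  -- Inclusion as an equation, so that it rewrites the index J ∩ K produced by `P-P`.
  _≼_ : ∀ {n} → Subset n → Subset n → Set
  p ≼ q = p ∩ q ≡ p

  ≼-∪ˡ : ∀ {n} (p q : Subset n) → p ≼ p ∪ q
  ≼-∪ˡ p q = Subset.∩-abs-∪ p q

  ≼-∪ʳ : ∀ {n} (p q : Subset n) {r} → r ≼ q → r ≼ p ∪ q
  ≼-∪ʳ p q {r} e = trans (Subset.∩-distribˡ-∪ r p q) (trans (cong ((r ∩ p) ∪_) e)
    (trans (Subset.∪-comm (r ∩ p) r) (Subset.∪-abs-∩ r p)))

  ≼-∪-monoʳ : ∀ {n} (J : Subset n) {p q} → p ≼ q → J ∪ p ≼ J ∪ q
  ≼-∪-monoʳ J {p} {q} e = trans (sym (Subset.∪-distribˡ-∩ J p q)) (cong (J ∪_) e)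

  ≼-∪ˡ′ : ∀ {n} (p q : Subset n) {r} → r ≼ p → r ≼ p ∪ q
  ≼-∪ˡ′ p q {r} e = subst (r ≼_) (Subset.∪-comm q p) (≼-∪ʳ q p e)

  unionFin : ∀ {k n} → (Fin k → Subset n) → Subset n
  unionFin {zero}  f = ⊥
  unionFin {suc k} f = f zero ∪ unionFin (f ∘ suc)

  ∣unionFin∣≤ : ∀ {k n s} {f : Fin k → Subset n} → (∀ i → ∣ f i ∣ ℕ.≤ s) → ∣ unionFin f ∣ ℕ.≤ k ℕ.* s
  ∣unionFin∣≤ {zero} {n} p = ℕ.≤-reflexive (Subset.∣⊥∣≡0 n)
  ∣unionFin∣≤ {suc k} {f = f} p = ℕ.≤-trans (∣p∪q∣≤∣p∣+∣q∣ (f zero) (unionFin (f ∘ suc))) (ℕ.+-mono-≤ (p zero) (∣unionFin∣≤ (p ∘ suc)))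

  ≼-unionFin : ∀ {k n} (f : Fin k → Subset n) i {p} → p ≼ f i → p ≼ unionFin f
  ≼-unionFin f zero    e = ≼-∪ˡ′ (f zero) _ e
  ≼-unionFin f (suc i) e = ≼-∪ʳ (f zero) _ (≼-unionFin (f ∘ suc) i e)

  merge : ∀ {X : Set} {n} → Subset n → Vec X n → Vec X n → Vec X n
  merge []      []      []      = []
  merge (b ∷ J) (a ∷ x) (c ∷ y) = (if b then a else c) ∷ merge J x y

  merge-merge : ∀ {X : Set} {n} (J : Subset n) (x y z : Vec X n) → merge J (merge J x y) z ≡ merge J x z
  merge-merge []          []      []      []      = refl
  merge-merge (true ∷ J)  (a ∷ x) (b ∷ y) (c ∷ z) = cong (a ∷_) (merge-merge J x y z)
  merge-merge (false ∷ J) (a ∷ x) (b ∷ y) (c ∷ z) = cong (c ∷_) (merge-merge J x y z)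

  merge-idem : ∀ {X : Set} {n} (J : Subset n) (x : Vec X n) → merge J x x ≡ x
  merge-idem []          []      = refl
  merge-idem (true ∷ J)  (a ∷ x) = cong (a ∷_) (merge-idem J x)
  merge-idem (false ∷ J) (a ∷ x) = cong (a ∷_) (merge-idem J x)

  -- Freezing the coordinates outside J at d leaves only N ^ ∣ J ∣ sets S x to collect.
  collect : ∀ {N m n} → Fin N → Subset m → (Vec (Fin N) m → Subset n) → Subset n
  collect d []          S = S []
  collect d (true ∷ J)  S = unionFin (λ a → collect d J (λ x → S (a ∷ x)))
  collect d (false ∷ J) S = collect d J (λ x → S (d ∷ x))

  ∣collect∣≤ : ∀ {N m n s} (d : Fin N) (J : Subset m) {S : Vec (Fin N) m → Subset n} → (∀ x → ∣ S x ∣ ℕ.≤ s) →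
               ∣ collect d J S ∣ ℕ.≤ (N ℕ.^ ∣ J ∣) ℕ.* s
  ∣collect∣≤ {s = s} d [] p = ℕ.≤-trans (p []) (ℕ.≤-reflexive (sym (ℕ.*-identityˡ s)))
  ∣collect∣≤ {N} {s = s} d (true ∷ J) p = ℕ.≤-trans (∣unionFin∣≤ (λ a → ∣collect∣≤ d J (λ x → p (a ∷ x))))
    (ℕ.≤-reflexive (sym (ℕ.*-assoc N (N ℕ.^ ∣ J ∣) s)))
  ∣collect∣≤ d (false ∷ J) p = ∣collect∣≤ d J (λ x → p (d ∷ x))

  ≼-collect : ∀ {N m n} (d : Fin N) (J : Subset m) (S : Vec (Fin N) m → Subset n) x →
              S (merge J x (replicate m d)) ≼ collect d J S
  ≼-collect d []          S []      = Subset.∩-idem (S [])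
  ≼-collect d (true ∷ J)  S (a ∷ x) = ≼-unionFin _ a (≼-collect d J (λ x → S (a ∷ x)) x)
  ≼-collect d (false ∷ J) S (a ∷ x) = ≼-collect d J (λ x → S (d ∷ x)) x

  growth : ℕ → ℕ → ℕ → ℕ
  growth N s k = k ℕ.+ (N ℕ.^ k) ℕ.* s

  -- A maximum over all rounds, since `regularise` may stop at any of them.
  iterateGrowth : ℕ → ℕ → ℕ → ℕ → ℕ
  iterateGrowth N s zero    k = k
  iterateGrowth N s (suc r) k = k ℕ.⊔ iterateGrowth N s r (growth N s k)

  module EnergyIncrement (N : ℕ) (ν : ℚ) (0<ν : 0ℚ < ν) (Nν≡1 : ι N * ν ≡ 1ℚ) (d : Fin N) where

    open Uniform N ν 0<ν Nν≡1
    open Operators (Fin N) uniform uniform-commute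

    P-true : ∀ {n} (J : Subset n) f a x → P (true ∷ J) f (a ∷ x) ≡ P J (λ y → f (a ∷ y)) x
    P-true J f a x = solve 2 (λ u v → con 1ℚ :* u :+ (con 1ℚ :- con 1ℚ) :* v := u) refl
      (P J (λ y → f (a ∷ y)) x) (U (λ b → P J (λ y → f (b ∷ y)) x))

    P-false : ∀ {n} (J : Subset n) f a x → P (false ∷ J) f (a ∷ x) ≡ U (λ b → P J (λ y → f (b ∷ y)) x)
    P-false J f a x = solve 2 (λ u v → con 0ℚ :* u :+ (con 1ℚ :- con 0ℚ) :* v := v) refl
      (P J (λ y → f (a ∷ y)) x) (U (λ b → P J (λ y → f (b ∷ y)) x))

    P-restrict : ∀ {n} (J S : Subset n) f x y → P S (λ z → f (merge J x z)) y ≡ P (J ∪ S) f (merge J x y)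
    P-restrict []          []          f []      []      = refl
    P-restrict (true ∷ J)  (true ∷ S)  f (a ∷ x) (c ∷ y) = trans (P-true S (λ z → f (merge (true ∷ J) (a ∷ x) z)) c y)
      (trans (P-restrict J S (λ z → f (a ∷ z)) x y) (sym (P-true (J ∪ S) f a (merge J x y))))
    P-restrict (true ∷ J)  (false ∷ S) f (a ∷ x) (c ∷ y) = trans (P-false S (λ z → f (merge (true ∷ J) (a ∷ x) z)) c y)
      (trans (𝔼-const uniform _) (trans (P-restrict J S (λ z → f (a ∷ z)) x y) (sym (P-true (J ∪ S) f a (merge J x y)))))
    P-restrict (false ∷ J) (true ∷ S)  f (a ∷ x) (c ∷ y) = trans (P-true S (λ z → f (merge (false ∷ J) (a ∷ x) z)) c y)
      (trans (P-restrict J S (λ z → f (c ∷ z)) x y) (sym (P-true (J ∪ S) f c (merge J x y))))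
    P-restrict (false ∷ J) (false ∷ S) f (a ∷ x) (c ∷ y) = trans (P-false S (λ z → f (merge (false ∷ J) (a ∷ x) z)) c y)
      (trans (𝔼-cong uniform (λ b → P-restrict J S (λ z → f (b ∷ z)) x y)) (sym (P-false (J ∪ S) f c (merge J x y))))

    P-merge : ∀ {n} (J : Subset n) f x y → P J f (merge J x y) ≡ P J f x
    P-merge []          f []      []      = refl
    P-merge (true ∷ J)  f (a ∷ x) (c ∷ y) = trans (P-true J f a (merge J x y))
      (trans (P-merge J (λ z → f (a ∷ z)) x y) (sym (P-true J f a x)))
    P-merge (false ∷ J) f (a ∷ x) (c ∷ y) = trans (P-false J f c (merge J x y))
      (trans (𝔼-cong uniform (λ b → P-merge J (λ z → f (b ∷ z)) x y)) (sym (P-false J f a x)))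

    P-measurable : ∀ {n} (J : Subset n) f → (∀ x y → f (merge J x y) ≡ f x) → ∀ x → P J f x ≡ f x
    P-measurable []          f m []      = refl
    P-measurable (true ∷ J)  f m (a ∷ x) = trans (P-true J f a x) (P-measurable J (λ z → f (a ∷ z)) (λ x y → m (a ∷ x) (a ∷ y)) x)
    P-measurable (false ∷ J) f m (a ∷ x) = trans (P-false J f a x)
      (trans (𝔼-cong uniform (λ b → trans (P-measurable J (λ z → f (b ∷ z)) (λ x y → m (b ∷ x) (b ∷ y)) x)
        (trans (cong (λ z → f (b ∷ z)) (sym (merge-idem J x))) (m (a ∷ x) (b ∷ x))))) (𝔼-const uniform (f (a ∷ x))))

    P-fibre : ∀ {n} (J : Subset n) f x → P J f x ≡ ⟪ (λ y → f (merge J x y)) ⟫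
    P-fibre []          f []      = refl
    P-fibre (true ∷ J)  f (a ∷ x) = trans (P-true J f a x) (trans (P-fibre J (λ z → f (a ∷ z)) x) (sym (𝔼-const uniform _)))
    P-fibre (false ∷ J) f (a ∷ x) = trans (P-false J f a x) (𝔼-cong uniform (λ b → P-fibre J (λ z → f (b ∷ z)) x))

    -- Given the coordinates in J, prescribing those in S has probability at least ν^|S|, and f is
    -- nonnegative on the remainder. Coordinates common to J and S merely waste a factor ν ≤ 1.
    P-refine-lower : ∀ {n} (J S : Subset n) {f} → (∀ x → 0ℚ ≤ f x) → ∀ x y → pow ν ∣ S ∣ * P (J ∪ S) f (merge J x y) ≤ P J f x
    P-refine-lower [] [] p [] [] = ≤-reflexive (*-identityˡ _)
    P-refine-lower (true ∷ J) (s ∷ S) {f} p (a ∷ x) (c ∷ y) = begin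
      pow ν ∣ s ∷ S ∣ * P (true ∷ (J ∪ S)) f (a ∷ merge J x y)       ≡⟨ cong (pow ν ∣ s ∷ S ∣ *_) (P-true (J ∪ S) f a (merge J x y)) ⟩
      pow ν ∣ s ∷ S ∣ * P (J ∪ S) (λ z → f (a ∷ z)) (merge J x y)    ≤⟨ *-monoʳ (T-nonneg (χ-units (J ∪ S)) (λ z → p (a ∷ z)) (merge J x y)) (pow-anti (<⇒≤ 0<ν) (ν≤1 d) (size s)) ⟩
      pow ν ∣ S ∣ * P (J ∪ S) (λ z → f (a ∷ z)) (merge J x y)        ≤⟨ P-refine-lower J S (λ z → p (a ∷ z)) x y ⟩
      P J (λ z → f (a ∷ z)) x                                        ≡⟨ P-true J f a x ⟨
      P (true ∷ J) f (a ∷ x) ∎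
      where
      size : ∀ s → ∣ S ∣ ℕ.≤ ∣ s ∷ S ∣
      size true  = ℕ.n≤1+n ∣ S ∣
      size false = ℕ.≤-refl
    P-refine-lower (false ∷ J) (true ∷ S) {f} p (a ∷ x) (c ∷ y) = begin
      ν * pow ν ∣ S ∣ * P (true ∷ (J ∪ S)) f (c ∷ merge J x y)       ≡⟨ cong (ν * pow ν ∣ S ∣ *_) (P-true (J ∪ S) f c (merge J x y)) ⟩
      ν * pow ν ∣ S ∣ * P (J ∪ S) (λ z → f (c ∷ z)) (merge J x y)    ≡⟨ *-assoc ν (pow ν ∣ S ∣) _ ⟩
      ν * (pow ν ∣ S ∣ * P (J ∪ S) (λ z → f (c ∷ z)) (merge J x y))  ≤⟨ *-monoˡ (<⇒≤ 0<ν) (P-refine-lower J S (λ z → p (c ∷ z)) x y) ⟩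
      ν * P J (λ z → f (c ∷ z)) x                                    ≤⟨ U-weight (λ b → P J (λ z → f (b ∷ z)) x) (λ b → T-nonneg (χ-units J) (λ z → p (b ∷ z)) x) c ⟩
      U (λ b → P J (λ z → f (b ∷ z)) x)                              ≡⟨ P-false J f a x ⟨
      P (false ∷ J) f (a ∷ x) ∎
    P-refine-lower (false ∷ J) (false ∷ S) {f} p (a ∷ x) (c ∷ y) = begin
      pow ν ∣ S ∣ * P (false ∷ (J ∪ S)) f (c ∷ merge J x y)                     ≡⟨ cong (pow ν ∣ S ∣ *_) (P-false (J ∪ S) f c (merge J x y)) ⟩
      pow ν ∣ S ∣ * U (λ b → P (J ∪ S) (λ z → f (b ∷ z)) (merge J x y))         ≡⟨ 𝔼-* uniform (pow ν ∣ S ∣) _ ⟨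
      U (λ b → pow ν ∣ S ∣ * P (J ∪ S) (λ z → f (b ∷ z)) (merge J x y))         ≤⟨ 𝔼-mono uniform (λ b → P-refine-lower J S (λ z → p (b ∷ z)) x y) ⟩
      U (λ b → P J (λ z → f (b ∷ z)) x)                                         ≡⟨ P-false J f a x ⟨
      P (false ∷ J) f (a ∷ x) ∎

    -- The condition depends only on the fibre over J, so averaging over the fibre turns A into its
    -- density, which is below τ wherever the condition holds.
    below : ∀ {n} τ → 0ℚ ≤ τ → (J : Subset n) (A : Vec (Fin N) n → Bool) →
            ⟪ (λ x → χ (A x) * χ (does (P J (χ ∘ A) x <? τ))) ⟫ ≤ τ
    below {n} τ 0≤τ J A = begin
      ⟪ (λ x → χ (A x) * low x) ⟫              ≡⟨ 𝔼-cong (E n) (λ x → cong (χ (A x) *_) (P-measurable J low (λ x y → cong (λ v → χ (does (v <? τ))) (P-merge J (χ ∘ A) x y)) x)) ⟨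
      ⟪ (λ x → χ (A x) * P J low x) ⟫          ≡⟨ T-adj (map χ J) (χ ∘ A) low ⟨
      ⟪ (λ x → P J (χ ∘ A) x * low x) ⟫        ≤⟨ 𝔼-mono (E n) (λ x → cases (P J (χ ∘ A) x) (P J (χ ∘ A) x <? τ)) ⟩
      𝔼 (E n) (λ _ → τ)                        ≡⟨ 𝔼-const (E n) τ ⟩
      τ ∎
      where
      low : Vec (Fin N) n → ℚ
      low x = χ (does (P J (χ ∘ A) x <? τ))
      cases : ∀ v (l : Dec (v < τ)) → v * χ (does l) ≤ τ
      cases v (yes v<τ) = ≤-trans (≤-reflexive (*-identityʳ v)) (<⇒≤ v<τ)
      cases v (no _)    = ≤-trans (≤-reflexive (*-zeroʳ v)) 0≤τ

    module _ (s : ℕ) (α : ℚ) (0<α : 0ℚ < α) {n : ℕ} (A : Vec (Fin N) n → Bool) where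

      f : Vec (Fin N) n → ℚ
      f = χ ∘ A

      -- By `P-restrict` this negates spreadness of the fibre of A over x.
      Bad : Subset n → Vec (Fin N) n → Set
      Bad J x = ∃ λ S → ∣ S ∣ ℕ.≤ s × ∃ λ y → P (J ∪ S) f (merge J x y) < α

      bad? : ∀ J x → Dec (Bad J x)
      bad? J x = anyVec? anyBool? (λ S → (∣ S ∣ ℕ.≤? s) ×-dec anyVec? Fin.any? (λ y → P (J ∪ S) f (merge J x y) <? α))

      Bad-merge : ∀ J x y → Bad J x → Bad J (merge J x y)
      Bad-merge J x y (S , S≤ , z , p) = S , S≤ , z , subst (λ v → P (J ∪ S) f v < α) (sym (merge-merge J x y z)) p

      -- Density at least 2 α on the fibre against less than α on a restriction: this gap of α is
      -- the source of the energy gain.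
      denseBad? : ∀ J x → Dec (2ℚ * α ≤ P J f x × Bad J x)
      denseBad? J x = (2ℚ * α ≤? P J f x) ×-dec bad? J x

      badness : Subset n → ℚ
      badness J = ⟪ (λ x → χ (does (denseBad? J x))) ⟫

      energy≤1 : ∀ J → ‖ P J f ‖² ≤ 1ℚ
      energy≤1 J = ≤-trans (T-contract (χ-units J) f) (≤-trans (𝔼-mono (E n) (λ x → bit (A x))) (≤-reflexive (𝔼-1 (E n))))
        where
        bit : ∀ b → sq (χ b) ≤ 1ℚ
        bit true  = ≤-refl
        bit false = 0≤1

      witness : ∀ J x → Dec (Bad J x) → Subset n
      witness J x (yes (S , _)) = S
      witness J x (no _)        = ⊥

      ∣witness∣≤ : ∀ J x (b : Dec (Bad J x)) → ∣ witness J x b ∣ ℕ.≤ s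
      ∣witness∣≤ J x (yes (S , S≤ , _)) = S≤
      ∣witness∣≤ J x (no _) = ℕ.≤-trans (ℕ.≤-reflexive (Subset.∣⊥∣≡0 n)) ℕ.z≤n

      witness-low : ∀ J x (b : Dec (Bad J x)) → Bad J x → ∃ λ y → P (J ∪ witness J x b) f (merge J x y) < α
      witness-low J x (yes (S , _ , low)) _ = low
      witness-low J x (no ¬b) b = Empty.⊥-elim (¬b b)

      gain : ℚ
      gain = pow ν s * sq α

      refine : Subset n → Subset n
      refine J = J ∪ collect d J (λ x → witness J x (bad? J x))

      ∣refine∣≤ : ∀ J → ∣ refine J ∣ ℕ.≤ growth N s ∣ J ∣
      ∣refine∣≤ J = ℕ.≤-trans (∣p∪q∣≤∣p∣+∣q∣ J _) (ℕ.+-monoʳ-≤ ∣ J ∣ (∣collect∣≤ d J (λ x → ∣witness∣≤ J x (bad? J x))))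

      -- A witness S cuts out a part of the fibre, of relative weight at least ν^s, on which the
      -- mean of `P (refine J) f` differs from `P J f` by at least α; Jensen's inequality turns this
      -- gap into energy.
      local-gain : ∀ J x → χ (does (denseBad? J x)) * gain ≤ P J (λ z → sq (P (refine J) f z - P J f z)) x
      local-gain J x = cases (denseBad? J x)
        where
        J′ = refine J
        g : Vec (Fin N) n → ℚ
        g z = P J′ f z - P J f z
        found : 2ℚ * α ≤ P J f x → Bad J x → gain ≤ P J (λ z → sq (g z)) x
        found dense bad = begin
          pow ν s * sq α                            ≤⟨ *-mono (0≤pow s (<⇒≤ 0<ν)) (0≤sq (P K g x′)) (pow-anti (<⇒≤ 0<ν) (ν≤1 d) S≤s) gap² ⟩
          pow ν ∣ S ∣ * sq (P K g x′)               ≤⟨ *-monoˡ (0≤pow ∣ S ∣ (<⇒≤ 0<ν)) (T-jensen (χ-units K) g x′) ⟩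
          pow ν ∣ S ∣ * P K (λ z → sq (g z)) x′     ≤⟨ P-refine-lower J S (λ z → 0≤sq (g z)) x y ⟩
          P J (λ z → sq (g z)) x ∎
          where
          -- `refine` collects witnesses only at points equal to d outside J. Badness depends on the
          -- fibre alone, so x may be replaced by such a point.
          x̃ = merge J x (replicate n d)
          b = bad? J x̃
          S = witness J x̃ b
          S≤s : ∣ S ∣ ℕ.≤ s
          S≤s = ∣witness∣≤ J x̃ b
          low = witness-low J x̃ b (Bad-merge J x (replicate n d) bad)
          y = proj₁ low
          x′ = merge J x y
          K = J ∪ S
          PK<α : P K f x′ < α
          PK<α = subst (λ v → P K f v < α) (merge-merge J x (replicate n d) y) (proj₂ low)
          -- K lies between J and `refine J`, so `P K` turns `P J′ f` into `P K f` and fixes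
          -- `P J f`.
          PKg : P K g x′ ≡ P K f x′ - P J f x
          PKg = trans (T-sub (map χ K) (P J′ f) (P J f) x′) (cong₂ _-_
            (trans (P-P K J′ f x′) (cong (λ V → P V f x′) (≼-∪-monoʳ J {S} (≼-collect d J (λ x → witness J x (bad? J x)) x))))
            (trans (P-P K J f x′) (trans (cong (λ V → P V f x′) (trans (Subset.∩-comm K J) (Subset.∩-abs-∪ J S))) (P-merge J f x y))))
          gap² : sq α ≤ sq (P K g x′)
          gap² = subst (λ v → sq α ≤ sq v) (sym PKg) (≤-trans (*-mono (<⇒≤ 0<α) (≤-trans (<⇒≤ 0<α) α≤) α≤ α≤)
            (≤-reflexive (solve 2 (λ u v → (u :- v) :* (u :- v) := (v :- u) :* (v :- u)) refl (P J f x) (P K f x′))))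
            where
            α≤ : α ≤ P J f x - P K f x′
            α≤ = 0≤-⇒≤ (≤-trans (0≤+ (≤⇒0≤- dense) (≤⇒0≤- (<⇒≤ PK<α)))
              (≤-reflexive (solve 3 (λ u v a → (u :- con 2ℚ :* a) :+ (a :- v) := u :- v :- a) refl (P J f x) (P K f x′) α)))
        cases : (b : Dec (2ℚ * α ≤ P J f x × Bad J x)) → χ (does b) * gain ≤ P J (λ z → sq (g z)) x
        cases (yes (dense , bad)) = ≤-trans (≤-reflexive (*-identityˡ gain)) (found dense bad)
        cases (no _) = ≤-trans (≤-reflexive (*-zeroˡ gain)) (T-nonneg (χ-units J) (λ z → 0≤sq (g z)) x)

      energy-increment : ∀ J → ‖ P J f ‖² + badness J * gain ≤ ‖ P (refine J) f ‖²
      energy-increment J = 0≤-⇒≤ (≤-trans (≤⇒0≤- mean-gain) (≤-reflexive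
        (solve 3 (λ a b c → (a :- b) :- c := a :- (b :+ c)) refl ‖ P J′ f ‖² ‖ P J f ‖² (badness J * gain))))
        where
        J′ = refine J
        mean-gain : badness J * gain ≤ ‖ P J′ f ‖² - ‖ P J f ‖²
        mean-gain = begin
          badness J * gain                                       ≡⟨ 𝔼-*ʳ (E n) _ gain ⟨
          ⟪ (λ x → χ (does (denseBad? J x)) * gain) ⟫            ≤⟨ 𝔼-mono (E n) (local-gain J) ⟩
          ⟪ P J (λ z → sq (P J′ f z - P J f z)) ⟫                ≡⟨ T-mean (map χ J) _ ⟩
          ‖ (λ z → P J′ f z - P J f z) ‖²                        ≡⟨ 𝔼-cong (E n) (λ z → cong (λ v → sq (P J′ f z - v)) (PJ′ z)) ⟨
          ‖ (λ z → P J′ f z - P J (P J′ f) z) ‖²                 ≡⟨ pythagoras J (P J′ f) ⟩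
          ‖ P J′ f ‖² - ‖ P J (P J′ f) ‖²                        ≡⟨ cong (λ v → ‖ P J′ f ‖² - v) (𝔼-cong (E n) (λ z → cong sq (PJ′ z))) ⟩
          ‖ P J′ f ‖² - ‖ P J f ‖² ∎
          where
          PJ′ : ∀ z → P J (P J′ f) z ≡ P J f z
          PJ′ z = trans (P-P J J′ f z) (cong (λ V → P V f z) (≼-∪ˡ J _))

      -- Each refinement raises the energy ‖ P J f ‖² ≤ 1 by badness J * gain.
      regularise : ∀ r k J → 1 ℕ.≤ ∣ J ∣ → ∣ J ∣ ℕ.≤ k → 1ℚ < ‖ P J f ‖² + ι r * (2ℚ * α * gain) →
        Σ (Subset n) λ J′ → 1 ℕ.≤ ∣ J′ ∣ × ∣ J′ ∣ ℕ.≤ iterateGrowth N s r k × badness J′ ≤ 2ℚ * α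
      regularise zero k J 1≤J J≤k big = Empty.⊥-elim (≤⇒¬< (≤-trans
        (≤-reflexive (solve 2 (λ e g → e :+ con 0ℚ :* g := e) refl ‖ P J f ‖² (2ℚ * α * gain))) (energy≤1 J)) big)
      regularise (suc r) k J 1≤J J≤k big = decide (badness J ≤? 2ℚ * α)
        where
        N≥1 : ∀ {M} → Fin M → ℕ.NonZero M
        N≥1 {suc M} _ = _
        step : ¬ (badness J ≤ 2ℚ * α) → 1ℚ < ‖ P (refine J) f ‖² + ι r * (2ℚ * α * gain)
        step ¬small = <-≤-trans big (≤-trans (≤-by (0≤* (≤⇒0≤- (<⇒≤ (≰⇒> ¬small))) (0≤* (0≤pow s (<⇒≤ 0<ν)) (0≤sq α)))
            (solve 5 (λ e b a g r → ((e :+ b :* g) :+ r :* (con 2ℚ :* a :* g)) :- (e :+ (con 1ℚ :+ r) :* (con 2ℚ :* a :* g)) := (b :- con 2ℚ :* a) :* g) refl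
              ‖ P J f ‖² (badness J) α gain (ι r)))
          (+-monoˡ-≤ (ι r * (2ℚ * α * gain)) (energy-increment J)))
        decide : Dec (badness J ≤ 2ℚ * α) → _
        decide (yes small) = J , 1≤J , ℕ.≤-trans J≤k (ℕ.m≤m⊔n k _) , small
        decide (no ¬small) = finish (regularise r (growth N s k) (refine J) (ℕ.≤-trans 1≤J (Subset.∣p∣≤∣p∪q∣ J _))
            (ℕ.≤-trans (∣refine∣≤ J) (ℕ.+-mono-≤ J≤k (ℕ.*-monoˡ-≤ s (ℕ.^-monoʳ-≤ N {{N≥1 d}} J≤k)))) (step ¬small))
          where
          finish : (Σ (Subset n) λ J′ → 1 ℕ.≤ ∣ J′ ∣ × ∣ J′ ∣ ℕ.≤ iterateGrowth N s r (growth N s k) × badness J′ ≤ 2ℚ * α) → _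
          finish (J′ , 1≤J′ , J′≤ , small) = J′ , 1≤J′ , ℕ.≤-trans J′≤ (ℕ.m≤n⊔m k _) , small

  -- Juntas

  embed : ∀ {n} (J : Subset n) → Fin ∣ J ∣ → Fin n
  embed (true ∷ J)  zero    = zero
  embed (true ∷ J)  (suc i) = suc (embed J i)
  embed (false ∷ J) i       = suc (embed J i)

  embed-injective : ∀ {n} (J : Subset n) → Injective _≡_ _≡_ (embed J)
  embed-injective (true ∷ J)  {zero}  {zero}  e = refl
  embed-injective (true ∷ J)  {suc i} {suc j} e = cong suc (embed-injective J (Fin.suc-injective e))
  embed-injective (false ∷ J) {i}     {j}     e = embed-injective J (Fin.suc-injective e)

  embed-surjective : ∀ {n} (J : Subset n) i → lookup J i ≡ true → ∃ λ k → embed J k ≡ i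
  embed-surjective (true ∷ J)  zero    e = zero , refl
  embed-surjective (true ∷ J)  (suc i) e = suc (proj₁ r) , cong suc (proj₂ r)
    where r = embed-surjective J i e
  embed-surjective (false ∷ J) (suc i) e = proj₁ r , cong suc (proj₂ r)
    where r = embed-surjective J i e

  extend : ∀ {X : Set} {n} → X → (J : Subset n) → Vec X ∣ J ∣ → Vec X n
  extend d []          z       = []
  extend d (true ∷ J)  (a ∷ z) = a ∷ extend d J z
  extend d (false ∷ J) z       = d ∷ extend d J z

  lookup-extend : ∀ {X : Set} {n} (d : X) (J : Subset n) z k → lookup (extend d J z) (embed J k) ≡ lookup z k
  lookup-extend d (true ∷ J)  (a ∷ z) zero    = refl
  lookup-extend d (true ∷ J)  (a ∷ z) (suc k) = lookup-extend d J z k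
  lookup-extend d (false ∷ J) z       k       = lookup-extend d J z k

  merge-extend : ∀ {X : Set} {n} (d : X) (J : Subset n) x →
                 merge J (extend d J (tabulate (λ k → lookup x (embed J k)))) x ≡ x
  merge-extend d []          []      = refl
  merge-extend d (true ∷ J)  (a ∷ x) = cong (a ∷_) (merge-extend d J x)
  merge-extend d (false ∷ J) (a ∷ x) = cong (a ∷_) (merge-extend d J x)

  lookup-merge-in : ∀ {X : Set} {n} (J : Subset n) (x y : Vec X n) i → lookup J i ≡ true → lookup (merge J x y) i ≡ lookup x i
  lookup-merge-in (true ∷ J)  (a ∷ x) (c ∷ y) zero    e = refl
  lookup-merge-in (b ∷ J)     (a ∷ x) (c ∷ y) (suc i) e = lookup-merge-in J x y i e

  lookup-merge-out : ∀ {X : Set} {n} (J : Subset n) (x y : Vec X n) i → lookup J i ≡ false → lookup (merge J x y) i ≡ lookup y i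
  lookup-merge-out (false ∷ J) (a ∷ x) (c ∷ y) zero    e = refl
  lookup-merge-out (b ∷ J)     (a ∷ x) (c ∷ y) (suc i) e = lookup-merge-out J x y i e

  -- From uniform expectations to cardinalities

  module Counting (G : FiniteAbelianGroup) (ν : ℚ) (0<ν : 0ℚ < ν) (Nν≡1 : ι (FiniteAbelianGroup.order G) * ν ≡ 1ℚ) where

    open FiniteAbelianGroup G using (order)
    open SpreadSets G ν 0<ν Nν≡1
    open Uniform order ν 0<ν Nν≡1

    countB-++ : ∀ {A : Set} (P : A → Bool) xs ys → countB G P (xs ++ ys) ≡ countB G P xs ℕ.+ countB G P ys
    countB-++ P List.[]       ys = refl
    countB-++ P (x List.∷ xs) ys = trans (cong ((if P x then 1 else 0) ℕ.+_) (countB-++ P xs ys))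
      (sym (ℕ.+-assoc (if P x then 1 else 0) (countB G P xs) (countB G P ys)))

    countB-map : ∀ {A B : Set} (P : B → Bool) (h : A → B) xs → countB G P (List.map h xs) ≡ countB G (P ∘ h) xs
    countB-map P h List.[]       = refl
    countB-map P h (x List.∷ xs) = cong ((if P (h x) then 1 else 0) ℕ.+_) (countB-map P h xs)

    countB-concatMap : ∀ {A B : Set} (P : B → Bool) (h : A → List B) {k} (g : Fin k → A) →
      ι (countB G P (concatMap h (List.tabulate g))) ≡ sum (λ i → ι (countB G P (h (g i))))
    countB-concatMap P h {zero}  g = refl
    countB-concatMap P h {suc k} g = trans (cong ι (countB-++ P (h (g zero)) (concatMap h (List.tabulate (g ∘ suc)))))
      (trans (ι-+ (countB G P (h (g zero))) _) (cong (ι (countB G P (h (g zero))) +_) (countB-concatMap P h (g ∘ suc))))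

    ι-card : ∀ n (P : SubsetG^ G n) → ι (card G n P) ≡ pow (ι order) n * ⟪ (λ x → χ (P x)) ⟫
    ι-card zero P = bit (P [])
      where
      bit : ∀ b → ι ((if b then 1 else 0) ℕ.+ 0) ≡ 1ℚ * χ b
      bit true  = refl
      bit false = refl
    ι-card (suc n) P = trans (countB-concatMap P (λ a → List.map (a ∷_) (allElts G n)) id)
      (trans (sum-cong-≗ (λ a → trans (cong ι (countB-map P (a ∷_) (allElts G n))) (ι-card n (λ x → P (a ∷ x)))))
      (trans (sym (*-distribˡ-sum (pow (ι order) n) h)) scale))
      where
      h : Fin order → ℚ
      h a = ⟪ (λ x → χ (P (a ∷ x))) ⟫
      scale : pow (ι order) n * sum h ≡ ι order * pow (ι order) n * (ν * sum h)
      scale = trans (sym (*-identityˡ _)) (trans (cong (_* (pow (ι order) n * sum h)) (sym Nν≡1))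
        (solve 4 (λ N v p s → N :* v :* (p :* s) := N :* p :* (v :* s)) refl (ι order) ν (pow (ι order) n) (sum h)))

    -- Since 4 α = 1 / q, the density bound gives error 1 / q, which p ≥ 1 relaxes to p / q.
    card-bound : ∀ n (P : SubsetG^ G n) p q α → 1 ℕ.≤ p → 4ℚ * ι q * α ≡ 1ℚ →
      ⟪ (λ x → χ (P x)) ⟫ ≤ 4ℚ * α → q ℕ.* card G n P ℕ.≤ p ℕ.* (order ℕ.^ n)
    card-bound n P p q α 1≤p qα≡1 small = ι-cancel-≤ (begin
      ι (q ℕ.* card G n P)                                   ≡⟨ trans (ι-* q (card G n P)) (cong (ι q *_) (ι-card n P)) ⟩
      ι q * (pow (ι order) n * ⟪ (λ x → χ (P x)) ⟫)          ≤⟨ *-monoˡ (0≤ι q) (*-monoˡ (0≤pow n (0≤ι order)) small) ⟩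
      ι q * (pow (ι order) n * (4ℚ * α))                     ≡⟨ solve 4 (λ q a x f → q :* (x :* (f :* a)) := f :* q :* a :* x) refl (ι q) α (pow (ι order) n) 4ℚ ⟩
      4ℚ * ι q * α * pow (ι order) n                         ≡⟨ trans (cong (_* pow (ι order) n) qα≡1) (*-identityˡ _) ⟩
      pow (ι order) n                                        ≡⟨ ι-^ order n ⟨
      ι (order ℕ.^ n)                                        ≤⟨ ι-mono (ℕ.≤-trans (ℕ.≤-reflexive (sym (ℕ.*-identityˡ (order ℕ.^ n)))) (ℕ.*-monoˡ-≤ (order ℕ.^ n) 1≤p)) ⟩
      ι (p ℕ.* (order ℕ.^ n)) ∎)

  sumG-cong : ∀ G d {f g : Fin d → Fin (FiniteAbelianGroup.order G)} → (∀ j → f j ≡ g j) → sumG G d f ≡ sumG G d g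
  sumG-cong G zero    p = refl
  sumG-cong G (suc d) p = cong₂ (FiniteAbelianGroup._⊕_ G) (p zero) (sumG-cong G d (p ∘ suc))

  -- Juntas of good fibres

  module Conclusion (G : FiniteAbelianGroup) (ν : ℚ) (0<ν : 0ℚ < ν) (Nν≡1 : ι (FiniteAbelianGroup.order G) * ν ≡ 1ℚ)
                    (α : ℚ) (0<α : 0ℚ < α) where

    open FiniteAbelianGroup G
    open SpreadSets G ν 0<ν Nν≡1
    open EnergyIncrement order ν 0<ν Nν≡1 𝟘

    s : ℕ
    s = Constants.s (spreadness 0<α 0<α)

    module _ {d n : ℕ} (𝐄 : Fin (suc (suc d)) → SubsetG^ G n) (J : Subset n) where

      -- Only the first set has to be spread on its fibre, and it is asked for density 2 α because
      -- `badness` controls just the fibres that dense. The second needs density for `spread-meets`,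
      -- the others only a point in the fibre.
      Good : Fin (suc (suc d)) → Elt G n → Set
      Good zero    x = 2ℚ * α ≤ P J (λ y → χ (𝐄 zero y)) x × ¬ Bad s α 0<α (𝐄 zero) J x
      Good (suc j) x = α ≤ P J (λ y → χ (𝐄 (suc j) y)) x

      good? : ∀ j x → Dec (Good j x)
      good? zero    x = (2ℚ * α ≤? P J (λ y → χ (𝐄 zero y)) x) ×-dec ¬? (bad? s α 0<α (𝐄 zero) J x)
      good? (suc j) x = α ≤? P J (λ y → χ (𝐄 (suc j) y)) x

      Good-merge : ∀ j x y → Good j (merge J x y) → Good j x
      Good-merge zero    x y (p , q) = subst (2ℚ * α ≤_) (P-merge J (λ y → χ (𝐄 zero y)) x y) p , λ b → q (Bad-merge s α 0<α (𝐄 zero) J x y b)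
      Good-merge (suc j) x y p = subst (α ≤_) (P-merge J (λ y → χ (𝐄 (suc j) y)) x y) p

      -- The padding by 𝟘 is an arbitrary choice of a point in the fibre: by `Good-merge`, goodness
      -- depends only on the coordinates in J.
      junta : Fin (suc (suc d)) → SubsetG^ G ∣ J ∣
      junta j z = does (good? j (extend 𝟘 J z))

      inhabited : ∀ j x → α ≤ P J (λ y → χ (𝐄 j y)) x → ∃ λ y → 𝐄 j (merge J x y) ≡ true
      inhabited j x dense = decide (anyVec? Fin.any? (λ y → 𝐄 j (merge J x y) Bool.≟ true))
        where
        decide : Dec (∃ λ y → 𝐄 j (merge J x y) ≡ true) → ∃ λ y → 𝐄 j (merge J x y) ≡ true
        decide (yes found) = found
        decide (no none) = ⊥-elim (≤⇒¬< (≤-trans dense (≤-reflexive (trans (P-fibre J (λ y → χ (𝐄 j y)) x)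
            (trans (𝔼-cong (E n) (λ y → empty y (𝐄 j (merge J x y)) refl)) (𝔼-const (E n) 0ℚ))))) 0<α)
          where
          empty : ∀ y b → 𝐄 j (merge J x y) ≡ b → χ (𝐄 j (merge J x y)) ≡ 0ℚ
          empty y true  e = ⊥-elim (none (y , e))
          empty y false e = cong χ e

      -- A configuration e with all sums over J in Z₀ would extend to a forbidden one on [n]: choose
      -- a point in each fibre from the third on, take their sum as the translation, and let
      -- `spread-meets` supply points of the first two fibres. The fibres are kept as subsets of G^n
      -- that ignore J, so the sums it provides are used outside J only.
      junta-avoids : ∀ {Z₀ z₀} → z₀ ∈ Z₀ → ¬ InStrictCoset G Z₀ →
                     SumsetAvoids G (suc (suc d)) n 𝐄 Z₀ → SumsetAvoids G (suc (suc d)) ∣ J ∣ junta Z₀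
      junta-avoids {Z₀} z₀∈ ¬coset avoids (e , e∈ , sums∈) = spread-meets 0<α 0<α z₀∈ ¬coset
        (λ y → 𝐄 zero (merge J (x zero) y)) (λ y → 𝐄 (suc zero) (merge J (x (suc zero)) y)) (tabulate rest) spread dense meet
        where
        x : Fin (suc (suc d)) → Elt G n
        x j = extend 𝟘 J (e j)
        good : ∀ j → Good j (x j)
        good j = witness′ (good? j (x j)) (e∈ j)
          where
          witness′ : ∀ {Q : Set} (q? : Dec Q) → does q? ≡ true → Q
          witness′ (yes q) _ = q
        y : Fin d → Elt G n
        y j = proj₁ (inhabited (suc (suc j)) (x (suc (suc j))) (good (suc (suc j))))
        rest : Fin n → Fin order
        rest i = sumG G d (λ j → lookup (y j) i)
        spread : Spread s α (λ y → 𝐄 zero (merge J (x zero) y))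
        spread S S≤s y = ≤-trans (≮⇒≥ (λ low → proj₂ (good zero) (S , S≤s , y , low)))
          (≤-reflexive (sym (P-restrict J S (λ z → χ (𝐄 zero z)) (x zero) y)))
        dense : α ≤ ⟪ (λ y → χ (𝐄 (suc zero) (merge J (x (suc zero)) y))) ⟫
        dense = ≤-trans (good (suc zero)) (≤-reflexive (P-fibre J (λ z → χ (𝐄 (suc zero) z)) (x (suc zero))))
        meet : ∀ a b → 𝐄 zero (merge J (x zero) a) ≡ true → 𝐄 (suc zero) (merge J (x (suc zero)) b) ≡ true →
               ¬ (∀ i → (lookup a i ⊕ (lookup b i ⊕ lookup (tabulate rest) i)) ∈ Z₀)
        meet a b a∈ b∈ abc∈ = avoids ((λ j → merge J (x j) (w j)) , w∈ , λ i → at i (lookup J i) refl)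
          where
          w : Fin (suc (suc d)) → Elt G n
          w zero          = a
          w (suc zero)    = b
          w (suc (suc j)) = y j
          w∈ : ∀ j → 𝐄 j (merge J (x j) (w j)) ≡ true
          w∈ zero          = a∈
          w∈ (suc zero)    = b∈
          w∈ (suc (suc j)) = proj₂ (inhabited (suc (suc j)) (x (suc (suc j))) (good (suc (suc j))))
          at : ∀ i b → lookup J i ≡ b → sumG G (suc (suc d)) (λ j → lookup (merge J (x j) (w j)) i) ∈ Z₀
          at i true Ji = subst (_∈ Z₀) (sumG-cong G (suc (suc d)) (λ j → sym (trans (lookup-merge-in J (x j) (w j) i Ji)
              (trans (cong (lookup (x j)) (sym (proj₂ k))) (lookup-extend 𝟘 J (e j) (proj₁ k)))))) (sums∈ (proj₁ k))
            where k = embed-surjective J i Ji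
          at i false Ji = subst (_∈ Z₀) (trans (cong (λ v → lookup a i ⊕ (lookup b i ⊕ v)) (Vec.lookup∘tabulate rest i))
            (sumG-cong G (suc (suc d)) (λ j → sym (lookup-merge-out J (x j) (w j) i Ji)) )) (abc∈ i)

      lost : ∀ j x → Bool
      lost j = diffCyl G (embed J) (𝐄 j) (junta j)

      lost-pointwise : ∀ j x c → 0ℚ ≤ c → (¬ Good j x → χ (𝐄 j x) ≤ c) → χ (lost j x) ≤ c
      lost-pointwise j x c 0≤c bound = cases (𝐄 j x) refl (good? j x′)
        where
        x′ = extend 𝟘 J (restrict G (embed J) x)
        cases : ∀ b → 𝐄 j x ≡ b → (g : Dec (Good j x′)) → χ (if b then (if does g then false else true) else false) ≤ c
        cases true  e (yes _) = 0≤c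
        cases true  e (no ¬g) = subst (λ b → χ b ≤ c) e (bound (λ g → ¬g (Good-merge j x′ x (subst (Good j) (sym (merge-extend 𝟘 J x)) g))))
        cases false e _       = 0≤c

      low : ∀ τ j → Elt G n → ℚ
      low τ j x = χ (𝐄 j x) * χ (does (P J (λ y → χ (𝐄 j y)) x <? τ))

      0≤low : ∀ τ j x → 0ℚ ≤ low τ j x
      0≤low τ j x = 0≤* (proj₁ (χ-unit (𝐄 j x))) (proj₁ (χ-unit (does (P J (λ y → χ (𝐄 j y)) x <? τ))))

      low-bound : ∀ τ j x → ¬ (τ ≤ P J (λ y → χ (𝐄 j y)) x) → χ (𝐄 j x) ≤ low τ j x
      low-bound τ j x ¬dense = cases (P J (λ y → χ (𝐄 j y)) x <? τ)
        where
        cases : (l : Dec (P J (λ y → χ (𝐄 j y)) x < τ)) → χ (𝐄 j x) ≤ χ (𝐄 j x) * χ (does l)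
        cases (yes _)  = ≤-reflexive (sym (*-identityʳ (χ (𝐄 j x))))
        cases (no ¬low) = ⊥-elim (¬low (≰⇒> ¬dense))

      -- The first set loses at most 2 α in sparse fibres and 2 α in dense fibres that are not
      -- spread; the others lose only sparse fibres, at most α.
      lost-small : badness s α 0<α (𝐄 zero) J ≤ 2ℚ * α → ∀ j → ⟪ (λ x → χ (lost j x)) ⟫ ≤ 4ℚ * α
      lost-small few-bad zero = begin
        ⟪ (λ x → χ (lost zero x)) ⟫                        ≤⟨ 𝔼-mono (E n) (λ x → lost-pointwise zero x (low τ zero x + bad x)
                                                                (0≤+ (0≤low τ zero x) (0≤bad x)) (pointwise x)) ⟩
        ⟪ (λ x → low τ zero x + bad x) ⟫                   ≡⟨ 𝔼-+ (E n) (low τ zero) bad ⟩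
        ⟪ low τ zero ⟫ + ⟪ bad ⟫                           ≤⟨ +-mono-≤ (below τ 0≤τ J (𝐄 zero)) few-bad ⟩
        τ + τ                                              ≡⟨ *-distribʳ-+ α 2ℚ 2ℚ ⟨
        4ℚ * α ∎
        where
        τ = 2ℚ * α
        0≤τ = 0≤* 0≤2 (<⇒≤ 0<α)
        bad : Elt G n → ℚ
        bad x = χ (does (denseBad? s α 0<α (𝐄 zero) J x))
        0≤bad : ∀ x → 0ℚ ≤ bad x
        0≤bad x = proj₁ (χ-unit (does (denseBad? s α 0<α (𝐄 zero) J x)))
        pointwise : ∀ x → ¬ Good zero x → χ (𝐄 zero x) ≤ low τ zero x + bad x
        pointwise x ¬good = cases (τ ≤? P J (λ y → χ (𝐄 zero y)) x)
          where
          cases : Dec (τ ≤ P J (λ y → χ (𝐄 zero y)) x) → χ (𝐄 zero x) ≤ low τ zero x + bad x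
          cases (no ¬dense) = ≤-trans (low-bound τ zero x ¬dense) (subst (_≤ low τ zero x + bad x) (+-identityʳ (low τ zero x))
            (+-monoʳ-≤ (low τ zero x) (0≤bad x)))
          cases (yes dense) = subst (_≤ low τ zero x + bad x) (+-identityˡ (χ (𝐄 zero x))) (+-mono-≤ (0≤low τ zero x)
            (≤-trans (proj₂ (χ-unit (𝐄 zero x))) (≤-reflexive (sym (cong χ (Dec.dec-true (denseBad? s α 0<α (𝐄 zero) J x)
              (dense , Dec.decidable-stable (bad? s α 0<α (𝐄 zero) J x) (λ ¬bad → ¬good (dense , ¬bad)))))))))
      lost-small few-bad (suc j) = begin
        ⟪ (λ x → χ (lost (suc j) x)) ⟫                     ≤⟨ 𝔼-mono (E n) (λ x → lost-pointwise (suc j) x (low α (suc j) x)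
                                                                (0≤low α (suc j) x) (low-bound α (suc j) x)) ⟩
        ⟪ low α (suc j) ⟫                                  ≤⟨ below α (<⇒≤ 0<α) J (𝐄 (suc j)) ⟩
        α                                                  ≡⟨ *-identityˡ α ⟨
        1ℚ * α                                             ≤⟨ *-monoʳ (<⇒≤ 0<α) (≤ᵇ⇒≤ {1ℚ} {4ℚ} _) ⟩
        4ℚ * α ∎

open Development
open Expectation
open import Defs
open import Data.Rational as ℚ using (ℚ; 0ℚ; 1ℚ)
import Data.Rational.Properties as ℚ
open import Data.Rational.Solver using (module +-*-Solver)
open import Data.Bool using (true; false; if_then_else_)
open import Data.Fin using (Fin; zero; suc)
open import Data.Fin.Subset using (Subset; _∈_; ∣_∣; ⁅_⁆)
import Data.Fin.Subset.Properties as Subset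
open import Data.Nat using (ℕ; zero; suc; _*_; _^_; _≤_; _<_; z≤n; s≤s)
import Data.Nat.Properties as ℕ
open import Data.Product using (Σ; ∃; _×_; _,_; proj₁; proj₂)
open import Relation.Nullary using (¬_; Dec; yes; no)
open import Function.Definitions using (Injective)
open import Relation.Binary.PropositionalEquality using (_≡_; refl; sym; trans; cong; subst)
open +-*-Solver using (solve; con; _:=_; _:+_; _:*_)

-- Assembly and the final constant

module Theorem (G : FiniteAbelianGroup) (ν : ℚ) (0<ν : 0ℚ ℚ.< ν) (Nν≡1 : ι (FiniteAbelianGroup.order G) ℚ.* ν ≡ 1ℚ)
               (q : ℕ) (α : ℚ) (0<α : 0ℚ ℚ.< α) (qα≡1 : 4ℚ ℚ.* ι q ℚ.* α ≡ 1ℚ) where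

  open FiniteAbelianGroup G
  open Counting G ν 0<ν Nν≡1 using (card-bound)
  open Conclusion G ν 0<ν Nν≡1 α 0<α
  open EnergyIncrement order ν 0<ν Nν≡1 𝟘
  open SpreadSets G ν 0<ν Nν≡1 using (E; P; ⟪_⟫; ‖_‖²)

  increment : ℚ
  increment = 2ℚ ℚ.* α ℚ.* (pow ν s ℚ.* sq α)

  rounds : Σ ℕ λ r → 1ℚ ℚ.< ι r ℚ.* increment
  rounds = count (1/-pos increment 0<increment)
    where
    0<increment : 0ℚ ℚ.< increment
    0<increment = 0<* (0<* (ℚ.positive⁻¹ 2ℚ) 0<α) (0<* (0<pow s 0<ν) (0<* 0<α 0<α))
    count : (Σ ℚ λ y → 0ℚ ℚ.< y × increment ℚ.* y ≡ 1ℚ) → Σ ℕ λ r → 1ℚ ℚ.< ι r ℚ.* increment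
    -- One round beyond 1 / increment makes the inequality strict.
    count (y , 0<y , e) = suc r , ℚ.<-≤-trans (subst (ℚ._< 1ℚ ℚ.+ increment) (ℚ.+-identityʳ 1ℚ) (ℚ.+-monoʳ-< 1ℚ 0<increment))
      (ℚ.≤-trans (ℚ.+-monoˡ-≤ increment (ℚ.≤-trans (ℚ.≤-reflexive (sym e)) (*-monoˡ (ℚ.<⇒≤ 0<increment) (proj₂ (archimedean y)))))
        (ℚ.≤-reflexive (solve 2 (λ g r → g :* r :+ g := (con 1ℚ :+ r) :* g) refl increment (ι r))))
      where r = proj₁ (archimedean y)

  bound : ℕ
  bound = iterateGrowth order s (proj₁ rounds) 1

  -- With two successors, k = 1 is admissible whatever `bound` is, as the case of empty Z₀ requires.
  Approximation : ∀ (p d n : ℕ) → Subset order → (Fin d → SubsetG^ G n) → Set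
  Approximation p d n Z₀ 𝐄 =
    Σ ℕ λ k → Σ (Fin k → Fin n) λ e → Injective _≡_ _≡_ e × 0 < k × k < suc (suc bound) ×
    Σ (Fin d → SubsetG^ G k) λ 𝐄′ →
    ((j : Fin d) → q * card G n (diffCyl G e (𝐄 j) (𝐄′ j)) ≤ p * (order ^ n)) × SumsetAvoids G d k 𝐄′ Z₀

  approximate-nonempty : ∀ {p d n} → 1 ≤ p → (Z₀ : Subset order) → ¬ InStrictCoset G Z₀ → (∃ λ z → z ∈ Z₀) →
    (𝐄 : Fin (suc (suc d)) → SubsetG^ G (suc n)) → SumsetAvoids G (suc (suc d)) (suc n) 𝐄 Z₀ → Approximation p (suc (suc d)) (suc n) Z₀ 𝐄
  approximate-nonempty {p} {d} {n} 1≤p Z₀ ¬coset (z₀ , z₀∈) 𝐄 avoids =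
    -- Starting from one coordinate rather than none ensures 0 < |I|, as refinement only adds
    -- coordinates.
    conclude (regularise s α 0<α (𝐄 zero) (proj₁ rounds) 1 ⁅ zero ⁆ (ℕ.≤-reflexive (sym one)) (ℕ.≤-reflexive one) start)
    where
    one : ∣ ⁅ zero {n} ⁆ ∣ ≡ 1
    one = Subset.∣⁅x⁆∣≡1 (zero {n})
    energy = ‖ P ⁅ zero ⁆ (λ x → χ (𝐄 zero x)) ‖²
    start : 1ℚ ℚ.< energy ℚ.+ ι (proj₁ rounds) ℚ.* increment
    start = ℚ.<-≤-trans (proj₂ rounds) (subst (ℚ._≤ energy ℚ.+ ι (proj₁ rounds) ℚ.* increment) (ℚ.+-identityˡ _)
      (ℚ.+-monoˡ-≤ (ι (proj₁ rounds) ℚ.* increment) (𝔼-nonneg (E (suc n)) (λ x → 0≤sq (P ⁅ zero ⁆ (λ x → χ (𝐄 zero x)) x)))))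
    conclude : (Σ (Subset (suc n)) λ J → 1 ≤ ∣ J ∣ × ∣ J ∣ ≤ bound × badness s α 0<α (𝐄 zero) J ℚ.≤ 2ℚ ℚ.* α) →
               Approximation p (suc (suc d)) (suc n) Z₀ 𝐄
    conclude (J , 1≤J , J≤ , few-bad) = ∣ J ∣ , embed J , embed-injective J , 1≤J , s≤s (ℕ.≤-trans J≤ (ℕ.n≤1+n bound)) ,
      junta 𝐄 J ,
      (λ j → card-bound (suc n) (lost 𝐄 J j) p q α 1≤p qα≡1 (lost-small 𝐄 J few-bad j)) ,
      junta-avoids 𝐄 J z₀∈ ¬coset avoids

  approximate-empty : ∀ {p d n} → 1 ≤ p → (Z₀ : Subset order) → ¬ (∃ λ z → z ∈ Z₀) →
    (𝐄 : Fin d → SubsetG^ G (suc n)) → Approximation p d (suc n) Z₀ 𝐄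
  approximate-empty {p} {n = n} 1≤p Z₀ empty 𝐄 = 1 , (λ _ → zero) , (λ { {zero} {zero} _ → refl }) , s≤s z≤n , s≤s (s≤s z≤n) ,
    (λ _ _ → true) , (λ j → card-bound (suc n) (λ x → if 𝐄 j x then false else false) p q α 1≤p qα≡1 (nothing-lost j)) , λ (_ , _ , sums∈) → empty (_ , sums∈ zero)
    where
    nothing-lost : ∀ j → ⟪ (λ x → χ (if 𝐄 j x then false else false)) ⟫ ℚ.≤ 4ℚ ℚ.* α
    nothing-lost j = ℚ.≤-trans (ℚ.≤-reflexive (trans (𝔼-cong (E (suc n)) (λ x → zer (𝐄 j x))) (𝔼-const (E (suc n)) 0ℚ)))
      (ℚ.<⇒≤ (0<* (ℚ.positive⁻¹ 4ℚ) 0<α))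
      where
      zer : ∀ b → χ (if b then false else false) ≡ 0ℚ
      zer true  = refl
      zer false = refl

  approximate : ∀ {p d} n → 1 ≤ n → 1 ≤ p → (Z₀ : Subset order) → ¬ InStrictCoset G Z₀ →
    (𝐄 : Fin (suc (suc d)) → SubsetG^ G n) → SumsetAvoids G (suc (suc d)) n 𝐄 Z₀ → Approximation p (suc (suc d)) n Z₀ 𝐄
  approximate {p} {d} (suc n) _ 1≤p Z₀ ¬coset 𝐄 avoids = decide (Subset.nonempty? Z₀)
    where
    decide : Dec (∃ λ z → z ∈ Z₀) → Approximation p (suc (suc d)) (suc n) Z₀ 𝐄
    decide (yes nonempty) = approximate-nonempty 1≤p Z₀ ¬coset nonempty 𝐄 avoids
    decide (no empty)     = approximate-empty 1≤p Z₀ empty 𝐄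

0<ι : ∀ {n} → Fin n → 0ℚ ℚ.< ι n
0<ι {suc n} _ = 0<ιsuc n

theorem1p3 : (d : ℕ) → 2 ≤ d → (G : FiniteAbelianGroup) →
    (p q : ℕ) → 1 ≤ p → 1 ≤ q →
    Σ ℕ λ C → (n : ℕ) → 1 ≤ n →
    (Z₀ : Subset (FiniteAbelianGroup.order G)) → ¬ InStrictCoset G Z₀ →
    (E : Fin d → SubsetG^ G n) → SumsetAvoids G d n E Z₀ →
    Σ ℕ λ k → Σ (Fin k → Fin n) λ ι → Injective _≡_ _≡_ ι × 0 < k × k < C ×
    Σ (Fin d → SubsetG^ G k) λ E′ →
    ((j : Fin d) → q * card G n (diffCyl G ι (E j) (E′ j)) ≤ p * (FiniteAbelianGroup.order G ^ n))
    × SumsetAvoids G d k E′ Z₀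
theorem1p3 (suc (suc d)) (s≤s (s≤s z≤n)) G p (suc q) 1≤p _ =
  build (1/-pos (ι order) (0<ι 𝟘)) (1/-pos (4ℚ ℚ.* ι (suc q)) (0<* (ℚ.positive⁻¹ 4ℚ) (0<ιsuc q)))
  where
  open FiniteAbelianGroup G using (order; 𝟘)
  build : (Σ ℚ λ ν → 0ℚ ℚ.< ν × ι order ℚ.* ν ≡ 1ℚ) → (Σ ℚ λ α → 0ℚ ℚ.< α × 4ℚ ℚ.* ι (suc q) ℚ.* α ≡ 1ℚ) → _
  build (ν , 0<ν , Nν≡1) (α , 0<α , qα≡1) =
    -- `bound` comes from G and q alone, before n, Z₀ and the sets are given.
    suc (suc bound) , λ n 1≤n → approximate n 1≤n 1≤p
    where open Theorem G ν 0<ν Nν≡1 (suc q) α 0<α qα≡1
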